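{- There is an algorithm for the Vector Domination Problem and a function $s:(0,\infty)\to(0,1)$, polynomial in $\frac1c$ (in the sense that there exist absolute constants $\delta>0$ and $K>0$ with $s(c)\ge\delta\,c^{ -K}$ for all $c\ge1$), such that for inputs $A,B\subseteq\mathbb{R}^d$ with $|A|=|B|=N$ and $d=c\log N$ the algorithm runs in time $O\left(N^{2-s(c)}\right)$.
   Context: For vectors $u,v\in\mathbb{R}^d$, $u\ge v$ means $u_k\ge v_k$ for every coordinate $k=1,\dots,d$. The Vector Domination Problem is: given two finite sets $A,B$ of $d$-dimensional real vectors, find $u\in A$ and $v\in B$ such that $u\ge v$, or determine that no such pair exists. $\log$ denotes the logarithm to base $2$. Running time counts elementary operations, where arithmetic operations and comparisons on real numbers have unit cost. The parameter $c$ is treated as a constant (fixed as $N$ grows), and the constant hidden in $O(\cdot)$ may depend on $c$. -}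

module Defs where

open import Algebra.Bundles using (CommutativeRing; Semiring)
open import Algebra.Core using (Op₁; Op₂)
open import Algebra.Structures using (IsCommutativeRing)
open import Data.Empty using (⊥-elim)
open import Data.Fin.Base using (Fin)
open import Data.List.Base as List using (List)
open import Data.Nat.Base as ℕ using (ℕ; zero; suc; NonZero; z≤n; s≤s)
import Data.Nat.Properties as ℕₚ
open import Data.Product.Base using (∃; ∃-syntax; ∃₂; _×_; _,_; proj₁; proj₂)
open import Data.Sum.Base using (inj₁; inj₂)
open import Data.Vec.Base as Vec using (Vec; []; _∷_)
import Data.Vec.Membership.Setoid as Membership
import Data.Vec.Relation.Binary.Pointwise.Inductive as Pointwise
import Data.Vec.Relation.Unary.Unique.Setoid as Uniqueness
open import Relation.Binary.Bundles using (Setoid)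
open import Relation.Binary.Core using (Rel)
import Relation.Binary.Construct.NonStrictToStrict as ToStrict
open import Relation.Binary.PropositionalEquality as ≡ using (_≡_)
open import Relation.Binary.Structures using (IsDecTotalOrder)
open import Relation.Nullary using (¬_; yes; no)

------------------------------------------------------------------------
-- The real numbers

-- ℝ is axiomatised as a Dedekind-complete ordered field, which determines it
-- up to isomorphism.  Order and suprema are read classically: the order is
-- decidable, and a supremum comes with elements of the set above every
-- smaller number.  Equality is a setoid equality because ℝ is a quotient.

record Reals : Set₁ where
  infix  8 -_
  infixl 7 _*_
  infixl 6 _+_
  infix  4 _≈_ _≤_

  field
    Carrier           : Set
    _≈_               : Rel Carrier _
    _≤_               : Rel Carrier _
    _+_ _*_           : Op₂ Carrier
    -_                : Op₁ Carrier
    0# 1#             : Carrier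
    isCommutativeRing : IsCommutativeRing _≈_ _+_ _*_ -_ 0# 1#
    isDecTotalOrder   : IsDecTotalOrder _≈_ _≤_

  open ToStrict _≈_ _≤_ public using (_<_)

  field
    0≉1      : ¬ 0# ≈ 1#
    inv      : ∀ x → .(¬ x ≈ 0#) → Carrier
    *-inv    : ∀ x (x≉0 : ¬ x ≈ 0#) → x * inv x x≉0 ≈ 1#
    +-mono   : ∀ {x y} z → x ≤ y → x + z ≤ y + z
    *-nonneg : ∀ {x y} → 0# ≤ x → 0# ≤ y → 0# ≤ x * y

  IsSup : (Carrier → Set) → Carrier → Set
  IsSup S s = (∀ y → S y → y ≤ s) × (∀ u → u < s → ∃[ y ] S y × u < y)

  field
    complete : (S : Carrier → Set) → ∃ S → (∃[ b ] ∀ y → S y → y ≤ b) →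
               ∃ (IsSup S)

  commutativeRing : CommutativeRing _ _
  commutativeRing = record { isCommutativeRing = isCommutativeRing }

  open CommutativeRing commutativeRing public
    using (_-_; setoid; semiring; ring)

  open import Algebra.Definitions.RawSemiring (Semiring.rawSemiring semiring) public
    using (_^_) renaming (_×_ to _·_)

  fromℕ : ℕ → Carrier
  fromℕ n = n · 1#

  2# : Carrier
  2# = fromℕ 2

------------------------------------------------------------------------
-- Real powers and logarithms

module PowerLog (R : Reals) where
  open Reals R

  private
    open module CR = CommutativeRing commutativeRing
      using (refl; sym; trans; +-congˡ; +-congʳ; +-comm; +-assoc; +-identityˡ;
             +-identityʳ; -‿inverseˡ; -‿inverseʳ; *-congˡ; *-congʳ; *-comm;
             *-assoc; *-identityˡ; *-identityʳ; zeroˡ; zeroʳ; distribˡ)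
    open module DTO = IsDecTotalOrder isDecTotalOrder
      using (antisym; total; _≤?_; ≤-respˡ-≈; ≤-respʳ-≈)
      renaming (refl to ≤-refl; trans to ≤-trans; reflexive to ≤-reflexive)
    open import Algebra.Properties.Ring ring using ([y-z]x≈yx-zx)
    open import Algebra.Properties.Semiring.Mult semiring
      using (×-homo-+; ×1-homo-*)
    open import Algebra.Properties.Semiring.Exp semiring
      using (^-homo-*; ^-assocʳ)

  ≰⇒> : ∀ {x y} → ¬ x ≤ y → y < x
  ≰⇒> = ToStrict.≰⇒> _≈_ _≤_ sym ≤-reflexive total

  <⇒≱ : ∀ {x y} → x < y → ¬ y ≤ x
  <⇒≱ = ToStrict.<⇒≱ _≈_ _≤_ antisym

  cancel+ : ∀ y x → (y - x) + x ≈ y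
  cancel+ y x = trans (+-assoc y (- x) x) (trans (+-congˡ (-‿inverseˡ x)) (+-identityʳ y))

  +-monoʳ : ∀ {x y} z → x ≤ y → z + x ≤ z + y
  +-monoʳ z x≤y = ≤-respˡ-≈ (+-comm _ z) (≤-respʳ-≈ (+-comm _ z) (+-mono z x≤y))

  +-cancel : ∀ {x y} z → x + z ≤ y + z → x ≤ y
  +-cancel {x} {y} z h = ≤-respˡ-≈ (undo x) (≤-respʳ-≈ (undo y) (+-mono (- z) h))
    where
    undo : ∀ w → (w + z) + - z ≈ w
    undo w = trans (+-assoc w z (- z)) (trans (+-congˡ (-‿inverseʳ z)) (+-identityʳ w))

  ≤⇒0≤- : ∀ {x y} → x ≤ y → 0# ≤ y - x
  ≤⇒0≤- {x} x≤y = ≤-respˡ-≈ (-‿inverseʳ x) (+-mono (- x) x≤y)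

  0≤-⇒≤ : ∀ {x y} → 0# ≤ y - x → x ≤ y
  0≤-⇒≤ {x} {y} h = ≤-respˡ-≈ (+-identityˡ x) (≤-respʳ-≈ (cancel+ y x) (+-mono x h))

  *-mono : ∀ {x y} z → 0# ≤ z → x ≤ y → x * z ≤ y * z
  *-mono {x} {y} z 0≤z x≤y =
    0≤-⇒≤ (≤-respʳ-≈ ([y-z]x≈yx-zx z y x) (*-nonneg (≤⇒0≤- x≤y) 0≤z))

  *-monoʳ : ∀ {x y} z → 0# ≤ z → x ≤ y → z * x ≤ z * y
  *-monoʳ z 0≤z x≤y = ≤-respˡ-≈ (*-comm _ z) (≤-respʳ-≈ (*-comm _ z) (*-mono z 0≤z x≤y))

  *-cancel-≈ : ∀ {x y} z → ¬ z ≈ 0# → x * z ≈ y * z → x ≈ y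
  *-cancel-≈ {x} {y} z z≉0 h = trans (sym (undo x)) (trans (*-congʳ h) (undo y))
    where
    undo : ∀ w → (w * z) * inv z z≉0 ≈ w
    undo w = trans (*-assoc w z _) (trans (*-congˡ (*-inv z z≉0)) (*-identityʳ w))

  *-cancel : ∀ {x y} z → 0# < z → x * z ≤ y * z → x ≤ y
  *-cancel {x} {y} z (0≤z , 0≉z) h with x ≤? y
  ... | yes x≤y = x≤y
  ... | no x≰y = ⊥-elim (proj₂ y<x (*-cancel-≈ z (λ e → 0≉z (sym e))
                   (antisym (*-mono z 0≤z (proj₁ y<x)) h)))
    where y<x = ≰⇒> x≰y

  0≤1 : 0# ≤ 1#
  0≤1 with total 0# 1#
  ... | inj₁ p = p
  ... | inj₂ 1≤0 = ≤-respʳ-≈ square (*-nonneg 0≤-1 0≤-1)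
    where
    0≤-1 : 0# ≤ - 1#
    0≤-1 = ≤-respʳ-≈ (+-identityˡ (- 1#)) (≤⇒0≤- 1≤0)
    open import Algebra.Properties.Ring ring using (-‿distribˡ-*; -‿involutive)
    square : - 1# * - 1# ≈ 1#
    square = trans (sym (-‿distribˡ-* 1# (- 1#)))
               (trans (CR.-‿cong (*-identityˡ (- 1#))) (-‿involutive 1#))

  0<1 : 0# < 1#
  0<1 = 0≤1 , 0≉1

  x≤1+x : ∀ x → x ≤ 1# + x
  x≤1+x x = ≤-respˡ-≈ (+-identityˡ x) (+-mono x 0≤1)

  x<1+x : ∀ x → ¬ 1# + x ≤ x
  x<1+x x h = <⇒≱ 0<1 (+-cancel x (≤-respʳ-≈ (sym (+-identityˡ x)) h))

  0≤fromℕ : ∀ n → 0# ≤ fromℕ n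
  0≤fromℕ zero    = ≤-refl
  0≤fromℕ (suc n) = ≤-trans (0≤fromℕ n) (x≤1+x (fromℕ n))

  fromℕ-mono : ∀ {m n} → m ℕ.≤ n → fromℕ m ≤ fromℕ n
  fromℕ-mono {n = n} z≤n = 0≤fromℕ n
  fromℕ-mono (s≤s m≤n)   = +-monoʳ 1# (fromℕ-mono m≤n)

  fromℕ-reflects : ∀ {m n} → fromℕ m ≤ fromℕ n → m ℕ.≤ n
  fromℕ-reflects {m} {n} h with m ℕₚ.≤? n
  ... | yes m≤n = m≤n
  ... | no m≰n  = ⊥-elim (x<1+x _ (≤-trans (fromℕ-mono (ℕₚ.≰⇒> m≰n)) h))

  1≤fromℕ : ∀ n → .{{NonZero n}} → 1# ≤ fromℕ n
  1≤fromℕ (suc n) = ≤-respˡ-≈ (+-identityʳ 1#) (+-monoʳ 1# (0≤fromℕ n))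

  archimedean : ∀ x → ∃[ n ] x ≤ fromℕ n
  archimedean x with x ≤? 0#
  ... | yes x≤0 = 0 , x≤0
  ... | no x≰0 = witness
    where
    S : Carrier → Set
    S y = y ≤ x × ∃[ n ] y ≤ fromℕ n

    sup : ∃ (IsSup S)
    sup = complete S (0# , proj₁ (≰⇒> x≰0) , 0 , ≤-refl) (x , λ _ → proj₁)

    s : Carrier
    s = proj₁ sup

    s-1<s : s - 1# < s
    s-1<s = ≰⇒> λ h → x<1+x (s - 1#)
      (≤-respˡ-≈ (trans (sym (cancel+ s 1#)) (+-comm _ 1#)) h)

    witness : ∃[ n ] x ≤ fromℕ n
    witness with proj₂ (proj₂ sup) (s - 1#) s-1<s
    ... | y , (_ , n , y≤n) , s-1<y with x ≤? fromℕ (suc n)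
    ...   | yes h = suc n , h
    ...   | no h  = ⊥-elim (<⇒≱ s-1<y (≤-trans y≤n n≤s-1))
      where
      1+n≤s : 1# + fromℕ n ≤ s
      1+n≤s = proj₁ (proj₂ sup) (fromℕ (suc n)) (proj₁ (≰⇒> h) , suc n , ≤-refl)
      n≤s-1 : fromℕ n ≤ s - 1#
      n≤s-1 = +-cancel 1# (≤-respˡ-≈ (+-comm 1# _)
                (≤-respʳ-≈ (sym (cancel+ s 1#)) 1+n≤s))

  -- BelowPower b x y says 0 ≤ y ≤ b^((p − r)/q) for some rational
  -- (p − r)/q ≤ x, with denominators cleared.  Hence, for b ≥ 1, the supremum
  -- of these y is sup { b^t ∣ t ∈ ℚ, t ≤ x }, the usual definition of b^x.
  record BelowPower (b x y : Carrier) : Set where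
    constructor belowPower
    field
      p r q     : ℕ
      q≢0       : NonZero q
      exponent≤ : fromℕ p ≤ fromℕ r + fromℕ q * x
      0≤value   : 0# ≤ y
      value≤    : y ^ q * b ^ r ≤ b ^ p

  module _ {b : Carrier} (1≤b : 1# ≤ b) where

    1≤^ : ∀ n → 1# ≤ b ^ n
    1≤^ zero    = ≤-refl
    1≤^ (suc n) = ≤-trans (1≤^ n)
      (≤-respˡ-≈ (*-identityˡ _) (*-mono (b ^ n) (≤-trans 0≤1 (1≤^ n)) 1≤b))

    0<^ : ∀ n → 0# < b ^ n
    0<^ n = ≤-trans 0≤1 (1≤^ n) ,
      λ e → <⇒≱ 0<1 (≤-respʳ-≈ (sym e) (1≤^ n))

    ^-monoʳ : ∀ {m n} → m ℕ.≤ n → b ^ m ≤ b ^ n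
    ^-monoʳ {n = n} z≤n = 1≤^ n
    ^-monoʳ (s≤s m≤n)   = *-monoʳ b (≤-trans 0≤1 1≤b) (^-monoʳ m≤n)

  0≤^ : ∀ {x} n → 0# ≤ x → 0# ≤ x ^ n
  0≤^ zero    0≤x = 0≤1
  0≤^ (suc n) 0≤x = *-nonneg 0≤x (0≤^ n 0≤x)

  ^-monoˡ : ∀ {x y} n → 0# ≤ x → x ≤ y → x ^ n ≤ y ^ n
  ^-monoˡ zero    0≤x x≤y = ≤-refl
  ^-monoˡ (suc n) 0≤x x≤y = ≤-trans
    (*-mono _ (0≤^ n 0≤x) x≤y)
    (*-monoʳ _ (≤-trans 0≤x x≤y) (^-monoˡ n 0≤x x≤y))

  ^-reflects : ∀ {x y} n → NonZero n → 0# < x → y ^ n ≤ x ^ n → y ≤ x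
  ^-reflects {x} {y} (suc n) _ 0<x h with y ≤? x
  ... | yes y≤x = y≤x
  ... | no y≰x  = *-cancel (x ^ n) (0<xⁿ n)
    (≤-trans (*-monoʳ y (≤-trans 0≤x x≤y) (^-monoˡ n 0≤x x≤y)) h)
    where
    0≤x = proj₁ 0<x
    x≤y = proj₁ (≰⇒> y≰x)
    0<xⁿ : ∀ k → 0# < x ^ k
    0<xⁿ zero    = 0<1
    0<xⁿ (suc k) = *-nonneg 0≤x (proj₁ (0<xⁿ k)) ,
      λ e → proj₂ 0<x (*-cancel-≈ (x ^ k) (λ e′ → proj₂ (0<xⁿ k) (sym e′))
              (trans (zeroˡ _) e))

  belowPower-bound : ∀ {b x y} n → 1# ≤ b → x ≤ fromℕ n →
                     BelowPower b x y → y ≤ b ^ n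
  belowPower-bound {b} {x} {y} n 1≤b x≤n (belowPower p r q q≢0 e _ v) =
    ^-reflects q q≢0 (0<^ 1≤b n) (*-cancel (b ^ r) (0<^ 1≤b r) (≤-trans v bᵖ≤))
    where
    p≤r+nq : p ℕ.≤ r ℕ.+ n ℕ.* q
    p≤r+nq = fromℕ-reflects (≤-trans e (≤-trans
      (+-monoʳ (fromℕ r) (*-monoʳ (fromℕ q) (0≤fromℕ q) x≤n))
      (≤-reflexive (trans
        (+-congˡ (trans (*-comm (fromℕ q) (fromℕ n)) (sym (×1-homo-* n q))))
        (sym (×-homo-+ 1# r (n ℕ.* q)))))))
    bᵖ≤ : b ^ p ≤ (b ^ n) ^ q * b ^ r
    bᵖ≤ = ≤-trans (^-monoʳ 1≤b p≤r+nq) (≤-reflexive (trans (^-homo-* b r (n ℕ.* q))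
      (trans (*-comm _ _) (*-congʳ (sym (^-assocʳ b n q))))))

  pow-sup : ∀ b → 1# ≤ b → ∀ x → ∃ (IsSup (BelowPower b x))
  pow-sup b 1≤b x = complete (BelowPower b x) (0# , zero-below)
    (b ^ n , λ _ → belowPower-bound n 1≤b x≤n)
    where
    n = proj₁ (archimedean x)
    x≤n = proj₂ (archimedean x)
    r = proj₁ (archimedean (- x))
    zero-below : BelowPower b x 0#
    zero-below = belowPower 0 r 1 _
      (≤-respˡ-≈ (-‿inverseˡ x) (≤-trans (+-mono x (proj₂ (archimedean (- x))))
        (≤-reflexive (+-congˡ (trans (sym (*-identityˡ x))
          (*-congʳ (sym (+-identityʳ 1#))))))))
      ≤-refl
      (≤-respˡ-≈ (sym (trans (*-congʳ (zeroˡ 1#)) (zeroˡ (b ^ r)))) 0≤1)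

  pow : ∀ b → 1# ≤ b → Carrier → Carrier
  pow b 1≤b x = proj₁ (pow-sup b 1≤b x)

  pow-isSup : ∀ b 1≤b x → IsSup (BelowPower b x) (pow b 1≤b x)
  pow-isSup b 1≤b x = proj₂ (pow-sup b 1≤b x)

  sup≤ : ∀ {S s u} → IsSup S s → (∀ y → S y → y ≤ u) → s ≤ u
  sup≤ {s = s} {u} (_ , approx) bound with s ≤? u
  ... | yes s≤u = s≤u
  ... | no s≰u with approx u (≰⇒> s≰u)
  ...   | y , Sy , u<y = ⊥-elim (<⇒≱ u<y (bound y Sy))

  1≤2 : 1# ≤ 2#
  1≤2 = 1≤fromℕ 2

  fromℕ≤2^ : ∀ n → fromℕ (suc n) ≤ 2# ^ n
  fromℕ≤2^ zero    = ≤-reflexive (+-identityʳ 1#)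
  fromℕ≤2^ (suc n) = ≤-trans (+-mono (fromℕ (suc n)) (1≤^ 1≤2 n))
    (≤-trans (+-monoʳ (2# ^ n) (fromℕ≤2^ n)) (≤-reflexive (sym double)))
    where
    z = 2# ^ n
    double : 2# * z ≈ z + z
    double = trans (CR.distribʳ z 1# _) (CR.+-cong (*-identityˡ z)
      (trans (*-congʳ (+-identityʳ 1#)) (*-identityˡ z)))

  log₂-sup : ∀ y → 1# ≤ y → ∃ (IsSup (λ x → pow 2# 1≤2 x ≤ y))
  log₂-sup y 1≤y = complete _ (0# , pow0≤y) (fromℕ n , bound)
    where
    n = proj₁ (archimedean y)
    pow0≤y : pow 2# 1≤2 0# ≤ y
    pow0≤y = ≤-trans
      (sup≤ (pow-isSup 2# 1≤2 0#) (λ _ → belowPower-bound 0 1≤2 ≤-refl)) 1≤y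
    bound : ∀ x → pow 2# 1≤2 x ≤ y → x ≤ fromℕ n
    bound x h with total x (fromℕ n)
    ... | inj₁ x≤n = x≤n
    ... | inj₂ n≤x = ⊥-elim (x<1+x (fromℕ n) (≤-trans (fromℕ≤2^ n)
            (≤-trans 2ⁿ≤pow (≤-trans h (proj₂ (archimedean y))))))
      where
      2ⁿ≤pow : 2# ^ n ≤ pow 2# 1≤2 x
      2ⁿ≤pow = proj₁ (pow-isSup 2# 1≤2 x) (2# ^ n) (belowPower n 0 1 _
        (≤-trans n≤x (≤-reflexive (sym (trans (+-identityˡ _)
          (trans (*-congʳ (+-identityʳ 1#)) (*-identityˡ x))))))
        (≤-trans 0≤1 (1≤^ 1≤2 n))
        (≤-reflexive (trans (*-identityʳ _) (*-identityʳ _))))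

  log₂ : ∀ y → 1# ≤ y → Carrier
  log₂ y 1≤y = proj₁ (log₂-sup y 1≤y)

  log₂-isSup : ∀ y 1≤y → IsSup (λ x → pow 2# (1≤fromℕ 2) x ≤ y) (log₂ y 1≤y)
  log₂-isSup y 1≤y = proj₂ (log₂-sup y 1≤y)

  -- d = c log N, rounded down or up to an integer.
  _IsRounded_log_ : (d : ℕ) (c : Carrier) (N : ℕ) → .{{NonZero N}} → Set
  d IsRounded c log N =
    fromℕ d < c * log₂ (fromℕ N) (1≤fromℕ N) + 1# ×
    c * log₂ (fromℕ N) (1≤fromℕ N) < fromℕ d + 1#

------------------------------------------------------------------------
-- Programs

-- Algorithms are finite programs of mutually recursive first-order functions
-- over cells that are empty, hold one real number, or hold two references to
-- cells.  There is no integer type, no rounding and no indirection other than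
-- following references, so one evaluation step is O(1) elementary operations.

data Expr (arities : List ℕ) (n : ℕ) : Set where
  var            : Fin n → Expr arities n
  let′           : Expr arities n → Expr arities (suc n) → Expr arities n
  nil            : Expr arities n
  cons           : Expr arities n → Expr arities n → Expr arities n
  case           : Expr arities n → Expr arities n →
                   Expr arities (2 ℕ.+ n) → Expr arities n
  zero one       : Expr arities n
  add sub mul div : Expr arities n → Expr arities n → Expr arities n
  if_≤_then_else_ : Expr arities n → Expr arities n →
                    Expr arities n → Expr arities n → Expr arities n
  call           : (f : Fin (List.length arities)) →
                   Vec (Expr arities n) (List.lookup arities f) → Expr arities n

record Program (inputs : ℕ) : Set where
  field
    arities : List ℕ
    body    : (f : Fin (List.length arities)) →
              Expr arities (List.lookup arities f)
    main    : Expr arities inputs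

module Semantics (R : Reals) where
  open Reals R

  data Value : Set where
    nil  : Value
    real : Carrier → Value
    cons : Value → Value → Value

  module _ {inputs} (P : Program inputs) where
    open Program P

    mutual
      -- ρ ⊢ e ⇓ v ∣ t: in environment ρ, e evaluates to v in t steps.  Every
      -- evaluated node of the syntax tree is one step.  Evaluation is
      -- deterministic and partial: looping, division by zero and operands of
      -- the wrong shape give no result.
      infix 4 _⊢_⇓_∣_ _⊢*_⇓_∣_
      data _⊢_⇓_∣_ {n} (ρ : Vec Value n) : Expr arities n → Value → ℕ → Set where
        ⇓var  : ∀ {i} → ρ ⊢ var i ⇓ Vec.lookup ρ i ∣ 1
        ⇓let  : ∀ {e e′ v w t t′} → ρ ⊢ e ⇓ v ∣ t → (v ∷ ρ) ⊢ e′ ⇓ w ∣ t′ →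
                ρ ⊢ let′ e e′ ⇓ w ∣ suc (t ℕ.+ t′)
        ⇓nil  : ρ ⊢ nil ⇓ nil ∣ 1
        ⇓cons : ∀ {e e′ v w t t′} → ρ ⊢ e ⇓ v ∣ t → ρ ⊢ e′ ⇓ w ∣ t′ →
                ρ ⊢ cons e e′ ⇓ cons v w ∣ suc (t ℕ.+ t′)
        ⇓case-nil  : ∀ {e e₁ e₂ w t t′} →
                     ρ ⊢ e ⇓ nil ∣ t → ρ ⊢ e₁ ⇓ w ∣ t′ →
                     ρ ⊢ case e e₁ e₂ ⇓ w ∣ suc (t ℕ.+ t′)
        ⇓case-cons : ∀ {e e₁ e₂ v v′ w t t′} →
                     ρ ⊢ e ⇓ cons v v′ ∣ t → (v ∷ v′ ∷ ρ) ⊢ e₂ ⇓ w ∣ t′ →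
                     ρ ⊢ case e e₁ e₂ ⇓ w ∣ suc (t ℕ.+ t′)
        ⇓zero : ρ ⊢ zero ⇓ real 0# ∣ 1
        ⇓one  : ρ ⊢ one ⇓ real 1# ∣ 1
        ⇓add  : ∀ {e e′ x y t t′} → ρ ⊢ e ⇓ real x ∣ t → ρ ⊢ e′ ⇓ real y ∣ t′ →
                ρ ⊢ add e e′ ⇓ real (x + y) ∣ suc (t ℕ.+ t′)
        ⇓sub  : ∀ {e e′ x y t t′} → ρ ⊢ e ⇓ real x ∣ t → ρ ⊢ e′ ⇓ real y ∣ t′ →
                ρ ⊢ sub e e′ ⇓ real (x - y) ∣ suc (t ℕ.+ t′)
        ⇓mul  : ∀ {e e′ x y t t′} → ρ ⊢ e ⇓ real x ∣ t → ρ ⊢ e′ ⇓ real y ∣ t′ →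
                ρ ⊢ mul e e′ ⇓ real (x * y) ∣ suc (t ℕ.+ t′)
        ⇓div  : ∀ {e e′ x y t t′} → ρ ⊢ e ⇓ real x ∣ t → ρ ⊢ e′ ⇓ real y ∣ t′ →
                (y≉0 : ¬ y ≈ 0#) →
                ρ ⊢ div e e′ ⇓ real (x * inv y y≉0) ∣ suc (t ℕ.+ t′)
        ⇓then : ∀ {e e′ e₁ e₂ x y w t t′ t″} →
                ρ ⊢ e ⇓ real x ∣ t → ρ ⊢ e′ ⇓ real y ∣ t′ →
                x ≤ y → ρ ⊢ e₁ ⇓ w ∣ t″ →
                ρ ⊢ if e ≤ e′ then e₁ else e₂ ⇓ w ∣ suc (t ℕ.+ t′ ℕ.+ t″)
        ⇓else : ∀ {e e′ e₁ e₂ x y w t t′ t″} →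
                ρ ⊢ e ⇓ real x ∣ t → ρ ⊢ e′ ⇓ real y ∣ t′ →
                ¬ x ≤ y → ρ ⊢ e₂ ⇓ w ∣ t″ →
                ρ ⊢ if e ≤ e′ then e₁ else e₂ ⇓ w ∣ suc (t ℕ.+ t′ ℕ.+ t″)
        ⇓call : ∀ {f es vs w t t′} → ρ ⊢* es ⇓ vs ∣ t → vs ⊢ body f ⇓ w ∣ t′ →
                ρ ⊢ call f es ⇓ w ∣ suc (t ℕ.+ t′)

      data _⊢*_⇓_∣_ {n} (ρ : Vec Value n) :
             ∀ {k} → Vec (Expr arities n) k → Vec Value k → ℕ → Set where
        []  : ρ ⊢* [] ⇓ [] ∣ 0
        _∷_ : ∀ {k e v t t′} {es : Vec _ k} {vs} →
              ρ ⊢ e ⇓ v ∣ t → ρ ⊢* es ⇓ vs ∣ t′ →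
              ρ ⊢* e ∷ es ⇓ v ∷ vs ∣ t ℕ.+ t′

  Run : ∀ {inputs} → Program inputs → Vec Value inputs → Value → ℕ → Set
  Run P ρ v t = _⊢_⇓_∣_ P ρ (Program.main P) v t

------------------------------------------------------------------------
-- The Vector Domination Problem

module VectorDomination (R : Reals) where
  open Reals R
  open Semantics R

  Point : ℕ → Set
  Point d = Vec Carrier d

  pointSetoid : ℕ → Setoid _ _
  pointSetoid d = Pointwise.setoid setoid d

  -- u ≽ v is the coordinatewise u ≥ v.
  infix 4 _≽_
  _≽_ : ∀ {d} → Rel (Point d) _
  u ≽ v = ∀ k → Vec.lookup v k ≤ Vec.lookup u k

  -- A set of N points of ℝᵈ, listed without repetition in some order.
  record PointSet (d N : ℕ) : Set where
    field
      elements : Vec (Point d) N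
      distinct : Uniqueness.Unique (pointSetoid d) elements

  infix 4 _∈_
  _∈_ : ∀ {d N} → Point d → PointSet d N → Set
  u ∈ A = Membership._∈_ (pointSetoid _) u (PointSet.elements A)

  encodeList : ∀ {n} → Vec Value n → Value
  encodeList = Vec.foldr′ cons nil

  encodePoint : ∀ {d} → Point d → Value
  encodePoint u = encodeList (Vec.map real u)

  encodeSet : ∀ {d N} → PointSet d N → Value
  encodeSet A = encodeList (Vec.map encodePoint (PointSet.elements A))

  data IsAnswer {d M N} (A : PointSet d M) (B : PointSet d N) : Value → Set where
    found : ∀ {u v} → u ∈ A → v ∈ B → u ≽ v →
            IsAnswer A B (cons (encodePoint u) (encodePoint v))
    none  : (∀ {u v} → u ∈ A → v ∈ B → ¬ u ≽ v) → IsAnswer A B nil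

  RunOn : Program 2 → ∀ {d M N} → PointSet d M → PointSet d N → Value → ℕ → Set
  RunOn P A B = Run P (encodeSet A ∷ encodeSet B ∷ [])

  Solves : Program 2 → Set
  Solves P = ∀ {d M N} (A : PointSet d M) (B : PointSet d N) →
             ∃₂ λ answer t → RunOn P A B answer t × IsAnswer A B answer

  HaltsWithin : Program 2 → ∀ {d M N} → PointSet d M → PointSet d N → Carrier → Set
  HaltsWithin P A B bound =
    ∃₂ λ answer t → RunOn P A B answer t × fromℕ t ≤ bound

{-# OPTIONS --safe #-}

-- Let u ∈ A and v ∈ B be sought with u ≥ v.  Split A at the lowest 1/m of its
-- first coordinates into A₁ and A₂, at the threshold t, and B into the vectors
-- B₁ with first coordinate at most t and the others B₂.  No vector of A₁ is
-- above one of B₂, and for A₂ against B₁ the first coordinate can be dropped.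
-- So the pairs (A₁, B₁) and (A₂, B₂) are searched recursively in the same
-- dimension and (A₂, B₁) in the next lower one, down to depth J in splits,
-- where brute force takes over.
--
-- If B₂ is at least 1/m of B, a fraction 1/(2m²) of all pairs disappears.
-- Otherwise only a fraction 2/m of them goes through a split.  Weighting a pair
-- by 1 + 1/(2m²) for every split and by 1 − 2/m³ for every dropped coordinate
-- therefore gives a total weight that does not grow, and the leaves contain at
-- most N² (1 + 1/(2m²))^(−J) (1 − 2/m³)^(−d) pairs.  For d ≤ q log N this is
-- N^(2 − Ω(1/e⁵)) when e = 72 q, m = e² and J = (log N)/e, while the number of
-- nodes, with nearly linear work each, is only about √N.
module Submission where

-- The constants come from a balance. Let L be the binary length of N and h = e⁵. With m = e², J =
-- L/e splits earn an exponent of about L/(2h), while d ≤ qL dropped coordinates cost one of order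
-- qL/(eh): both live on the scale L/h, and the gain wins once e is a large enough multiple of q. A
-- large e also keeps the tree small, because the estimate of its size contains a factor 2^(18qJ).
-- The factor 72 meets both demands. The program knows neither c nor any integer. Its parameters are
-- lengths of lists: logarithms come from repeated halving, and quotients from walking along one
-- list while consuming another. In place of c it uses q = ⌊d/L⌋ + 1, read off the first vector; for
-- d rounded from c log N this is at most c + 2. The estimates stay in the natural numbers.
-- Denominators are cleared, and factors close to 1 are grouped into blocks worth a factor 2, so
-- that real powers appear only in the last step.

-- Running time in terms of the number of calls

module Evaluation where

  open import Defs
  open import Data.Nat.Base using (ℕ; suc; _+_; _*_; _≤_; s≤s)
  import Data.Nat.Properties as ℕₚ
  open import Data.Nat.Tactic.RingSolver using (solve-∀)
  open import Data.Vec.Base as Vec using (Vec; []; _∷_)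
  open import Relation.Binary.PropositionalEquality using (_≡_; cong)
  open import Relation.Nullary using (¬_)

  mutual
    size : ∀ {ar n} → Expr ar n → ℕ
    size (var _)                  = 1
    size (let′ e e′)              = suc (size e + size e′)
    size nil                      = 1
    size (cons e e′)              = suc (size e + size e′)
    size (case e e₁ e₂)           = suc (size e + (size e₁ + size e₂))
    size zero                     = 1
    size one                      = 1
    size (add e e′)               = suc (size e + size e′)
    size (sub e e′)               = suc (size e + size e′)
    size (mul e e′)               = suc (size e + size e′)
    size (div e e′)               = suc (size e + size e′)
    size (if e ≤ e′ then e₁ else e₂) = suc (size e + size e′ + (size e₁ + size e₂))
    size (call f es)              = suc (size* es)

    size* : ∀ {ar n k} → Vec (Expr ar n) k → ℕ
    size* []       = 0
    size* (e ∷ es) = size e + size* es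

  -- One activation of a function body evaluates each of its nodes at most once,
  -- so it is enough to count calls: ρ ⊢ e ⇓ v # k says that e evaluates to v
  -- with at most k calls.
  module Calls (R : Reals) {inputs : ℕ} (P : Program inputs) (K : ℕ)
               (body-size : ∀ f → size (Program.body P f) ≤ K) where
    open Program P
    open Reals R using () renaming (_≤_ to _≤ᵣ_)
    open Semantics R using (Value; nil; real; cons; ⇓var; ⇓let; ⇓nil; ⇓cons; ⇓case-nil;
      ⇓case-cons; ⇓then; ⇓else; ⇓call; []; _∷_)

    infix 4 _⊢_⇓_#_ _⊢*_⇓_#_

    record _⊢_⇓_#_ {n} (ρ : Vec Value n) (e : Expr arities n) (v : Value) (k : ℕ) : Set where
      constructor counted
      field
        {time} : ℕ
        run    : Semantics._⊢_⇓_∣_ R P ρ e v time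
        time≤  : time ≤ size e + k * K

    record _⊢*_⇓_#_ {n m} (ρ : Vec Value n) (es : Vec (Expr arities n) m) (vs : Vec Value m)
                    (k : ℕ) : Set where
      constructor counted
      field
        {time} : ℕ
        run    : Semantics._⊢*_⇓_∣_ R P ρ es vs time
        time≤  : time ≤ size* es + k * K

    private
      add≤ : ∀ {t t′ s s′} k k′ → t ≤ s + k * K → t′ ≤ s′ + k′ * K →
             t + t′ ≤ s + s′ + (k + k′) * K
      add≤ {s = s} {s′} k k′ p p′ = ℕₚ.≤-trans (ℕₚ.+-mono-≤ p p′)
        (ℕₚ.≤-reflexive (regroup s s′ k k′ K))
        where
        regroup : ∀ s s′ k k′ K → s + k * K + (s′ + k′ * K) ≡ s + s′ + (k + k′) * K
        regroup = solve-∀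

      left≤ : ∀ {t} s s′ {r} → t ≤ s + r → t ≤ s + s′ + r
      left≤ s s′ {r} p = ℕₚ.≤-trans p (ℕₚ.+-monoˡ-≤ r (ℕₚ.m≤m+n s s′))

      right≤ : ∀ {t} s s′ {r} → t ≤ s′ + r → t ≤ s + s′ + r
      right≤ s s′ {r} p = ℕₚ.≤-trans p (ℕₚ.+-monoˡ-≤ r (ℕₚ.m≤n+m s′ s))

    module _ {n} {ρ : Vec Value n} where

      weaken : ∀ {e v k k′} → k ≤ k′ → ρ ⊢ e ⇓ v # k → ρ ⊢ e ⇓ v # k′
      weaken {e} k≤k′ (counted d p) =
        counted d (ℕₚ.≤-trans p (ℕₚ.+-monoʳ-≤ (size e) (ℕₚ.*-monoˡ-≤ K k≤k′)))

      #var : ∀ {i} → ρ ⊢ var i ⇓ Vec.lookup ρ i # 0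
      #var = counted ⇓var ℕₚ.≤-refl

      #nil : ρ ⊢ nil ⇓ nil # 0
      #nil = counted ⇓nil ℕₚ.≤-refl

      #let : ∀ {e e′ v w k k′} → ρ ⊢ e ⇓ v # k → v ∷ ρ ⊢ e′ ⇓ w # k′ →
             ρ ⊢ let′ e e′ ⇓ w # k + k′
      #let {k = k} {k′} (counted d p) (counted d′ p′) =
        counted (⇓let d d′) (s≤s (add≤ k k′ p p′))

      #cons : ∀ {e e′ v w k k′} → ρ ⊢ e ⇓ v # k → ρ ⊢ e′ ⇓ w # k′ →
              ρ ⊢ cons e e′ ⇓ cons v w # k + k′
      #cons {k = k} {k′} (counted d p) (counted d′ p′) =
        counted (⇓cons d d′) (s≤s (add≤ k k′ p p′))

      #case-nil : ∀ {e e₁ e₂ w k k′} → ρ ⊢ e ⇓ nil # k → ρ ⊢ e₁ ⇓ w # k′ →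
                  ρ ⊢ case e e₁ e₂ ⇓ w # k + k′
      #case-nil {e₁ = e₁} {e₂} {k = k} {k′} (counted d p) (counted d′ p′) =
        counted (⇓case-nil d d′) (s≤s (add≤ k k′ p (left≤ (size e₁) (size e₂) p′)))

      #case-cons : ∀ {e e₁ e₂ v v′ w k k′} → ρ ⊢ e ⇓ cons v v′ # k →
                   v ∷ v′ ∷ ρ ⊢ e₂ ⇓ w # k′ → ρ ⊢ case e e₁ e₂ ⇓ w # k + k′
      #case-cons {e₁ = e₁} {e₂} {k = k} {k′} (counted d p) (counted d′ p′) =
        counted (⇓case-cons d d′) (s≤s (add≤ k k′ p (right≤ (size e₁) (size e₂) p′)))

      #then : ∀ {e e′ e₁ e₂ x y w k k′ k″} → ρ ⊢ e ⇓ real x # k → ρ ⊢ e′ ⇓ real y # k′ →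
              x ≤ᵣ y → ρ ⊢ e₁ ⇓ w # k″ → ρ ⊢ if e ≤ e′ then e₁ else e₂ ⇓ w # k + k′ + k″
      #then {e₁ = e₁} {e₂} {k = k} {k′} {k″} (counted d p) (counted d′ p′) x≤y (counted d″ p″) =
        counted (⇓then d d′ x≤y d″)
          (s≤s (add≤ (k + k′) k″ (add≤ k k′ p p′) (left≤ (size e₁) (size e₂) p″)))

      #else : ∀ {e e′ e₁ e₂ x y w k k′ k″} → ρ ⊢ e ⇓ real x # k → ρ ⊢ e′ ⇓ real y # k′ →
              ¬ x ≤ᵣ y → ρ ⊢ e₂ ⇓ w # k″ → ρ ⊢ if e ≤ e′ then e₁ else e₂ ⇓ w # k + k′ + k″
      #else {e₁ = e₁} {e₂} {k = k} {k′} {k″} (counted d p) (counted d′ p′) x≰y (counted d″ p″) =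
        counted (⇓else d d′ x≰y d″)
          (s≤s (add≤ (k + k′) k″ (add≤ k k′ p p′) (right≤ (size e₁) (size e₂) p″)))

      -- The `suc` pays for the body itself, which has at most `K` nodes; the calls made inside it
      -- are already in `k′`.
      #call : ∀ {f es vs w k k′} → ρ ⊢* es ⇓ vs # k → vs ⊢ body f ⇓ w # k′ →
              ρ ⊢ call f es ⇓ w # k + suc k′
      #call {f} {es} {k = k} {k′} (counted d p) (counted d′ p′) =
        counted (⇓call d d′) (s≤s (ℕₚ.≤-trans (add≤ k (suc k′) p body≤)
          (ℕₚ.≤-reflexive (cong (_+ (k + suc k′) * K) (ℕₚ.+-identityʳ (size* es))))))
        where
        body≤ : _ ≤ 0 + suc k′ * K
        body≤ = ℕₚ.≤-trans p′ (ℕₚ.+-monoˡ-≤ (k′ * K) (body-size f))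

      #[] : ρ ⊢* [] ⇓ [] # 0
      #[] = counted [] ℕₚ.≤-refl

      infixr 5 _#∷_
      _#∷_ : ∀ {m e v k k′} {es : Vec (Expr arities n) m} {vs} →
             ρ ⊢ e ⇓ v # k → ρ ⊢* es ⇓ vs # k′ → ρ ⊢* e ∷ es ⇓ v ∷ vs # k + k′
      _#∷_ {k = k} {k′} (counted d p) (counted d′ p′) = counted (d ∷ d′) (add≤ k k′ p p′)

-- The program

module Algorithm where

  open import Defs
  open import Data.Fin.Base using (Fin; zero; suc)
  open import Data.List.Base as List using (List; []; _∷_)
  open import Data.Nat.Base using (ℕ; zero; suc)
  open import Data.Vec.Base using ([]; _∷_)

  arities : List ℕ
  arities = 2 ∷ 3 ∷ 2 ∷ 1 ∷ 1 ∷ 2 ∷ 2 ∷ 2 ∷ 1 ∷ 2 ∷ 2 ∷ 2 ∷ 4 ∷ 1 ∷ []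

  pattern i0  = zero
  pattern i1  = suc i0
  pattern i2  = suc i1
  pattern i3  = suc i2
  pattern i4  = suc i3
  pattern i5  = suc i4
  pattern i6  = suc i5
  pattern i7  = suc i6
  pattern i8  = suc i7
  pattern i9  = suc i8
  pattern i10 = suc i9
  pattern i11 = suc i10
  pattern i12 = suc i11
  pattern i13 = suc i12
  pattern i14 = suc i13
  pattern i15 = suc i14
  pattern i16 = suc i15
  pattern i17 = suc i16
  pattern i18 = suc i17

  pattern drop      = i0
  pattern chop      = i1
  pattern merge     = i2
  pattern sort      = i3
  pattern log       = i4
  pattern append    = i5
  pattern times     = i6
  pattern partition = i7
  pattern tails     = i8
  pattern dominates = i9
  pattern row       = i10
  pattern brute     = i11
  pattern solve     = i12
  pattern items     = i13

  -- A number is represented by any list of that length; an item, by a cell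
  -- holding the remaining coordinates of a point and the whole point.

  module _ {n : ℕ} where

    unary : ℕ → Expr arities n
    unary zero    = nil
    unary (suc k) = cons nil (unary k)

    first second key : Expr arities n → Expr arities n
    first  e = case e nil (var i0)
    second e = case e nil (var i1)
    key    e = case e nil (case (var i0) nil (var i0))

    infixr 3 _orElse_
    -- The answer of `e` is rebuilt from the components that `case` binds, so that `e` is evaluated
    -- only once.
    _orElse_ : Expr arities n → Expr arities n → Expr arities n
    e orElse e′ = case e e′ (cons (var i0) (var i1))

  body : (f : Fin (List.length arities)) → Expr arities (List.lookup arities f)
  -- drop xs m: cons (the elements of xs after the first m) nil, or nil if xs is
  -- shorter than m
  body drop = case (var i1) (cons (var i0) nil)
    (case (var i2) nil (call drop (var i1 ∷ var i3 ∷ [])))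
  -- chop xs ys m: xs split after ⌊∣ys∣/m⌋ elements
  body chop = case (call drop (var i1 ∷ var i2 ∷ [])) (cons nil (var i0))
    (case (var i2) (cons nil nil)
      (case (call chop (var i1 ∷ var i2 ∷ var i6 ∷ [])) nil
        (cons (cons (var i2) (var i0)) (var i1))))
  body merge = case (var i0) (var i1) (case (var i3) (var i2)
    (if key (var i2) ≤ key (var i0)
      then cons (var i2) (call merge (var i3 ∷ var i5 ∷ []))
      else cons (var i0) (call merge (var i4 ∷ var i1 ∷ []))))
  body sort = case (var i0) nil (case (var i1) (var i2)
    (case (call chop (var i4 ∷ var i4 ∷ unary 2 ∷ [])) nil
      (call merge (call sort (var i0 ∷ []) ∷ call sort (var i1 ∷ []) ∷ []))))
  -- Repeated halving: for a nonempty list the result has as many elements as the logarithm of its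
  -- length, rounded down.
  body log = case (var i0) nil (case (var i1) nil
    (cons nil (case (call chop (var i4 ∷ var i4 ∷ unary 2 ∷ [])) nil
      (call log (var i0 ∷ [])))))
  body append = case (var i0) (var i1) (cons (var i0) (call append (var i1 ∷ var i3 ∷ [])))
  body times = case (var i0) nil
    (call append (var i3 ∷ call times (var i1 ∷ var i3 ∷ []) ∷ []))
  -- partition B t: the items of B with key ≤ t and the others
  body partition = case (var i0) (cons nil nil)
    (case (call partition (var i1 ∷ var i3 ∷ [])) nil
      (if key (var i2) ≤ var i5
        then cons (cons (var i2) (var i0)) (var i1)
        else cons (var i0) (cons (var i2) (var i1))))
  body tails = case (var i0) nil
    (cons (case (var i0) nil (case (var i0) nil (cons (var i1) (var i3))))
          (call tails (var i1 ∷ [])))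
  -- `cons nil nil` stands for true and `nil` for false, so that `case` can branch on the result.
  body dominates = case (var i0) (cons nil nil) (case (var i3) nil
    (if var i0 ≤ var i2 then call dominates (var i3 ∷ var i1 ∷ []) else nil))
  body row = case (var i1) nil
    (case (call dominates (first (var i2) ∷ first (var i0) ∷ []))
      (call row (var i2 ∷ var i1 ∷ []))
      (cons (second (var i4)) (second (var i2))))
  body brute = case (var i0) nil
    (call row (var i0 ∷ var i3 ∷ []) orElse call brute (var i1 ∷ var i3 ∷ []))
  -- solve A B J m: at most J splits along a branch, each at the lowest 1/m of A
  body solve = case (var i2) (call brute (var i0 ∷ var i1 ∷ []))
    (case (var i2) nil
      (case (first (var i0))
        -- No coordinate is left, so any two items form a solution.
        (case (var i5) nil (cons (second (var i2)) (second (var i0))))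
        (let′ (call sort (var i6 ∷ []))
          (case (call chop (var i0 ∷ var i0 ∷ var i10 ∷ [])) nil
            -- Nothing is chopped off exactly when `A` has fewer than `m` items; brute force is then
            -- cheap.
            (case (var i0) (call brute (var i9 ∷ var i10 ∷ []))
              (case (var i3) nil
                (case (call partition (var i14 ∷ key (var i0) ∷ [])) nil
                  ( call solve (var i6 ∷ var i0 ∷ var i14 ∷ var i18 ∷ [])
             orElse call solve (var i7 ∷ var i1 ∷ var i14 ∷ var i18 ∷ [])
             orElse call solve (call tails (var i7 ∷ []) ∷ call tails (var i0 ∷ [])
                                -- `var i17` is the whole budget `J`, whereas the other two calls
                                -- receive its tail `var i14`: dropping a coordinate spends no
                                -- split.
                                ∷ var i17 ∷ var i18 ∷ [])))))))))
  body items = case (var i0) nil (cons (cons (var i0) (var i0)) (call items (var i1 ∷ [])))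

  program : Program 2
  program = record
    { arities = arities
    ; body    = body
    ; main    = case (var i0) nil
        -- The four bindings are `L`, one more than the rounded logarithm of the size of the first
        -- set; `q`, one more than the quotient of the dimension by `L`; `e = 72 * q`; and `J`, the
        -- quotient of `L` by `e`.
        (let′ (cons nil (call log (var i2 ∷ [])))
        (let′ (cons nil (first (call chop (var i1 ∷ var i1 ∷ var i0 ∷ []))))
        (let′ (call times (unary 72 ∷ var i0 ∷ []))
        (let′ (first (call chop (var i2 ∷ var i2 ∷ var i0 ∷ [])))
          (call solve (call items (var i6 ∷ []) ∷ call items (var i7 ∷ []) ∷ var i0
                       ∷ call times (var i1 ∷ var i1 ∷ []) ∷ []))))))
    }

-- Leaf mass and number of nodes of the recursion tree

module Recurrence where

  open import Data.Nat.Base using (ℕ; zero; suc; _+_; _*_; _^_; _≤_; _<_; z≤n; s≤s; >-nonZero)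
  open import Data.Nat.Properties
  open import Data.Nat.Tactic.RingSolver using (solve-∀)
  open import Data.Sum.Base using (inj₁; inj₂)
  open import Relation.Binary.PropositionalEquality using (_≡_; sym; cong)

  ≤-by : ∀ {m n} k → m + k ≡ n → m ≤ n
  ≤-by {m} k eq = ≤-trans (m≤m+n m k) (≤-reflexive eq)

  -- The recursion tree of `solve` at its largest, with `j` splits and `d` coordinates left.
  nodes : ℕ → ℕ → ℕ
  nodes zero    d       = 1
  nodes (suc j) zero    = 1
  nodes (suc j) (suc d) = suc (nodes j (suc d) + nodes j (suc d) + nodes (suc j) d)

  -- The mass of a pair of sets is the product of their sizes.  A set of size
  -- k + l is split into parts of sizes k and l, the other into parts of sizes
  -- s and t, and a mass of kt is discarded.  If t is a large fraction then kt
  -- is a large enough part of the whole mass; otherwise the masses ks and lt are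
  -- small, and the discount on ls pays for their surcharge.
  module Masses (m Q : ℕ) (4≤m : 4 ≤ m) (Q+2≡m³ : Q + 2 ≡ m * (m * m)) where

    F : ℕ
    F = 2 * (m * m)

    split-balanced : ∀ {k l s t} → 1 ≤ k → k + l ≤ suc k * m → s + t ≤ m * t →
      suc F * (Q + 2) * (k * s + l * t) + Q * F * (l * s) ≤ F * (Q + 2) * ((k + l) * (s + t))
    split-balanced {k} {l} {s} {t} 1≤k a≤ b≤ = begin
      suc F * (Q + 2) * (k * s + l * t) + Q * F * (l * s)
        -- `l * s` is charged at the rate of the other two masses; the discarded `k * t` alone
        -- compensates for the surcharge.
        ≤⟨ ≤-by ((Q + 2 + 2 * F) * (l * s)) (absorb F Q (k * s + l * t) (l * s)) ⟩
      (Q + 2) * (suc F * (k * s + l * t + l * s))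
        ≤⟨ *-monoʳ-≤ (Q + 2) (+-cancelʳ-≤ (suc F * (k * t)) _ _ kept) ⟩
      (Q + 2) * (F * ((k + l) * (s + t)))
        ≡⟨ regroup (Q + 2) F ((k + l) * (s + t)) ⟩
      F * (Q + 2) * ((k + l) * (s + t)) ∎
      where
      open ≤-Reasoning
      absorb : ∀ F Q x y → suc F * (Q + 2) * x + Q * F * y + (Q + 2 + 2 * F) * y
                         ≡ (Q + 2) * (suc F * (x + y))
      absorb = solve-∀
      regroup : ∀ q F x → q * (F * x) ≡ F * q * x
      regroup = solve-∀
      whole : ∀ F k l s t → suc F * (k * s + l * t + l * s) + suc F * (k * t)
                          ≡ F * ((k + l) * (s + t)) + (k + l) * (s + t)
      whole = solve-∀
      double : ∀ k m → k * m + k * m ≡ 2 * (k * m)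
      double = solve-∀
      product : ∀ k m t → 2 * (k * m) * (m * t) ≡ 2 * (m * m) * (k * t)
      product = solve-∀
      a≤2km : k + l ≤ 2 * (k * m)
      a≤2km = ≤-trans a≤ (≤-trans
        (+-monoˡ-≤ (k * m) (≤-trans (≤-reflexive (sym (*-identityˡ m))) (*-monoˡ-≤ m 1≤k)))
        (≤-reflexive (double k m)))
      kept : suc F * (k * s + l * t + l * s) + suc F * (k * t)
           ≤ F * ((k + l) * (s + t)) + suc F * (k * t)
      kept = begin
        suc F * (k * s + l * t + l * s) + suc F * (k * t)  ≡⟨ whole F k l s t ⟩
        F * ((k + l) * (s + t)) + (k + l) * (s + t)
          -- The origin of `F = 2 * (m * m)`: the whole mass is at most `2 * (k * m)` times `m * t`,
          -- so the discarded part is at least the `F`-th part of it.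
          ≤⟨ +-monoʳ-≤ (F * ((k + l) * (s + t))) (*-mono-≤ a≤2km b≤) ⟩
        F * ((k + l) * (s + t)) + 2 * (k * m) * (m * t)
          ≡⟨ cong (F * ((k + l) * (s + t)) +_) (product k m t) ⟩
        F * ((k + l) * (s + t)) + F * (k * t)
          ≤⟨ +-monoʳ-≤ (F * ((k + l) * (s + t))) (*-monoˡ-≤ (k * t) (n≤1+n F)) ⟩
        F * ((k + l) * (s + t)) + suc F * (k * t) ∎

    split-unbalanced : ∀ {k l s t} → k * m ≤ k + l → m * t ≤ s + t →
      suc F * (Q + 2) * (k * s + l * t) + Q * F * (l * s) ≤ F * (Q + 2) * ((k + l) * (s + t))
    split-unbalanced {k} {l} {s} {t} km≤ mt≤ = begin
      suc F * (Q + 2) * S + Q * F * (l * s)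
        ≡⟨ expand F Q S (l * s) ⟩
      F * Q * (S + l * s) + ((Q + 2) * S + 2 * F * S)
        ≡⟨ cong (λ q → F * Q * (S + l * s) + (q * S + 2 * F * S)) Q+2≡m³ ⟩
      F * Q * (S + l * s) + (m * (m * m) * S + 2 * (2 * (m * m)) * S)
        ≤⟨ +-mono-≤ (*-monoʳ-≤ (F * Q) (≤-by (k * t) (whole k l s t))) surcharge ⟩
      F * Q * T + 2 * F * T
        ≡⟨ collect F Q T ⟩
      F * (Q + 2) * T ∎
      where
      open ≤-Reasoning
      S = k * s + l * t
      T = (k + l) * (s + t)
      expand : ∀ F Q x y → suc F * (Q + 2) * x + Q * F * y
                         ≡ F * Q * (x + y) + ((Q + 2) * x + 2 * F * x)
      expand = solve-∀
      whole : ∀ k l s t → k * s + l * t + l * s + k * t ≡ (k + l) * (s + t)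
      whole = solve-∀
      collect : ∀ F Q x → F * Q * x + 2 * F * x ≡ F * (Q + 2) * x
      collect = solve-∀
      distribute : ∀ m k l s t → m * (k * s + l * t) ≡ k * m * s + l * (m * t)
      distribute = solve-∀
      twice : ∀ x → x + x ≡ 2 * x
      twice = solve-∀
      quadruple : ∀ m x → m * (m * m) * x + 2 * (2 * (m * m)) * x ≡ m * m * (m * x) + m * m * (4 * x)
      quadruple = solve-∀
      result : ∀ m x → m * m * (2 * x) + m * m * (2 * x) ≡ 2 * (2 * (m * m)) * x
      result = solve-∀
      mS≤2T : m * S ≤ 2 * T
      mS≤2T = begin
        m * S                     ≡⟨ distribute m k l s t ⟩
        k * m * s + l * (m * t)   ≤⟨ +-mono-≤ (*-mono-≤ km≤ (m≤m+n s t)) (*-mono-≤ (m≤n+m l k) mt≤) ⟩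
        T + T                     ≡⟨ twice T ⟩
        2 * T                     ∎
      -- One half of `2 * F * T` pays for the surcharge on the splits, the other half for the
      -- discount that `S` does not receive; the latter uses `4 ≤ m`.
      surcharge : m * (m * m) * S + 2 * (2 * (m * m)) * S ≤ 2 * F * T
      surcharge = begin
        m * (m * m) * S + 2 * (2 * (m * m)) * S  ≡⟨ quadruple m S ⟩
        m * m * (m * S) + m * m * (4 * S)
          ≤⟨ +-mono-≤ (*-monoʳ-≤ (m * m) mS≤2T)
               (*-monoʳ-≤ (m * m) (≤-trans (*-monoˡ-≤ S 4≤m) mS≤2T)) ⟩
        m * m * (2 * T) + m * m * (2 * T)        ≡⟨ result m T ⟩
        2 * F * T                                ∎

    split-mass : ∀ {k l s t} → 1 ≤ k → k * m ≤ k + l → k + l < suc k * m →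
      suc F * (Q + 2) * (k * s + l * t) + Q * F * (l * s) ≤ F * (Q + 2) * ((k + l) * (s + t))
    split-mass {k} {l} {s} {t} 1≤k km≤ a< with ≤-total (s + t) (m * t)
    ... | inj₁ b≤ = split-balanced {k} {l} {s} {t} 1≤k (<⇒≤ a<) b≤
    ... | inj₂ mt≤ = split-unbalanced {k} {l} {s} {t} km≤ mt≤

    -- x bounds the total mass of the brute-forced leaves below a node of mass M
    -- with j splits and d coordinates left: a split gains a factor F/(F + 1), the
    -- removal of a coordinate costs a factor (Q + 2)/Q.
    LeafMass : (j d M x : ℕ) → Set
    LeafMass j d M x = x * (suc F ^ j * Q ^ d) ≤ M * (F ^ j * (Q + 2) ^ d)

    leafMass-brute : ∀ d M → LeafMass 0 d M M
    leafMass-brute d M = *-monoʳ-≤ M (*-monoʳ-≤ 1 (^-monoˡ-≤ d (m≤m+n Q 2)))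

    -- Once the common factor `F ^ j * (Q + 2) ^ d` is taken out of the three inductive bounds, what
    -- remains is `split-mass`.
    leafMass-split : ∀ {j d k l s t x₁ x₂ x₃} → 1 ≤ k → k * m ≤ k + l → k + l < suc k * m →
      LeafMass j (suc d) (k * s) x₁ → LeafMass j (suc d) (l * t) x₂ →
      LeafMass (suc j) d (l * s) x₃ →
      LeafMass (suc j) (suc d) ((k + l) * (s + t)) (x₁ + x₂ + x₃)
    leafMass-split {j} {d} {k} {l} {s} {t} {x₁} {x₂} {x₃} 1≤k km≤ a< h₁ h₂ h₃ = begin
      (x₁ + x₂ + x₃) * (suc F * p * (Q * y))
        ≡⟨ distribute x₁ x₂ x₃ (suc F) p Q y ⟩
      suc F * (x₁ * (p * (Q * y)) + x₂ * (p * (Q * y))) + Q * (x₃ * (suc F * p * y))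
        ≤⟨ +-mono-≤ (*-monoʳ-≤ (suc F) (+-mono-≤ h₁ h₂)) (*-monoʳ-≤ Q h₃) ⟩
      suc F * (k * s * (f * ((Q + 2) * z)) + l * t * (f * ((Q + 2) * z)))
        + Q * (l * s * (F * f * z))
        ≡⟨ factor (suc F) F Q (Q + 2) (k * s) (l * t) (l * s) f z ⟩
      (suc F * (Q + 2) * (k * s + l * t) + Q * F * (l * s)) * (f * z)
        ≤⟨ *-monoˡ-≤ (f * z) (split-mass {k} {l} {s} {t} 1≤k km≤ a<) ⟩
      F * (Q + 2) * ((k + l) * (s + t)) * (f * z)
        ≡⟨ regroup F (Q + 2) ((k + l) * (s + t)) f z ⟩
      (k + l) * (s + t) * (F * f * ((Q + 2) * z)) ∎
      where
      open ≤-Reasoning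
      p = suc F ^ j
      y = Q ^ d
      f = F ^ j
      z = (Q + 2) ^ d
      distribute : ∀ a b c P p Q y → (a + b + c) * (P * p * (Q * y))
        ≡ P * (a * (p * (Q * y)) + b * (p * (Q * y))) + Q * (c * (P * p * y))
      distribute = solve-∀
      factor : ∀ P F Q R a b c f z → P * (a * (f * (R * z)) + b * (f * (R * z))) + Q * (c * (F * f * z))
        ≡ (P * R * (a + b) + Q * F * c) * (f * z)
      factor = solve-∀
      regroup : ∀ F R a f z → F * R * a * (f * z) ≡ a * (F * f * (R * z))
      regroup = solve-∀

  -- Passing from `x` to `2 * x + 1` makes the recurrence homogeneous, and
  -- `(2 * M + 2) ^ j * ((M + 1) / M) ^ d` then solves it for every positive `M`. A large `M` makes
  -- coordinates cheap and splits expensive.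
  nodes-bound : ∀ M j d → suc (2 * nodes j d) * M ^ d ≤ 3 * ((2 * M + 2) ^ j * suc M ^ d)
  nodes-bound M zero d = *-monoʳ-≤ 3 (≤-trans (^-monoˡ-≤ d (n≤1+n M)) (≤-reflexive (sym (*-identityˡ _))))
  nodes-bound M (suc j) zero = *-monoʳ-≤ 3
    (≤-trans (m^n>0 (2 * M + 2) {{>-nonZero (≤-trans (s≤s z≤n) (m≤n+m 2 (2 * M)))}} (suc j))
      (≤-reflexive (sym (*-identityʳ _))))
  nodes-bound M (suc j) (suc d) = begin
    suc (2 * suc (x + x + y)) * (M * v)
      ≡⟨ expand x y M v ⟩
    2 * (suc (2 * x) * (M * v)) + M * (suc (2 * y) * v)
      ≤⟨ +-mono-≤ (*-monoʳ-≤ 2 (nodes-bound M j (suc d))) (*-monoʳ-≤ M (nodes-bound M (suc j) d)) ⟩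
    2 * (3 * (b * (suc M * c))) + M * (3 * ((2 * M + 2) * b * c))
      ≡⟨ collect M b c ⟩
    3 * ((2 * M + 2) * b * (suc M * c)) ∎
    where
    open ≤-Reasoning
    x = nodes j (suc d)
    y = nodes (suc j) d
    v = M ^ d
    b = (2 * M + 2) ^ j
    c = suc M ^ d
    expand : ∀ x y M v → suc (2 * suc (x + x + y)) * (M * v)
           ≡ 2 * (suc (2 * x) * (M * v)) + M * (suc (2 * y) * v)
    expand = solve-∀
    collect : ∀ M b c → 2 * (3 * (b * (suc M * c))) + M * (3 * ((2 * M + 2) * b * c))
            ≡ 3 * ((2 * M + 2) * b * (suc M * c))
    collect = solve-∀

-- Bernoulli inequalities and powers of 2

module Powers where

  open import Data.Nat.Base using (zero; suc; _+_; _*_; _^_; _≤_; _<_; z≤n; s≤s; NonZero; >-nonZero)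
  open import Data.Nat.DivMod using (_/_; _%_; m≡m%n+[m/n]*n; m%n<n)
  open import Data.Nat.Properties
  open import Data.Nat.Tactic.RingSolver using (solve-∀)
  open import Data.Product.Base using (∃₂; _×_; _,_)
  open import Relation.Binary.PropositionalEquality using (_≡_; refl; sym; trans; cong; subst; module ≡-Reasoning)

  opaque
    divide : ∀ a b → 1 ≤ b → ∃₂ λ i r → a ≡ r + i * b × r < b
    divide a b 1≤b = a / b , a % b , m≡m%n+[m/n]*n a b , m%n<n a b
      where instance
      b≢0 : NonZero b
      b≢0 = >-nonZero 1≤b

  n<2^n : ∀ n → n < 2 ^ n
  n<2^n zero    = s≤s z≤n
  n<2^n (suc n) = ≤-trans (+-mono-≤ (m^n>0 2 n) (n<2^n n))
    (≤-reflexive (cong (2 ^ n +_) (sym (+-identityʳ (2 ^ n)))))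

  -- Divided by `(a + b) ^ (r + 1)`, this is Bernoulli's inequality `(1 - x) ^ r ≥ 1 - r * x` at
  -- `x = b / (a + b)`.
  bernoulli-upper : ∀ a b r → (a + b) ^ r * (a + b) ≤ a ^ r * (a + b) + r * b * (a + b) ^ r
  bernoulli-upper a b zero = m≤m+n _ 0
  bernoulli-upper a b (suc r) = begin
    (a + b) * p * (a + b)                                ≡⟨ swap (a + b) p ⟩
    (a + b) * (p * (a + b))                              ≤⟨ *-monoʳ-≤ (a + b) (bernoulli-upper a b r) ⟩
    (a + b) * (a ^ r * (a + b) + r * b * p)              ≡⟨ expand a b (a ^ r) r p ⟩
    a * a ^ r * (a + b) + (b * (a + b) * a ^ r + r * b * ((a + b) * p))
      ≤⟨ +-monoʳ-≤ (a * a ^ r * (a + b)) (+-monoˡ-≤ (r * b * ((a + b) * p))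
           (*-monoʳ-≤ (b * (a + b)) (^-monoˡ-≤ r (m≤m+n a b)))) ⟩
    a * a ^ r * (a + b) + (b * (a + b) * p + r * b * ((a + b) * p))
      ≡⟨ cong (a * a ^ r * (a + b) +_) (collect a b r p) ⟩
    a * a ^ r * (a + b) + suc r * b * ((a + b) * p)      ∎
    where
    open ≤-Reasoning
    p = (a + b) ^ r
    swap : ∀ s p → s * p * s ≡ s * (p * s)
    swap = solve-∀
    expand : ∀ a b y r p → (a + b) * (y * (a + b) + r * b * p)
           ≡ a * y * (a + b) + (b * (a + b) * y + r * b * ((a + b) * p))
    expand = solve-∀
    collect : ∀ a b r p → b * (a + b) * p + r * b * ((a + b) * p) ≡ suc r * b * ((a + b) * p)
    collect = solve-∀

  -- The correction `r * b / (a + b)` in Bernoulli's inequality is at most one half here.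
  ^≤2*^ : ∀ {a} b r → 1 ≤ a → 2 * (r * b) ≤ a → (a + b) ^ r ≤ 2 * a ^ r
  ^≤2*^ {a} b r 1≤a 2rb≤a = *-cancelʳ-≤ p (2 * a ^ r) (a + b) {{>-nonZero (≤-trans 1≤a (m≤m+n a b))}}
    (+-cancelʳ-≤ (p * (a + b)) _ _ (begin
      p * (a + b) + p * (a + b)                        ≡⟨ double (p * (a + b)) ⟩
      2 * (p * (a + b))                                ≤⟨ *-monoʳ-≤ 2 (bernoulli-upper a b r) ⟩
      2 * (a ^ r * (a + b) + r * b * p)                ≡⟨ expand (a ^ r) (a + b) (r * b) p ⟩
      2 * a ^ r * (a + b) + p * (2 * (r * b))
        ≤⟨ +-monoʳ-≤ (2 * a ^ r * (a + b)) (*-monoʳ-≤ p (≤-trans 2rb≤a (m≤m+n a b))) ⟩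
      2 * a ^ r * (a + b) + p * (a + b)                ∎))
    where
    open ≤-Reasoning
    p = (a + b) ^ r
    double : ∀ x → x + x ≡ 2 * x
    double = solve-∀
    expand : ∀ y s c p → 2 * (y * s + c * p) ≡ 2 * y * s + p * (2 * c)
    expand = solve-∀

  -- Bernoulli's inequality `(1 + 1 / a) ^ r ≥ 1 + r / a`, cleared of denominators.
  bernoulli-lower : ∀ a r → a ^ r * (a + r) ≤ a * suc a ^ r
  bernoulli-lower a zero = ≤-reflexive (simplify a)
    where
    simplify : ∀ a → 1 * (a + 0) ≡ a * 1
    simplify = solve-∀
  bernoulli-lower a (suc r) = begin
    a * a ^ r * (a + suc r)            ≤⟨ m≤m+n _ (r * a ^ r) ⟩
    a * a ^ r * (a + suc r) + r * a ^ r ≡⟨ factor a (a ^ r) r ⟩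
    suc a * (a ^ r * (a + r))          ≤⟨ *-monoʳ-≤ (suc a) (bernoulli-lower a r) ⟩
    suc a * (a * suc a ^ r)            ≡⟨ swap (suc a) a (suc a ^ r) ⟩
    a * (suc a * suc a ^ r)            ∎
    where
    open ≤-Reasoning
    factor : ∀ a p r → a * p * (a + suc r) + r * p ≡ suc a * (p * (a + r))
    factor = solve-∀
    swap : ∀ b a p → b * (a * p) ≡ a * (b * p)
    swap = solve-∀

  2*^≤^ : ∀ a → 1 ≤ a → 2 * a ^ a ≤ suc a ^ a
  2*^≤^ a 1≤a = *-cancelˡ-≤ a {{>-nonZero 1≤a}} (begin
    a * (2 * a ^ a)   ≡⟨ swap a (a ^ a) ⟩
    a ^ a * (a + a)   ≤⟨ bernoulli-lower a a ⟩
    a * suc a ^ a     ∎)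
    where
    open ≤-Reasoning
    swap : ∀ a p → a * (2 * p) ≡ p * (a + a)
    swap = solve-∀

  private
    peel : ∀ a r i h → a ^ (r + (h + i * h)) ≡ a ^ h * a ^ (r + i * h)
    peel a r i h = begin
      a ^ (r + (h + i * h)) ≡⟨ cong (a ^_) (assoc r h (i * h)) ⟩
      a ^ (h + (r + i * h)) ≡⟨ ^-distribˡ-+-* a h (r + i * h) ⟩
      a ^ h * a ^ (r + i * h) ∎
      where
      open ≡-Reasoning
      assoc : ∀ r h x → r + (h + x) ≡ h + (r + x)
      assoc = solve-∀

    exchange : ∀ a b c d → a * b * (c * d) ≡ a * c * (b * d)
    exchange = solve-∀

  ^-distribʳ-* : ∀ a b k → (a * b) ^ k ≡ a ^ k * b ^ k
  ^-distribʳ-* a b zero    = refl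
  ^-distribʳ-* a b (suc k) = trans (cong (a * b *_) (^-distribʳ-* a b k)) (exchange a b (a ^ k) (b ^ k))

  -- The exponent is cut into `i` blocks of length `h`, worth one factor 2 each. The remainder `r`
  -- costs one more factor here; in `chunks-lower` it gains nothing, hence `2 ^ i` there.
  chunks-upper : ∀ {a b h} → (∀ r → r ≤ h → a ^ r ≤ 2 * b ^ r) → ∀ i {r} → r ≤ h →
                 a ^ (r + i * h) ≤ 2 ^ suc i * b ^ (r + i * h)
  chunks-upper {a} {b} {h} bound zero {r} r≤h =
    subst (λ x → a ^ x ≤ 2 * b ^ x) (sym (+-identityʳ r)) (bound r r≤h)
  chunks-upper {a} {b} {h} bound (suc i) {r} r≤h = begin
    a ^ (r + (h + i * h))                          ≡⟨ peel a r i h ⟩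
    a ^ h * a ^ (r + i * h)                        ≤⟨ *-mono-≤ (bound h ≤-refl) (chunks-upper bound i r≤h) ⟩
    2 * b ^ h * (2 ^ suc i * b ^ (r + i * h))      ≡⟨ exchange 2 (b ^ h) (2 ^ suc i) _ ⟩
    2 * 2 ^ suc i * (b ^ h * b ^ (r + i * h))      ≡⟨ cong (2 * 2 ^ suc i *_) (sym (peel b r i h)) ⟩
    2 * 2 ^ suc i * b ^ (r + (h + i * h))          ∎
    where open ≤-Reasoning

  chunks-lower : ∀ {a b h} → 2 * b ^ h ≤ a ^ h → b ≤ a → ∀ i r →
                 2 ^ i * b ^ (r + i * h) ≤ a ^ (r + i * h)
  chunks-lower {a} {b} bound b≤a zero r = ≤-trans (≤-reflexive (*-identityˡ _)) (^-monoˡ-≤ (r + 0) b≤a)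
  chunks-lower {a} {b} {h} bound b≤a (suc i) r = begin
    2 * 2 ^ i * b ^ (r + (h + i * h))          ≡⟨ cong (2 * 2 ^ i *_) (peel b r i h) ⟩
    2 * 2 ^ i * (b ^ h * b ^ (r + i * h))      ≡⟨ exchange 2 (2 ^ i) (b ^ h) _ ⟩
    2 * b ^ h * (2 ^ i * b ^ (r + i * h))      ≤⟨ *-mono-≤ bound (chunks-lower bound b≤a i r) ⟩
    a ^ h * a ^ (r + i * h)                    ≡⟨ sym (peel a r i h) ⟩
    a ^ (r + (h + i * h))                      ∎
    where open ≤-Reasoning

-- List functions: division, logarithm, sorting

module Lists where

  open import Defs
  open Evaluation
  open Algorithm
  open Recurrence using (≤-by)
  open import Data.Empty using (⊥-elim)
  open import Data.Fin.Properties using (all?)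
  open import Data.List.Base using (List; []; _∷_; _++_; length)
  open import Data.List.Properties using (length-++; ++-identityʳ)
  open import Data.List.Relation.Unary.All as All using (All; []; _∷_)
  import Data.List.Relation.Unary.All.Properties as Allₚ
  open import Data.List.Relation.Unary.AllPairs using (AllPairs; []; _∷_)
  open import Data.List.Relation.Binary.Permutation.Propositional using (_↭_; ↭-refl; ↭-trans; ↭-sym; prep; ↭-reflexive)
  open import Data.List.Relation.Binary.Permutation.Propositional.Properties using (All-resp-↭; shift; ↭-length; ++⁺)
  open import Data.Nat.Base using (ℕ; zero; suc; _+_; _*_; _^_; _≤_; _<_; z≤n; s≤s)
  import Data.Nat.Properties as ℕₚ
  open import Data.Nat.Tactic.RingSolver using (solve-∀)
  open import Data.Product.Base using (∃-syntax; ∃₂; _×_; _,_)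
  open import Data.Sum.Base using (_⊎_; inj₁; inj₂)
  open import Data.Vec.Base using (Vec; []; _∷_)
  open import Function.Base using (id)
  open import Relation.Binary.PropositionalEquality using (_≡_; refl; sym; trans; cong; cong₂; subst)
  open import Relation.Binary.Structures using (IsDecTotalOrder)
  open import Relation.Nullary using (¬_; yes; no)
  open import Relation.Nullary.Decidable using (from-yes)

  opaque
    -- A bound for the sizes of all function bodies, checked by evaluating `size`; opaque so that
    -- the literal does not unfold afterwards.
    K : ℕ
    K = 117

    body-size : ∀ f → size (body f) ≤ K
    body-size = from-yes (all? λ f → size (body f) ℕₚ.≤? K)

  opaque
    sortCost : ℕ → ℕ
    sortCost ℓ = 10 * (ℓ * 2 ^ ℓ)

    sortCost-≡ : ∀ ℓ → sortCost ℓ ≡ 10 * (ℓ * 2 ^ ℓ)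
    sortCost-≡ ℓ = refl

    -- One more level leaves room for `20 * 2 ^ ℓ` beyond the two halves: half of it covers `5 * n`,
    -- the other half covers `9`. This fixes the factor 10 in `sortCost`.
    sortCost-suc : ∀ ℓ {n} → n ≤ 2 ^ suc ℓ → 5 * n + 9 + 2 * sortCost ℓ ≤ sortCost (suc ℓ)
    sortCost-suc ℓ {n} n≤ = ℕₚ.≤-trans
      (ℕₚ.+-monoˡ-≤ (2 * sortCost ℓ) (ℕₚ.+-mono-≤ (ℕₚ.*-monoʳ-≤ 5 n≤)
        (ℕₚ.≤-trans (ℕₚ.n≤1+n 9) (ℕₚ.*-monoʳ-≤ 10 (ℕₚ.m^n>0 2 ℓ)))))
      (ℕₚ.≤-reflexive (regroup ℓ (2 ^ ℓ)))
      where
      regroup : ∀ ℓ p → 5 * (2 * p) + 10 * p + 2 * (10 * (ℓ * p)) ≡ 10 * (suc ℓ * (2 * p))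
      regroup = solve-∀

  opaque
    lower-half : ∀ {a n p} → a * 2 ≤ n → n ≤ 2 * p → a ≤ p
    lower-half {a} {n} {p} lower n≤ = ℕₚ.*-cancelʳ-≤ a p 2
      (ℕₚ.≤-trans lower (ℕₚ.≤-trans n≤ (ℕₚ.≤-reflexive (ℕₚ.*-comm 2 p))))

    -- The second half is the one rounded up, but `2 * b ≤ n + 1 ≤ 2 * p + 1` still forces `b ≤ p`
    -- by parity.
    upper-half : ∀ {a b n p} → a + b ≡ n → n < suc a * 2 → n ≤ 2 * p → b ≤ p
    upper-half {a} {b} {p = p} refl n< n≤ = ℕₚ.≤-pred (ℕₚ.*-cancelʳ-< 2 b (suc p)
      (ℕₚ.+-cancelˡ-< (a * 2) _ _ (ℕₚ.≤-trans (ℕₚ.≤-reflexive (eq a b))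
        (ℕₚ.≤-trans (ℕₚ.+-mono-≤ n< n≤) (ℕₚ.≤-reflexive (eq′ a p))))))
      where
      eq : ∀ a b → suc (a * 2 + b * 2) ≡ suc (a + b) + (a + b)
      eq = solve-∀
      eq′ : ∀ a p → suc a * 2 + 2 * p ≡ a * 2 + suc p * 2
      eq′ = solve-∀

    positive-half : ∀ {a n} → 2 ≤ n → n < suc a * 2 → 1 ≤ a
    positive-half {a} 2≤n n< = ℕₚ.≤-pred (ℕₚ.*-cancelʳ-< 2 1 (suc a) (ℕₚ.≤-trans (s≤s 2≤n) n<))

  module Spec (R : Reals) where
    open Reals R using (Carrier; isDecTotalOrder) renaming (_≤_ to _≤ᵣ_)
    private
      open module O = IsDecTotalOrder isDecTotalOrder using (_≤?_)
    open Semantics R using (Value; nil; real; cons)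
    open VectorDomination R using (Point; encodePoint)
    open Calls R program K body-size public

    ≰⇒≥ : ∀ {a b} → ¬ a ≤ᵣ b → b ≤ᵣ a
    ≰⇒≥ {a} {b} a≰b with O.total a b
    ... | inj₁ a≤b = ⊥-elim (a≰b a≤b)
    ... | inj₂ b≤a = b≤a

    enc : ∀ {X : Set} → (X → Value) → List X → Value
    enc f []       = nil
    enc f (x ∷ xs) = cons (f x) (enc f xs)

    data Numeral : ℕ → Value → Set where
      nil  : Numeral 0 nil
      cons : ∀ {n v w} → Numeral n w → Numeral (suc n) (cons v w)

    private variable
      X : Set
      d : ℕ

    enc-numeral : (f : X → Value) → ∀ xs → Numeral (length xs) (enc f xs)
    enc-numeral f []       = nil
    enc-numeral f (x ∷ xs) = cons (enc-numeral f xs)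

    numeral : ℕ → Value
    numeral zero    = nil
    numeral (suc k) = cons nil (numeral k)

    numeral-numeral : ∀ k → Numeral k (numeral k)
    numeral-numeral zero    = nil
    numeral-numeral (suc k) = cons (numeral-numeral k)

    #unary : ∀ {n} {ρ : Vec Value n} k → ρ ⊢ unary k ⇓ numeral k # 0
    #unary zero    = #nil
    #unary (suc k) = #cons #nil (#unary k)

    drop-spec : ∀ {n w m z} → Numeral n w → Numeral m z →
      (n < m × (w ∷ z ∷ [] ⊢ body drop ⇓ nil # m)) ⊎
      (∃₂ λ r y → n ≡ m + r × Numeral r y × (w ∷ z ∷ [] ⊢ body drop ⇓ cons y nil # m))
    drop-spec {n} {w} num nil = inj₂ (n , w , refl , num , #case-nil #var (#cons #var #nil))
    drop-spec nil (cons _) = inj₁ (s≤s z≤n , weaken z≤n (#case-cons #var (#case-nil #var #nil)))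
    drop-spec (cons num) (cons num′) with drop-spec num num′
    ... | inj₁ (lt , run) =
      inj₁ (s≤s lt , #case-cons #var (#case-cons #var (#call (#var #∷ #var #∷ #[]) run)))
    ... | inj₂ (r , y , eq , num″ , run) = inj₂ (r , y , cong suc eq , num″ ,
      #case-cons #var (#case-cons #var (#call (#var #∷ #var #∷ #[]) run)))

    -- Every element moved to the first part consumes `m` cells of the numeral, so the length of
    -- that part is the quotient of `n` by `m`. With `n ≤ length xs` the list cannot run out first.
    -- The same function therefore splits lists and performs every division of the program.
    chop-spec : (f : X → Value) → ∀ xs {n w m z} → Numeral n w → Numeral m z →
      1 ≤ m → n ≤ length xs →
      ∃₂ λ as bs → as ++ bs ≡ xs × length as * m ≤ n × n < suc (length as) * m ×
        (enc f xs ∷ w ∷ z ∷ [] ⊢ body chop ⇓ cons (enc f as) (enc f bs)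
          # suc (length xs) * (2 + m))
    chop-spec f xs {n} num num′ 1≤m n≤xs with drop-spec num num′
    ... | inj₁ (lt , run) = [] , xs , refl , z≤n ,
      subst (n <_) (sym (ℕₚ.+-identityʳ _)) lt ,
      weaken (ℕₚ.≤-trans (ℕₚ.≤-reflexive (ℕₚ.+-identityʳ _))
               (ℕₚ.≤-trans (ℕₚ.n≤1+n _) (ℕₚ.m≤m+n _ _)))
        (#case-nil (#call (#var #∷ #var #∷ #[]) run) (#cons #nil #var))
    chop-spec f [] num num′ 1≤m n≤0 | inj₂ (r , _ , eq , _)
      with ℕₚ.≤-trans 1≤m (ℕₚ.≤-trans (ℕₚ.m≤m+n _ r) (subst (_≤ 0) eq n≤0))
    ... | ()
    chop-spec f (x ∷ xs) {m = m} num num′ 1≤m n≤xs | inj₂ (r , _ , eq , num″ , run)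
      with chop-spec f xs num″ num′ 1≤m (ℕₚ.≤-pred (ℕₚ.≤-trans
             (ℕₚ.+-monoˡ-≤ r 1≤m) (subst (_≤ suc (length xs)) eq n≤xs)))
    ... | as , bs , split , lower , upper , run′ =
      x ∷ as , bs , cong (x ∷_) split ,
      subst (_ ≤_) (sym eq) (ℕₚ.+-monoʳ-≤ m lower) ,
      subst (_< _) (sym eq) (ℕₚ.+-monoʳ-< m upper) ,
      weaken (ℕₚ.≤-reflexive (total m (suc (length xs) * (2 + m))))
        (#case-cons (#call (#var #∷ #var #∷ #[]) run)
          (#case-cons #var
            (#case-cons (#call (#var #∷ #var #∷ #var #∷ #[]) run′)
              (#cons (#cons #var #var) #var))))
      where
      total : ∀ m r → suc m + (suc r + 0) ≡ 2 + m + r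
      total = solve-∀

    append-spec : ∀ {m w n z} → Numeral m w → Numeral n z →
      ∃[ y ] Numeral (m + n) y × (w ∷ z ∷ [] ⊢ body append ⇓ y # m)
    append-spec nil num′ = _ , num′ , #case-nil #var #var
    append-spec (cons num) num′ with append-spec num num′
    ... | y , num″ , run =
      _ , cons num″ , #case-cons #var (#cons #var (#call (#var #∷ #var #∷ #[]) run))

    times-spec : ∀ {m w n z} → Numeral m w → Numeral n z →
      ∃[ y ] Numeral (m * n) y × (w ∷ z ∷ [] ⊢ body times ⇓ y # m * (2 + n))
    times-spec nil num′ = _ , nil , #case-nil #var #nil
    times-spec {suc m} {n = n} (cons num) num′ with times-spec num num′
    ... | y , num″ , run with append-spec num′ num″
    ...   | y′ , num‴ , run′ = y′ , num‴ ,
      weaken (ℕₚ.≤-reflexive (total (m * (2 + n)) n))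
        (#case-cons #var (#call (#var #∷ #call (#var #∷ #var #∷ #[]) run #∷ #[]) run′))
      where
      total : ∀ t n → suc t + 0 + suc n ≡ 2 + n + t
      total = solve-∀


    -- The two bounds pin the length of `ws` to the rounded logarithm. Only one half is visited, but
    -- two are charged, so that the bound for sorting serves here too.
    log-spec : (f : X → Value) → ∀ ℓ xs → length xs ≤ 2 ^ ℓ →
      ∃[ ws ] length xs < 2 ^ suc (length ws) × (1 ≤ length xs → 2 ^ length ws ≤ length xs) ×
        (enc f xs ∷ [] ⊢ body log ⇓ enc id ws # sortCost ℓ)
    log-spec f ℓ []      _ = [] , s≤s z≤n , (λ ()) , weaken z≤n (#case-nil #var #nil)
    log-spec f ℓ (_ ∷ []) _ = [] , ℕₚ.≤-refl , (λ _ → ℕₚ.≤-refl) ,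
      weaken z≤n (#case-cons #var (#case-nil #var #nil))
    log-spec f zero (_ ∷ _ ∷ _) (s≤s ())
    log-spec f (suc ℓ) xs@(x ∷ y ∷ zs) xs≤ =
      let as , bs , split , lower , upper , run =
            chop-spec f xs (enc-numeral f xs) (numeral-numeral 2) (s≤s z≤n) ℕₚ.≤-refl
          ws , above , below , run′ = log-spec f ℓ as (lower-half lower xs≤)
      in nil ∷ ws ,
      ℕₚ.≤-trans upper (ℕₚ.≤-trans (ℕₚ.*-monoˡ-≤ 2 above)
        (ℕₚ.≤-reflexive (ℕₚ.*-comm (2 ^ suc (length ws)) 2))) ,
      (λ _ → ℕₚ.≤-trans (ℕₚ.*-monoʳ-≤ 2 (below (positive-half {length as} (s≤s (s≤s z≤n)) upper)))
               (ℕₚ.≤-trans (ℕₚ.≤-reflexive (ℕₚ.*-comm 2 (length as))) lower)) ,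
      weaken (ℕₚ.≤-trans (≤-by _ (total (length xs) (sortCost ℓ))) (sortCost-suc ℓ xs≤))
        (#case-cons #var (#case-cons #var (#cons #nil
          (#case-cons (#call (#var #∷ #var #∷ #unary 2 #∷ #[]) run)
            (#call (#var #∷ #[]) run′)))))
      where
      total : ∀ n s → suc (suc n * 4) + suc s + (n + 3 + s) ≡ 5 * n + 9 + 2 * s
      total = solve-∀

    Item : ℕ → Set
    Item d = Point d × Value

    encItem : Item d → Value
    encItem (u , w) = cons (encodePoint u) w

    itemKey : Item (suc d) → Carrier
    itemKey (x ∷ _ , _) = x

    tailItem : Item (suc d) → Item d
    tailItem (_ ∷ u , w) = u , w

    encItems : List (Item d) → Value
    encItems = enc encItem

    #key : ∀ {n} {ρ : Vec Value n} {e} {k} (x : Item (suc d)) →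
           ρ ⊢ e ⇓ encItem x # k → ρ ⊢ key e ⇓ real (itemKey x) # k + 0
    #key (_ ∷ _ , _) run = #case-cons run (#case-cons #var #var)

    #first : ∀ {n} {ρ : Vec Value n} {e v w k} → ρ ⊢ e ⇓ cons v w # k → ρ ⊢ first e ⇓ v # k + 0
    #first run = #case-cons run #var

    #second : ∀ {n} {ρ : Vec Value n} {e v w k} → ρ ⊢ e ⇓ cons v w # k → ρ ⊢ second e ⇓ w # k + 0
    #second run = #case-cons run #var

    infix 4 _⊑_
    _⊑_ : Item (suc d) → Item (suc d) → Set
    x ⊑ y = itemKey x ≤ᵣ itemKey y

    Sorted : List (Item (suc d)) → Set
    Sorted = AllPairs _⊑_

    merge-spec : (xs ys : List (Item (suc d))) → Sorted xs → Sorted ys →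
      ∃[ zs ] zs ↭ xs ++ ys × Sorted zs ×
        (encItems xs ∷ encItems ys ∷ [] ⊢ body merge ⇓ encItems zs # length xs + length ys)
    merge-spec [] ys _ ys↑ = ys , ↭-refl , ys↑ , weaken z≤n (#case-nil #var #var)
    merge-spec {d} (x ∷ xs) ys (x⊑ ∷ xs↑) ys↑ = merge-cons ys ys↑
      where
      -- Inner induction on `ys` with `x ∷ xs` fixed; the call of `merge-spec` is on the shorter
      -- `xs`.
      merge-cons : (ys : List (Item (suc d))) → Sorted ys →
        ∃[ zs ] zs ↭ x ∷ xs ++ ys × Sorted zs ×
          (encItems (x ∷ xs) ∷ encItems ys ∷ [] ⊢ body merge ⇓ encItems zs
            # suc (length xs) + length ys)
      merge-cons [] _ = x ∷ xs , ↭-reflexive (sym (++-identityʳ (x ∷ xs))) , x⊑ ∷ xs↑ ,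
        weaken z≤n (#case-cons #var (#case-nil #var #var))
      merge-cons (y ∷ ys) (y⊑ ∷ ys↑) with itemKey x ≤? itemKey y
      ... | yes x≤y = let zs , perm , zs↑ , run = merge-spec xs (y ∷ ys) xs↑ (y⊑ ∷ ys↑) in
        x ∷ zs , prep x perm ,
        All-resp-↭ (↭-sym perm) (Allₚ.++⁺ x⊑ (x≤y ∷ All.map (O.trans x≤y) y⊑)) ∷ zs↑ ,
        #case-cons #var (#case-cons #var (#then (#key x #var) (#key y #var) x≤y
          (#cons #var (#call (#var #∷ #var #∷ #[]) run))))
      ... | no x≰y = let zs , perm , zs↑ , run = merge-cons ys ys↑
                         y≤x = ≰⇒≥ x≰y in
        y ∷ zs , ↭-trans (prep y perm) (↭-sym (shift y (x ∷ xs) ys)) ,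
        All-resp-↭ (↭-sym perm) (Allₚ.++⁺ (y≤x ∷ All.map (O.trans y≤x) x⊑) y⊑) ∷ zs↑ ,
        weaken (s≤s (ℕₚ.≤-reflexive (sym (ℕₚ.+-suc (length xs) (length ys)))))
          (#case-cons #var (#case-cons #var (#else (#key x #var) (#key y #var) x≰y
            (#cons #var (#call (#var #∷ #var #∷ #[]) run)))))

    sort-spec : ∀ ℓ (xs : List (Item (suc d))) → length xs ≤ 2 ^ ℓ →
      ∃[ ys ] ys ↭ xs × Sorted ys × (encItems xs ∷ [] ⊢ body sort ⇓ encItems ys # sortCost ℓ)
    sort-spec ℓ [] _ = [] , ↭-refl , [] , weaken z≤n (#case-nil #var #nil)
    sort-spec ℓ (x ∷ []) _ = x ∷ [] , ↭-refl , [] ∷ [] ,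
      weaken z≤n (#case-cons #var (#case-nil #var #var))
    sort-spec zero (_ ∷ _ ∷ _) (s≤s ())
    sort-spec (suc ℓ) xs@(_ ∷ _ ∷ _) xs≤ =
      let as , bs , split , lower , upper , run =
            chop-spec encItem xs (enc-numeral encItem xs) (numeral-numeral 2) (s≤s z≤n) ℕₚ.≤-refl
          lengths = trans (sym (length-++ as)) (cong length split)
          as′ , perm , as↑ , run₁ = sort-spec ℓ as (lower-half lower xs≤)
          bs′ , perm′ , bs↑ , run₂ = sort-spec ℓ bs (upper-half lengths upper xs≤)
          ys , perm″ , ys↑ , run₃ = merge-spec as′ bs′ as↑ bs↑
      in ys ,
      ↭-trans perm″ (↭-trans (++⁺ perm perm′) (↭-reflexive split)) , ys↑ ,
      weaken (ℕₚ.≤-trans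
          (cost (trans (cong₂ _+_ (↭-length perm) (↭-length perm′)) lengths)) (sortCost-suc ℓ xs≤))
        (#case-cons #var (#case-cons #var
          (#case-cons (#call (#var #∷ #var #∷ #unary 2 #∷ #[]) run)
            (#call (#call (#var #∷ #[]) run₁ #∷ #call (#var #∷ #[]) run₂ #∷ #[]) run₃))))
      where
      total : ∀ n s → suc (suc n * 4) + (suc s + (suc s + 0) + suc n) + 1 ≡ 5 * n + 9 + 2 * s
      total = solve-∀
      cost : ∀ {m n s} → m ≡ n → suc (suc n * 4) + (suc s + (suc s + 0) + suc m) ≤ 5 * n + 9 + 2 * s
      cost {n = n} {s} refl = ≤-by 1 (total n s)

-- Partition, brute force and the combination of sub-searches

module Search where

  open import Defs
  open Evaluation
  open Algorithm
  open Recurrence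
  open Lists
  open import Data.Empty using (⊥-elim)
  open import Data.Fin.Base using (zero; suc)
  open import Data.List.Base using (List; []; _∷_; _++_; length; map)
  open import Data.List.Membership.Propositional using (_∈_)
  open import Data.List.Membership.Propositional.Properties using (∈-++⁻; ∈-++⁺ˡ; ∈-++⁺ʳ; ∈-map⁺; ∈-map⁻)
  open import Data.List.Relation.Unary.AllPairs using (AllPairs; []; _∷_)
  open import Data.List.Relation.Unary.All as All using (All; []; _∷_)
  open import Data.List.Relation.Unary.Any using (here; there)
  open import Data.List.Relation.Binary.Permutation.Propositional using (_↭_; ↭-refl; ↭-trans; ↭-sym; prep)
  open import Data.List.Relation.Binary.Permutation.Propositional.Properties using (shift; ∈-resp-↭)
  open import Data.Nat.Base using (ℕ; zero; suc; _+_; _*_; _^_; _≤_; z≤n; s≤s)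
  import Data.Nat.Properties as ℕₚ
  open import Data.Nat.Tactic.RingSolver using (solve-∀)
  open import Data.Product.Base using (∃-syntax; ∃₂; _×_; _,_; proj₁; proj₂)
  open import Data.Sum.Base using (_⊎_; inj₁; inj₂; [_,_]′)
  open import Data.Vec.Base using (Vec; []; _∷_)
  open import Relation.Binary.PropositionalEquality using (_≡_; refl; trans)
  open import Relation.Binary.Structures using (IsDecTotalOrder)
  open import Relation.Nullary using (¬_; yes; no)

  -- An upper bound for the calls made at a node other than the recursive ones,
  -- for sets of at most 2 ^ ℓ items with at most D coordinates.
  nodeCost : (ℓ m D : ℕ) → ℕ
  nodeCost ℓ m D = sortCost ℓ + suc (2 ^ ℓ) * (2 + m) + m * (2 + 2 ^ ℓ * (2 + D)) + 4 * 2 ^ ℓ + 9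

  module NodeCost (ℓ m D : ℕ) where
    private
      s = sortCost ℓ
      n = 2 ^ ℓ
      W = nodeCost ℓ m D

    -- At a leaf the comparisons are charged to its mass `a * b`, at most `2 + D` calls per pair;
    -- only the remaining linear work is charged to the node.
    brute≤nodeCost : ∀ {a} b {d} → a ≤ n → d ≤ D →
      suc (a * (2 + b * (2 + d))) ≤ W * 1 + (2 + D) * (a * b)
    brute≤nodeCost {a} b {d} a≤n d≤D = begin
      suc (a * (2 + b * (2 + d)))     ≡⟨ expand a b d ⟩
      (1 + 2 * a) + (2 + d) * (a * b)
        ≤⟨ ℕₚ.+-mono-≤ (ℕₚ.≤-trans (ℕₚ.+-monoʳ-≤ 1 (ℕₚ.*-monoʳ-≤ 2 a≤n)) small)
             (ℕₚ.*-monoˡ-≤ (a * b) (ℕₚ.+-monoʳ-≤ 2 d≤D)) ⟩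
      W * 1 + (2 + D) * (a * b)       ∎
      where
      open ℕₚ.≤-Reasoning
      expand : ∀ a b d → suc (a * (2 + b * (2 + d))) ≡ (1 + 2 * a) + (2 + d) * (a * b)
      expand = solve-∀
      rest : ∀ n s t u → 1 + 2 * n + (s + t + u + 2 * n + 8) ≡ (s + t + u + 4 * n + 9) * 1
      rest = solve-∀
      small : 1 + 2 * n ≤ W * 1
      small = ≤-by _ (rest n s (suc n * (2 + m)) (m * (2 + n * (2 + D))))

    -- When `A` is too small to split, brute force meets at most `m * 2 ^ ℓ` pairs and fits into the
    -- cost of the node itself. Such nodes contribute nothing to the leaf mass.
    unsplit≤nodeCost : ∀ {a a′ b d} → a′ ≤ n → a ≤ m → b ≤ n → d ≤ D →
      suc s + (suc (suc a′ * (2 + m)) + suc (a * (2 + b * (2 + d)))) ≤ W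
    unsplit≤nodeCost {a} {a′} {b} {d} a′≤n a≤m b≤n d≤D = begin
      suc s + (suc (suc a′ * (2 + m)) + suc (a * (2 + b * (2 + d))))
        ≤⟨ ℕₚ.+-monoʳ-≤ (suc s) (ℕₚ.+-mono-≤ (s≤s (ℕₚ.*-monoˡ-≤ (2 + m) (s≤s a′≤n)))
             (s≤s (ℕₚ.*-mono-≤ a≤m (ℕₚ.+-monoʳ-≤ 2 (ℕₚ.*-mono-≤ b≤n (ℕₚ.+-monoʳ-≤ 2 d≤D)))))) ⟩
      suc s + (suc (suc n * (2 + m)) + suc (m * (2 + n * (2 + D))))
        ≤⟨ ≤-by _ (rest n s (suc n * (2 + m)) (m * (2 + n * (2 + D)))) ⟩
      W ∎
      where
      open ℕₚ.≤-Reasoning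
      rest : ∀ n s t u → suc s + (suc t + suc u) + (4 * n + 6) ≡ s + t + u + 4 * n + 9
      rest = solve-∀

    split≤nodeCost : ∀ {a b a₂ lo} v₁ v₃ x₁ x₂ x₃ → a ≤ n → b ≤ n → a₂ ≤ n → lo ≤ n →
      suc s + (suc (suc a * (2 + m)) + (suc b +
        (suc (W * v₁ + (2 + D) * x₁) + (suc (W * v₁ + (2 + D) * x₂) +
          (suc a₂ + (suc lo + 0) + suc (W * v₃ + (2 + D) * x₃))))))
      ≤ W * suc (v₁ + v₁ + v₃) + (2 + D) * (x₁ + x₂ + x₃)
    split≤nodeCost {a} {b} {a₂} {lo} v₁ v₃ x₁ x₂ x₃ a≤n b≤n a₂≤n lo≤n = begin
      suc s + (suc (suc a * (2 + m)) + (suc b +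
        (suc (W * v₁ + (2 + D) * x₁) + (suc (W * v₁ + (2 + D) * x₂) +
          (suc a₂ + (suc lo + 0) + suc (W * v₃ + (2 + D) * x₃))))))
        ≡⟨ regroup s (suc a * (2 + m)) b a₂ lo W v₁ v₃ (2 + D) x₁ x₂ x₃ ⟩
      (s + suc a * (2 + m) + (b + a₂ + lo) + 8)
        + (W * (v₁ + v₁ + v₃) + (2 + D) * (x₁ + x₂ + x₃))
        ≤⟨ ℕₚ.+-monoˡ-≤ _ (ℕₚ.+-monoˡ-≤ 8 (ℕₚ.+-mono-≤
             (ℕₚ.+-monoʳ-≤ s (ℕₚ.*-monoˡ-≤ (2 + m) (s≤s a≤n)))
             (ℕₚ.+-mono-≤ (ℕₚ.+-mono-≤ b≤n a₂≤n) lo≤n))) ⟩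
      (s + suc n * (2 + m) + (n + n + n) + 8)
        + (W * (v₁ + v₁ + v₃) + (2 + D) * (x₁ + x₂ + x₃))
        ≤⟨ ℕₚ.+-monoˡ-≤ _ (≤-by {s + suc n * (2 + m) + (n + n + n) + 8} _
             (rest n s (suc n * (2 + m)) (m * (2 + n * (2 + D))))) ⟩
      W + (W * (v₁ + v₁ + v₃) + (2 + D) * (x₁ + x₂ + x₃))
        ≡⟨ collect W (v₁ + v₁ + v₃) ((2 + D) * (x₁ + x₂ + x₃)) ⟩
      W * suc (v₁ + v₁ + v₃) + (2 + D) * (x₁ + x₂ + x₃) ∎
      where
      open ℕₚ.≤-Reasoning
      regroup : ∀ s t b a₂ lo W v₁ v₃ D x₁ x₂ x₃ →
        suc s + (suc t + (suc b + (suc (W * v₁ + D * x₁) + (suc (W * v₁ + D * x₂) +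
          (suc a₂ + (suc lo + 0) + suc (W * v₃ + D * x₃))))))
        ≡ (s + t + (b + a₂ + lo) + 8) + (W * (v₁ + v₁ + v₃) + D * (x₁ + x₂ + x₃))
      regroup = solve-∀
      rest : ∀ n s t u → s + t + (n + n + n) + 8 + (u + n + 1) ≡ s + t + u + 4 * n + 9
      rest = solve-∀
      collect : ∀ W v x → W + (W * v + x) ≡ W * suc v + x
      collect = solve-∀

  module Searching (R : Reals) where
    open Reals R using (isDecTotalOrder) renaming (_≤_ to _≤ᵣ_)
    private
      open module O = IsDecTotalOrder isDecTotalOrder using (_≤?_)
    open Semantics R using (Value; nil; real; cons)
    open VectorDomination R using (Point; encodePoint; _≽_)
    open Spec R

    private variable
      d : ℕ

    partition-spec : ∀ t (B : List (Item (suc d))) →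
      ∃₂ λ lo hi → B ↭ lo ++ hi × All (λ y → itemKey y ≤ᵣ t) lo × All (λ y → ¬ itemKey y ≤ᵣ t) hi ×
        (encItems B ∷ real t ∷ [] ⊢ body partition ⇓ cons (encItems lo) (encItems hi) # length B)
    partition-spec t [] = [] , [] , ↭-refl , [] , [] , #case-nil #var (#cons #nil #nil)
    partition-spec t (y ∷ B) with itemKey y ≤? t
    ... | yes y≤t = let lo , hi , perm , lo≤ , hi≰ , run = partition-spec t B in
      y ∷ lo , hi , prep y perm , y≤t ∷ lo≤ , hi≰ ,
      weaken (ℕₚ.≤-reflexive (ℕₚ.+-identityʳ _))
        (#case-cons #var (#case-cons (#call (#var #∷ #var #∷ #[]) run)
          (#then (#key y #var) #var y≤t (#cons (#cons #var #var) #var))))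
    ... | no y≰t = let lo , hi , perm , lo≤ , hi≰ , run = partition-spec t B in
      lo , y ∷ hi , ↭-trans (prep y perm) (↭-sym (shift y lo hi)) , lo≤ , y≰t ∷ hi≰ ,
      weaken (ℕₚ.≤-reflexive (ℕₚ.+-identityʳ _))
        (#case-cons #var (#case-cons (#call (#var #∷ #var #∷ #[]) run)
          (#else (#key y #var) #var y≰t (#cons #var (#cons #var #var)))))

    tails-spec : (xs : List (Item (suc d))) →
      encItems xs ∷ [] ⊢ body tails ⇓ encItems (map tailItem xs) # length xs
    tails-spec [] = #case-nil #var #nil
    tails-spec ((_ ∷ _ , _) ∷ xs) =
      #case-cons #var (#cons (#case-cons #var (#case-cons #var (#cons #var #var)))
        (#call (#var #∷ #[]) (tails-spec xs)))

    dominates-spec : (u v : Point d) →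
      (u ≽ v × (encodePoint u ∷ encodePoint v ∷ [] ⊢ body dominates ⇓ cons nil nil # d)) ⊎
      (¬ u ≽ v × (encodePoint u ∷ encodePoint v ∷ [] ⊢ body dominates ⇓ nil # d))
    dominates-spec [] [] = inj₁ ((λ ()) , #case-nil #var (#cons #nil #nil))
    dominates-spec (x ∷ u) (y ∷ v) with y ≤? x | dominates-spec u v
    ... | yes y≤x | inj₁ (u≽v , run) = inj₁ ((λ { zero → y≤x ; (suc k) → u≽v k }) ,
      #case-cons #var (#case-cons #var (#then #var #var y≤x (#call (#var #∷ #var #∷ #[]) run))))
    ... | yes y≤x | inj₂ (u⋡v , run) = inj₂ ((λ h → u⋡v (λ k → h (suc k))) ,
      #case-cons #var (#case-cons #var (#then #var #var y≤x (#call (#var #∷ #var #∷ #[]) run))))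
    ... | no y≰x | _ = inj₂ ((λ h → y≰x (h zero)) ,
      weaken z≤n (#case-cons #var (#case-cons #var (#else #var #var y≰x #nil))))

    data Outcome (S : Value → Value → Set) : Value → Set where
      found : ∀ {v w} → S v w → Outcome S (cons v w)
      none  : (∀ {v w} → ¬ S v w) → Outcome S nil

    -- `found` travels along the first map and `none` along the second, so the two relations have to
    -- be equivalent.
    mapOutcome : ∀ {S T : Value → Value → Set} → (∀ {v w} → S v w → T v w) →
                 (∀ {v w} → T v w → S v w) → ∀ {z} → Outcome S z → Outcome T z
    mapOutcome to from (found s) = found (to s)
    mapOutcome to from (none ¬s) = none (λ t → ¬s (from t))

    #orElse : ∀ {n} {ρ : Vec Value n} {e e′ z z′ k k′} {S T : Value → Value → Set} →
      ρ ⊢ e ⇓ z # k → Outcome S z → ρ ⊢ e′ ⇓ z′ # k′ → Outcome T z′ →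
      ∃[ y ] Outcome (λ v w → S v w ⊎ T v w) y × (ρ ⊢ e orElse e′ ⇓ y # k + k′)
    #orElse {k = k} run (found s) run′ _ = _ , found (inj₁ s) ,
      weaken (ℕₚ.+-monoʳ-≤ k z≤n) (#case-cons run (#cons #var #var))
    #orElse run (none ¬s) run′ (found t) = _ , found (inj₂ t) , #case-nil run run′
    #orElse run (none ¬s) run′ (none ¬t) = _ , none [ ¬s , ¬t ]′ , #case-nil run run′

    -- Domination concerns the coordinates still attached to the items, whereas the reported values
    -- are the second components, which stay the same when a coordinate is dropped.
    data Solution (A B : List (Item d)) : Value → Value → Set where
      solution : ∀ {x y} → x ∈ A → y ∈ B → proj₁ x ≽ proj₁ y → Solution A B (proj₂ x) (proj₂ y)

    row-spec : (x : Item d) (B : List (Item d)) →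
      ∃[ z ] Outcome (Solution (x ∷ []) B) z ×
        (encItem x ∷ encItems B ∷ [] ⊢ body row ⇓ z # length B * (2 + d))
    row-spec x [] = _ , none (λ { (solution _ () _) }) , #case-nil #var #nil
    row-spec {d} x (y ∷ B) with dominates-spec (proj₁ x) (proj₁ y)
    ... | inj₁ (x≽y , run) = _ , found (solution (here refl) (here refl) x≽y) ,
      weaken (≤-by (suc (length B * (2 + d))) (total d (length B * (2 + d))))
        (#case-cons #var (#case-cons (#call (#first #var #∷ #first #var #∷ #[]) run)
          (#cons (#second #var) (#second #var))))
      where
      total : ∀ d r → suc d + 0 + suc r ≡ 2 + d + r
      total = solve-∀
    ... | inj₂ (x⋡y , run) = let z , outcome , run′ = row-spec x B in z ,
      mapOutcome (λ { (solution p q h) → solution p (there q) h })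
        (λ { (solution (here refl) (here refl) h) → ⊥-elim (x⋡y h)
           ; (solution p (there q) h) → solution p q h }) outcome ,
      weaken (ℕₚ.≤-reflexive (total d (length B * (2 + d))))
        (#case-cons #var (#case-nil (#call (#first #var #∷ #first #var #∷ #[]) run)
          (#call (#var #∷ #var #∷ #[]) run′)))
      where
      total : ∀ d r → suc d + suc r ≡ 2 + d + r
      total = solve-∀

    brute-spec : (A B : List (Item d)) →
      ∃[ z ] Outcome (Solution A B) z ×
        (encItems A ∷ encItems B ∷ [] ⊢ body brute ⇓ z # length A * (2 + length B * (2 + d)))
    brute-spec [] B = _ , none (λ { (solution () _ _) }) , #case-nil #var #nil
    brute-spec {d} (x ∷ A) B =
      let z , outcome , run    = row-spec x B
          z′ , outcome′ , run′ = brute-spec A B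
          y , outcome″ , run″  = #orElse (#call (#var #∷ #var #∷ #[]) run) outcome
                                         (#call (#var #∷ #var #∷ #[]) run′) outcome′
      in y ,
      mapOutcome (λ { (inj₁ (solution (here refl) q h)) → solution (here refl) q h
                    ; (inj₂ (solution p q h)) → solution (there p) q h })
                 (λ { (solution (here refl) q h) → inj₁ (solution (here refl) q h)
                    ; (solution (there p) q h) → inj₂ (solution p q h) }) outcome″ ,
      weaken (ℕₚ.≤-reflexive (total (length B * (2 + d)) (length A * (2 + length B * (2 + d)))))
        (#case-cons #var run″)
      where
      total : ∀ b r → suc b + suc r ≡ 2 + b + r
      total = solve-∀

    AllPairs-++⁻ : ∀ {X : Set} {_~_ : X → X → Set} xs {ys} → AllPairs _~_ (xs ++ ys) →
                   (∀ {x y} → x ∈ xs → y ∈ ys → x ~ y) × AllPairs _~_ ys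
    AllPairs-++⁻ []       pairs = (λ ()) , pairs
    AllPairs-++⁻ (x ∷ xs) (x~ ∷ pairs) = let across , right = AllPairs-++⁻ xs pairs in
      (λ { (here refl) q → All.lookup x~ (∈-++⁺ʳ xs q) ; (there p) q → across p q }) , right

    ≽-head : (x y : Item (suc d)) → proj₁ x ≽ proj₁ y → y ⊑ x
    ≽-head (_ ∷ _ , _) (_ ∷ _ , _) h = h zero

    -- The items of S₁ ++ (z ∷ S₂) are sorted by their first coordinate, and the
    -- key of z separates lo from hi: no item of S₁ dominates one of hi, and
    -- between z ∷ S₂ and lo the first coordinate need not be compared.
    split-outcome : ∀ {A B : List (Item (suc d))} S₁ z S₂ lo hi →
      S₁ ++ z ∷ S₂ ↭ A → Sorted (S₁ ++ z ∷ S₂) → B ↭ lo ++ hi →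
      All (λ y → itemKey y ≤ᵣ itemKey z) lo → All (λ y → ¬ itemKey y ≤ᵣ itemKey z) hi →
      ∀ {w} → Outcome (λ v v′ → Solution S₁ lo v v′ ⊎ Solution (z ∷ S₂) hi v v′ ⊎
                        Solution (map tailItem (z ∷ S₂)) (map tailItem lo) v v′) w →
      Outcome (Solution A B) w
    split-outcome {A = A} {B} S₁ z S₂ lo hi permA sorted permB lo≤ hi≰ = mapOutcome to from
      where
      across = proj₁ (AllPairs-++⁻ S₁ sorted)
      ∈A : ∀ {x} → x ∈ S₁ ++ z ∷ S₂ → x ∈ A
      ∈A = ∈-resp-↭ permA
      ∈B : ∀ {y} → y ∈ lo ++ hi → y ∈ B
      ∈B = ∈-resp-↭ (↭-sym permB)

      z⊑ : ∀ {x} → x ∈ z ∷ S₂ → z ⊑ x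
      z⊑ with proj₂ (AllPairs-++⁻ S₁ sorted)
      ... | z⊑S₂ ∷ _ = λ { (here refl) → O.refl ; (there p) → All.lookup z⊑S₂ p }

      untail : ∀ {v v′} → Solution (map tailItem (z ∷ S₂)) (map tailItem lo) v v′ → Solution A B v v′
      untail (solution p q h) with ∈-map⁻ tailItem p | ∈-map⁻ tailItem q
      ... | (a ∷ u , w) , x∈ , refl | (b ∷ u′ , w′) , y∈ , refl =
        solution (∈A (∈-++⁺ʳ S₁ x∈)) (∈B (∈-++⁺ˡ y∈))
          λ { zero → O.trans (All.lookup lo≤ y∈) (z⊑ x∈) ; (suc k) → h k }

      to : ∀ {v v′} → Solution S₁ lo v v′ ⊎ Solution (z ∷ S₂) hi v v′ ⊎
           Solution (map tailItem (z ∷ S₂)) (map tailItem lo) v v′ → Solution A B v v′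
      to (inj₁ (solution p q h))        = solution (∈A (∈-++⁺ˡ p)) (∈B (∈-++⁺ˡ q)) h
      to (inj₂ (inj₁ (solution p q h))) = solution (∈A (∈-++⁺ʳ S₁ p)) (∈B (∈-++⁺ʳ lo q)) h
      to (inj₂ (inj₂ s))                = untail s

      from : ∀ {v v′} → Solution A B v v′ → Solution S₁ lo v v′ ⊎ Solution (z ∷ S₂) hi v v′ ⊎
             Solution (map tailItem (z ∷ S₂)) (map tailItem lo) v v′
      from (solution {x} {y} p q h)
        with ∈-++⁻ S₁ (∈-resp-↭ (↭-sym permA) p) | ∈-++⁻ lo (∈-resp-↭ permB q)
      ... | inj₁ x∈ | inj₁ y∈ = inj₁ (solution x∈ y∈ h)
      -- Domination would place the key of `y` below that of `x`, hence below that of `z`, against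
      -- `hi≰`.
      ... | inj₁ x∈ | inj₂ y∈ = ⊥-elim (All.lookup hi≰ y∈
        (O.trans (≽-head x y h) (across x∈ (here refl))))
      ... | inj₂ x∈ | inj₂ y∈ = inj₂ (inj₁ (solution x∈ y∈ h))
      from (solution {_ ∷ _ , _} {_ ∷ _ , _} p q h) | inj₂ x∈ | inj₁ y∈ =
        inj₂ (inj₂ (solution (∈-map⁺ tailItem x∈) (∈-map⁺ tailItem y∈) (λ k → h (suc k))))

-- Correctness and cost of the recursive search

module Solve where

  open import Defs
  open Evaluation
  open Algorithm
  open Recurrence
  open Lists
  open Search
  open import Data.Empty using (⊥-elim)
  open import Data.List.Base using (List; []; _∷_; _++_; length; map)
  open import Data.List.Properties using (length-++; length-map; ++-identityʳ)
  open import Data.List.Relation.Unary.Any using (here)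
  open import Data.List.Relation.Binary.Permutation.Propositional using (_↭_)
  open import Data.List.Relation.Binary.Permutation.Propositional.Properties using (↭-length)
  open import Data.Nat.Base using (ℕ; suc; _+_; _*_; _^_; _≤_; _<_; z≤n; s≤s)
  import Data.Nat.Properties as ℕₚ
  open import Data.Product.Base using (∃₂; _×_; _,_)
  open import Data.Vec.Base using ([]; _∷_)
  open import Relation.Binary.PropositionalEquality using (_≡_; refl; sym; trans; cong; cong₂; subst)

  module Solving (R : Reals) where
    open Semantics R using (Value; nil; cons)
    open Spec R
    open Searching R

    module _ (m Q ℓ D : ℕ) (4≤m : 4 ≤ m) (Q+2≡m³ : Q + 2 ≡ m * (m * m))
             {M : Value} (numM : Numeral m M) where
      open Masses m Q 4≤m Q+2≡m³
      open NodeCost ℓ m D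

      -- `x` is the mass of the leaves at which the splits ran out. A pair in them costs at most
      -- `2 + D` calls; everything else is covered by `nodeCost` per node.
      SolveSpec : (j : ℕ) {d : ℕ} (J : Value) (A B : List (Item d)) → Set
      SolveSpec j {d} J A B = ∃₂ λ z x → Outcome (Solution A B) z × LeafMass j d (length A * length B) x ×
        (encItems A ∷ encItems B ∷ J ∷ M ∷ [] ⊢ body solve ⇓ z
          # nodeCost ℓ m D * nodes j d + (2 + D) * x)

      ≤-left : ∀ {a b c n} → a + b ≡ c → c ≤ n → a ≤ n
      ≤-left {a} {b} refl c≤n = ℕₚ.≤-trans (ℕₚ.m≤m+n a b) c≤n

      ≤-right : ∀ {a b c n} → a + b ≡ c → c ≤ n → b ≤ n
      ≤-right {a} {b} refl c≤n = ℕₚ.≤-trans (ℕₚ.m≤n+m b a) c≤n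

      solve-spec : ∀ {j J} → Numeral j J → ∀ {d} (A B : List (Item d)) → d ≤ D →
                   length A ≤ 2 ^ ℓ → length B ≤ 2 ^ ℓ → SolveSpec j J A B
      solve-spec nil {d} A B d≤D A≤ B≤ = let z , outcome , run = brute-spec A B in
        z , length A * length B , outcome , leafMass-brute d (length A * length B) ,
        weaken (brute≤nodeCost (length B) A≤ d≤D) (#case-nil #var (#call (#var #∷ #var #∷ #[]) run))
      solve-spec {suc j} (cons _) [] B _ _ _ = nil , 0 , none (λ { (solution () _ _) }) , z≤n ,
        weaken z≤n (#case-cons #var (#case-nil #var #nil))
      solve-spec {suc j} (cons _) (([] , _) ∷ A) [] _ _ _ = nil , 0 ,
        none (λ { (solution _ () _) }) , z≤n ,
        weaken z≤n (#case-cons #var (#case-cons #var (#case-nil (#first #var) (#case-nil #var #nil))))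
      solve-spec {suc j} (cons _) (([] , _) ∷ A) (([] , _) ∷ B) _ _ _ = _ , 0 ,
        found (solution (here refl) (here refl) (λ ())) , z≤n ,
        weaken z≤n (#case-cons #var (#case-cons #var (#case-nil (#first #var)
          (#case-cons #var (#cons (#second #var) (#second #var))))))
      solve-spec {suc j} {J} numJ@(cons num) {suc d} A@((_ ∷ _ , _) ∷ _) B d≤D A≤ B≤ =
        let S , perm , sorted , run₁ = sort-spec ℓ A A≤
            as , bs , split , lower , upper , run₂ = chop-spec encItem S (enc-numeral encItem S) numM
              (ℕₚ.≤-trans (s≤s z≤n) 4≤m) ℕₚ.≤-refl
        in chopped as bs S perm sorted split run₁ run₂ lower upper
        where
        chopped : ∀ as bs S → S ↭ A → Sorted S → as ++ bs ≡ S →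
          (encItems A ∷ [] ⊢ body sort ⇓ encItems S # sortCost ℓ) →
          (encItems S ∷ encItems S ∷ M ∷ [] ⊢ body chop ⇓ cons (encItems as) (encItems bs)
            # suc (length S) * (2 + m)) →
          length as * m ≤ length S → length S < suc (length as) * m →
          SolveSpec (suc j) J A B
        chopped [] bs S perm sorted split run₁ run₂ lower upper =
          let z , outcome , run = brute-spec A B in
          z , 0 , outcome , z≤n ,
          weaken (ℕₚ.≤-trans
              (unsplit≤nodeCost (subst (_≤ 2 ^ ℓ) (sym (↭-length perm)) A≤) A≤m B≤ d≤D)
              (ℕₚ.≤-trans (ℕₚ.m≤m*n (nodeCost ℓ m D) (nodes (suc j) (suc d))) (ℕₚ.m≤m+n _ _)))
            (#case-cons #var (#case-cons #var (#case-cons (#first #var)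
              (#let (#call (#var #∷ #[]) run₁)
                (#case-cons (#call (#var #∷ #var #∷ #var #∷ #[]) run₂)
                  (#case-nil #var (#call (#var #∷ #var #∷ #[]) run)))))))
          where
          A≤m : length A ≤ m
          A≤m = ℕₚ.≤-trans (ℕₚ.≤-reflexive (sym (↭-length perm)))
            (ℕₚ.≤-trans (ℕₚ.<⇒≤ upper) (ℕₚ.≤-reflexive (ℕₚ.+-identityʳ m)))
        -- A nonempty `as` making up all of `S` would satisfy `length as * m ≤ length as`, although
        -- `4 ≤ m`.
        chopped (a ∷ as) [] .(a ∷ as ++ []) perm sorted refl run₁ run₂ lower upper =
          ⊥-elim (ℕₚ.<⇒≱ (ℕₚ.m<m*n (suc (length as)) m (ℕₚ.≤-trans (s≤s (s≤s z≤n)) 4≤m))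
            (ℕₚ.≤-trans lower (ℕₚ.≤-reflexive (cong length (++-identityʳ (a ∷ as))))))
        chopped as@(_ ∷ _) (z ∷ bs) .(as ++ z ∷ bs) perm sorted refl run₁ run₂ lower upper =
          let lenS = length-++ as
              lenA = trans (sym lenS) (↭-length perm)
              lo , hi , permB , lo≤ , hi≰ , run₃ = partition-spec (itemKey z) B
              lenB = trans (sym (length-++ lo)) (sym (↭-length permB))
              lenT : length (map tailItem (z ∷ bs)) ≡ length (z ∷ bs)
              lenT = length-map tailItem (z ∷ bs)
              lenL : length (map tailItem lo) ≡ length lo
              lenL = length-map tailItem lo
              z₁ , x₁ , out₁ , mass₁ , run₄ = solve-spec num as lo d≤D (≤-left lenA A≤) (≤-left lenB B≤)
              z₂ , x₂ , out₂ , mass₂ , run₅ = solve-spec num (z ∷ bs) hi d≤D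
                (≤-right {length as} lenA A≤) (≤-right {length lo} lenB B≤)
              -- The numeral is kept and the dimension falls: the recursion is lexicographic in
              -- these two.
              z₃ , x₃ , out₃ , mass₃ , run₆ = solve-spec numJ (map tailItem (z ∷ bs)) (map tailItem lo)
                (ℕₚ.≤-trans (ℕₚ.n≤1+n d) d≤D)
                (subst (_≤ 2 ^ ℓ) (sym lenT) (≤-right {length as} lenA A≤))
                (subst (_≤ 2 ^ ℓ) (sym lenL) (≤-left lenB B≤))
              _ , out₂₃ , run₂₃ = #orElse
                (#call (#var #∷ #var #∷ #var #∷ #var #∷ #[]) run₅) out₂
                (#call (#call (#var #∷ #[]) (tails-spec (z ∷ bs)) #∷ #call (#var #∷ #[]) (tails-spec lo)
                        #∷ #var #∷ #var #∷ #[]) run₆) out₃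
              w , out , run₁₂₃ = #orElse
                (#call (#var #∷ #var #∷ #var #∷ #var #∷ #[]) run₄) out₁ run₂₃ out₂₃
          in w , x₁ + x₂ + x₃ , split-outcome as z bs lo hi perm sorted permB lo≤ hi≰ out ,
             subst (λ M → LeafMass (suc j) (suc d) M (x₁ + x₂ + x₃)) (cong₂ _*_ lenA lenB)
               (leafMass-split {j} {d} {length as} {length (z ∷ bs)} {length lo} {length hi} {x₁} {x₂} {x₃}
                 (s≤s z≤n) (subst (length as * m ≤_) lenS lower) (subst (_< suc (length as) * m) lenS upper)
                 mass₁ mass₂ (subst (λ M → LeafMass (suc j) d M x₃) (cong₂ _*_ lenT lenL) mass₃)) ,
             weaken (split≤nodeCost (nodes j (suc d)) (nodes (suc j) d) x₁ x₂ x₃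
                 (subst (_≤ 2 ^ ℓ) (sym (↭-length perm)) A≤) B≤ (≤-right {length as} lenA A≤)
                 (≤-left lenB B≤))
               (#case-cons #var (#case-cons #var (#case-cons (#first #var)
                 (#let (#call (#var #∷ #[]) run₁)
                   (#case-cons (#call (#var #∷ #var #∷ #var #∷ #[]) run₂)
                     (#case-cons #var (#case-cons #var
                       (#case-cons (#call (#var #∷ #key z #var #∷ #[]) run₃) run₁₂₃))))))))

-- Parameters and the main program

module Main where

  open import Defs
  open Evaluation
  open Algorithm
  open Recurrence
  open Lists
  open Search
  open Solve
  open import Data.Fin.Base using (suc)
  open import Data.List.Base using (List; []; _∷_; length)
  import Data.List.Membership.Propositional as List∈
  import Data.List.Relation.Unary.Any as ListAny
  open import Data.Nat.Base as ℕ using (ℕ; suc; _+_; _*_; _^_; _≤_; _<_; z≤n; s≤s)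
  import Data.Nat.Properties as ℕₚ
  open import Data.Nat.Tactic.RingSolver using (solve-∀)
  open import Data.Product.Base using (∃-syntax; ∃₂; _×_; _,_; proj₁; proj₂)
  open import Data.Vec.Base as Vec using (Vec; []; _∷_)
  open import Data.Vec.Properties using (length-toList)
  open import Data.Vec.Relation.Unary.Any using (here; there)
  import Data.Vec.Relation.Binary.Pointwise.Inductive as Pointwise
  import Data.Vec.Membership.Setoid as Membership
  open import Function.Base using (id)
  open import Relation.Binary.Bundles using (Setoid)
  open import Relation.Binary.PropositionalEquality using (_≡_; refl; sym; cong; cong₂; subst)
  open import Relation.Binary.Structures using (IsDecTotalOrder)

  2≤multiple : ∀ k {e} → e ≡ 72 * suc k → 2 ≤ e
  2≤multiple k e≡ = ℕₚ.≤-trans (ℕₚ.≤-trans (ℕₚ.m≤m+n 2 70) (ℕₚ.m≤m*n 72 (suc k)))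
    (ℕₚ.≤-reflexive (sym e≡))

  -- The values computed by the main program: L is the length of n in binary, and
  -- the search is solve with J splits at the lowest 1/e² of the vectors.
  record Parameters (n d : ℕ) : Set where
    field
      L k e Q J : ℕ
      n<2^L  : n < 2 ^ L
      2^L≤2n : 2 ^ L ≤ 2 * n
      kL≤d   : k * L ≤ d
      d<kL+L : d < suc k * L
      e≡     : e ≡ 72 * suc k
      Je≤L   : J * e ≤ L
      L<Je+e : L < suc J * e
      Q+2≡m³ : Q + 2 ≡ e * e * (e * e * (e * e))

    4≤m : 4 ≤ e * e
    4≤m = ℕₚ.*-mono-≤ (2≤multiple k e≡) (2≤multiple k e≡)

    open Masses (e * e) Q 4≤m Q+2≡m³ public

  -- The 152 consists of 144 for forming `72 * q`, which takes two calls for each of the 72 units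
  -- besides the `e` cells moved, and of 8 for the calls that the main program makes directly.
  setupCost : (ℓ d L e n₁ n₂ : ℕ) → ℕ
  setupCost ℓ d L e n₁ n₂ =
    sortCost ℓ + suc d * (2 + L) + suc L * (2 + e) + e * (2 + e) + e + n₁ + n₂ + 152

  module Running (R : Reals) where
    open Reals R using (isDecTotalOrder)
    private
      module O = IsDecTotalOrder isDecTotalOrder
    open Semantics R using (Value; nil; real; cons)
    open VectorDomination R
    open Spec R
    open Searching R
    open Solving R

    private variable
      d n : ℕ

    foldr-enc : ∀ {X : Set} (f : X → Value) (us : Vec X n) →
                encodeList (Vec.map f us) ≡ enc f (Vec.toList us)
    foldr-enc f []       = refl
    foldr-enc f (u ∷ us) = cong (cons (f u)) (foldr-enc f us)

    pointItems : Vec (Point d) n → List (Item d)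
    pointItems []       = []
    pointItems (u ∷ us) = (u , encodePoint u) ∷ pointItems us

    length-pointItems : (us : Vec (Point d) n) → length (pointItems us) ≡ n
    length-pointItems []       = refl
    length-pointItems (u ∷ us) = cong suc (length-pointItems us)

    items-spec : (us : Vec (Point d) n) →
      encodeList (Vec.map encodePoint us) ∷ [] ⊢ body items ⇓ encItems (pointItems us) # n
    items-spec []       = #case-nil #var #nil
    items-spec (u ∷ us) = #case-cons #var (#cons (#cons #var #var) (#call (#var #∷ #[]) (items-spec us)))

    ∈-pointItems⁻ : ∀ {x} (us : Vec (Point d) n) → x List∈.∈ pointItems us →
      proj₂ x ≡ encodePoint (proj₁ x) × Membership._∈_ (pointSetoid d) (proj₁ x) us
    ∈-pointItems⁻ (u ∷ us) (ListAny.here refl) = refl , here (Setoid.refl (pointSetoid _))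
    ∈-pointItems⁻ (u ∷ us) (ListAny.there p) = let eq , q = ∈-pointItems⁻ us p in eq , there q

    -- Membership in a point set is up to equality of reals, so only the listed representative `u′`
    -- occurs among the items.
    ∈-pointItems⁺ : ∀ {u} (us : Vec (Point d) n) → Membership._∈_ (pointSetoid d) u us →
      ∃[ u′ ] (u′ , encodePoint u′) List∈.∈ pointItems us × Setoid._≈_ (pointSetoid d) u u′
    ∈-pointItems⁺ (u ∷ us) (here eq) = u , ListAny.here refl , eq
    ∈-pointItems⁺ (u ∷ us) (there p) = let u′ , q , eq = ∈-pointItems⁺ us p in u′ , ListAny.there q , eq

    isAnswer : ∀ {M N z} (A : PointSet d M) (B : PointSet d N) →
      Outcome (Solution (pointItems (PointSet.elements A)) (pointItems (PointSet.elements B))) z →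
      IsAnswer A B z
    isAnswer A B (found (solution {x} {y} p q h))
      with ∈-pointItems⁻ (PointSet.elements A) p | ∈-pointItems⁻ (PointSet.elements B) q
    ... | eq , p′ | eq′ , q′ rewrite eq | eq′ = found p′ q′ h
    isAnswer A B (none ¬s) = none λ p q h →
      let u , p′ , u≈ = ∈-pointItems⁺ (PointSet.elements A) p
          v , q′ , v≈ = ∈-pointItems⁺ (PointSet.elements B) q
      in ¬s (solution p′ q′ λ k →
           O.≤-respˡ-≈ (Pointwise.lookup v≈ k) (O.≤-respʳ-≈ (Pointwise.lookup u≈ k) (h k)))

    record Calls≤ (n₁ n₂ d ℓ : ℕ) (calls : ℕ) : Set where
      field
        parameters : Parameters n₁ d
      open Parameters parameters public
      field
        leaves     : ℕ
        leafMass   : LeafMass J d (n₁ * n₂) leaves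
        calls≤     : calls ≤ setupCost ℓ d L e n₁ n₂
                             + (nodeCost ℓ (e * e) d * nodes J d + (2 + d) * leaves)

    -- The program measures only the first set. The exponent `ℓ` bounds both sizes and enters only
    -- the costs, which lets one statement serve correctness for sets of unequal sizes and the time
    -- bound for equal ones.
    main-spec : ∀ {n₁ n₂} ℓ (us : Vec (Point d) (suc n₁)) (vs : Vec (Point d) n₂) →
      suc n₁ ≤ 2 ^ ℓ → n₂ ≤ 2 ^ ℓ →
      ∃₂ λ z calls → Outcome (Solution (pointItems us) (pointItems vs)) z ×
        Calls≤ (suc n₁) n₂ d ℓ calls ×
        (encodeList (Vec.map encodePoint us) ∷ encodeList (Vec.map encodePoint vs) ∷ []
          ⊢ Program.main program ⇓ z # calls)
    main-spec {d} {n₁} {n₂} ℓ us@(a ∷ us′) vs n₁≤ n₂≤ =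
      let ws , above , below , runL = log-spec encodePoint ℓ (Vec.toList us)
            (subst (_≤ 2 ^ ℓ) (sym (length-toList us)) n₁≤)
          L = nil ∷ ws
          a-list = Vec.toList a
          as , bs , _ , kL≤ , <kL+L , runq = chop-spec real a-list (enc-numeral real a-list)
            (enc-numeral id L) (s≤s z≤n) ℕₚ.≤-refl
          e , nume , rune = times-spec (numeral-numeral 72) (cons {v = nil} (enc-numeral real as))
          len = length-toList a
      in run-main ws (length as) (72 * suc (length as)) (72 * (2 + suc (length as)))
           (subst (_< 2 ^ length L) (length-toList us) above)
           (ℕₚ.*-monoʳ-≤ 2 (subst (2 ^ length ws ≤_) (length-toList us)
             (below (subst (1 ≤_) (sym (length-toList us)) (s≤s z≤n)))))
           (subst (length as * length L ≤_) len kL≤) (subst (_< suc (length as) * length L) len <kL+L)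
           refl (ℕₚ.≤-reflexive (ℕₚ.*-distribˡ-+ 72 2 (suc (length as)))) nume
           (subst (λ w → w ∷ [] ⊢ body log ⇓ enc id ws # sortCost ℓ) (sym (foldr-enc encodePoint us)) runL)
           (enc real bs , subst (λ w → w ∷ w ∷ enc id L ∷ [] ⊢ body chop ⇓ cons (enc real as) (enc real bs)
              # suc d * (2 + length L)) (sym (foldr-enc real a))
              (subst (λ x → enc real a-list ∷ enc real a-list ∷ enc id L ∷ [] ⊢ body chop ⇓
                cons (enc real as) (enc real bs) # suc x * (2 + length L)) len runq))
           rune
      where
      run-main : ∀ ws → let L = nil ∷ ws in ∀ k e c {q E} →
        suc n₁ < 2 ^ length L → 2 ^ length L ≤ 2 * suc n₁ →
        k * length L ≤ d → d < suc k * length L → e ≡ 72 * suc k → c ≤ 144 + e → Numeral e E →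
        (encodeList (Vec.map encodePoint us) ∷ [] ⊢ body log ⇓ enc id ws # sortCost ℓ) →
        (∃[ r ] encodePoint a ∷ encodePoint a ∷ enc id L ∷ [] ⊢ body chop ⇓ cons q r
          # suc d * (2 + length L)) →
        (numeral 72 ∷ cons nil q ∷ [] ⊢ body times ⇓ E # c) →
        ∃₂ λ z calls → Outcome (Solution (pointItems us) (pointItems vs)) z ×
          Calls≤ (suc n₁) n₂ d ℓ calls ×
          (encodeList (Vec.map encodePoint us) ∷ encodeList (Vec.map encodePoint vs) ∷ []
            ⊢ Program.main program ⇓ z # calls)
      run-main ws k e c n<2^L 2^L≤2n kL≤d d<kL+L e≡ c≤ nume runL (_ , runq) rune =
        let L = nil ∷ ws
            js , _ , _ , Je≤L , L<Je+e , runJ = chop-spec id L (enc-numeral id L) nume 1≤e ℕₚ.≤-refl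
            m , numm , runm = times-spec nume nume
            p : Parameters (suc n₁) d
            p = record { L = length L ; k = k ; e = e ; Q = e * e * (e * e * (e * e)) ℕ.∸ 2
                       ; J = length js ; n<2^L = n<2^L ; 2^L≤2n = 2^L≤2n ; kL≤d = kL≤d
                       ; d<kL+L = d<kL+L ; e≡ = e≡ ; Je≤L = Je≤L ; L<Je+e = L<Je+e
                       ; Q+2≡m³ = ℕₚ.m∸n+n≡m 2≤m³ }
            z , x , outcome , mass , run = solve-spec (e * e) (Parameters.Q p) ℓ d
              (Parameters.4≤m p) (Parameters.Q+2≡m³ p) numm (enc-numeral id js)
              (pointItems us) (pointItems vs) ℕₚ.≤-refl
              (subst (_≤ 2 ^ ℓ) (sym (length-pointItems us)) n₁≤)
              (subst (_≤ 2 ^ ℓ) (sym (length-pointItems vs)) n₂≤)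
        in z , _ , outcome ,
           record { parameters = p ; leaves = x
                  ; leafMass = subst (λ M → Parameters.LeafMass p (length js) d M x)
                      (cong₂ _*_ (length-pointItems us) (length-pointItems vs)) mass
                  ; calls≤ = cost (suc n₁) n₂ (suc d * (2 + length L)) (suc (length L) * (2 + e)) (e * (2 + e))
                               (nodeCost ℓ (e * e) d * nodes (length js) d + (2 + d) * x) } ,
           #case-cons #var
             (#let (#cons #nil (#call (#var #∷ #[]) runL))
             (#let (#cons #nil (#first (#call (#var #∷ #var #∷ #var #∷ #[]) runq)))
             (#let (#call (#unary 72 #∷ #var #∷ #[]) rune)
             (#let (#first (#call (#var #∷ #var #∷ #var #∷ #[]) runJ))
               (#call (#call (#var #∷ #[]) (items-spec us) #∷ #call (#var #∷ #[]) (items-spec vs)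
                 #∷ #var #∷ #call (#var #∷ #var #∷ #[]) runm #∷ #[]) run)))))
        where
        1≤e : 1 ≤ e
        1≤e = ℕₚ.≤-trans (s≤s z≤n) (2≤multiple k e≡)
        2≤m³ : 2 ≤ e * e * (e * e * (e * e))
        2≤m³ = ℕₚ.*-mono-≤ (ℕₚ.*-mono-≤ (2≤multiple k e≡) 1≤e)
          (ℕₚ.*-mono-≤ (ℕₚ.*-mono-≤ 1≤e 1≤e) (ℕₚ.*-mono-≤ 1≤e 1≤e))
        cost : ∀ n₁ n₂ t₁ t₂ t₃ T →
          suc (sortCost ℓ) + (suc t₁ + 0 + (suc c + (suc t₂ + 0 +
            (suc n₁ + (suc n₂ + (suc t₃ + 0)) + suc T))))
          ≤ sortCost ℓ + t₁ + t₂ + t₃ + e + n₁ + n₂ + 152 + T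
        cost n₁ n₂ t₁ t₂ t₃ T = ℕₚ.≤-trans
          (ℕₚ.+-monoʳ-≤ (suc (sortCost ℓ)) (ℕₚ.+-monoʳ-≤ (suc t₁ + 0) (ℕₚ.+-monoˡ-≤ _ (s≤s c≤))))
          (ℕₚ.≤-reflexive (total (sortCost ℓ) t₁ e t₂ n₁ n₂ t₃ T))
          where
          total : ∀ s t₁ e t₂ n₁ n₂ t₃ T → suc s + (suc t₁ + 0 + (suc (144 + e) + (suc t₂ + 0 +
            (suc n₁ + (suc n₂ + (suc t₃ + 0)) + suc T)))) ≡ s + t₁ + t₂ + t₃ + e + n₁ + n₂ + 152 + T
          total = solve-∀

-- Numerical estimates for the number of calls

module Estimate where

  open Recurrence
  open Powers
  open Lists using (sortCost; sortCost-≡)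
  open Search using (nodeCost)
  open Main using (Parameters; setupCost; 2≤multiple)
  open import Data.Nat.Base using (ℕ; zero; suc; _+_; _*_; _^_; _≤_; _<_; z≤n; s≤s; NonZero; >-nonZero)
  open import Data.Nat.Properties
  open import Data.Nat.Tactic.RingSolver using (solve-∀)
  open import Data.Product.Base using (∃-syntax; ∃₂; _×_; _,_; proj₁; proj₂)
  open import Relation.Binary.PropositionalEquality using (_≡_; refl; sym; trans; cong; subst)

  -- A gain of `2 ^ j` over all splits and a loss of `2 ^ suc i` over all coordinates turn the
  -- powers in the leaf mass into powers of 2.
  cancel-powers : ∀ {F Q R J d x M} j i → 1 ≤ F → 1 ≤ Q →
    2 ^ j * F ^ J ≤ suc F ^ J → R ^ d ≤ 2 ^ suc i * Q ^ d →
    x * (suc F ^ J * Q ^ d) ≤ M * (F ^ J * R ^ d) → x * 2 ^ j ≤ M * 2 ^ suc i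
  cancel-powers {F} {Q} {R} {J} {d} {x} {M} j i 1≤F 1≤Q gain loss mass =
    *-cancelʳ-≤ _ _ (F ^ J * Q ^ d)
      {{>-nonZero (*-mono-≤ (m^n>0 F {{>-nonZero 1≤F}} J) (m^n>0 Q {{>-nonZero 1≤Q}} d))}} (begin
        x * 2 ^ j * (F ^ J * Q ^ d)     ≡⟨ move x (2 ^ j) (F ^ J) (Q ^ d) ⟩
        x * (2 ^ j * F ^ J * Q ^ d)     ≤⟨ *-monoʳ-≤ x (*-monoˡ-≤ (Q ^ d) gain) ⟩
        x * (suc F ^ J * Q ^ d)         ≤⟨ mass ⟩
        M * (F ^ J * R ^ d)             ≤⟨ *-monoʳ-≤ M (*-monoʳ-≤ (F ^ J) loss) ⟩
        M * (F ^ J * (2 ^ suc i * Q ^ d)) ≡⟨ move′ M (2 ^ suc i) (F ^ J) (Q ^ d) ⟩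
        M * 2 ^ suc i * (F ^ J * Q ^ d) ∎)
    where
    open ≤-Reasoning
    move : ∀ x a b c → x * a * (b * c) ≡ x * (a * b * c)
    move = solve-∀
    move′ : ∀ y a b c → y * (b * (a * c)) ≡ y * a * (b * c)
    move′ = solve-∀

  -- In units of `L / h`, `u + u + i` is at most `2/8 + 1/9 = 26/72`, which is below `1/2`, while
  -- `suc j` exceeds `1/2`.
  exponents≤ : ∀ {L h} u i j → u * (8 * h) ≤ L → 9 * (i * h) ≤ L → L < suc j * (2 * h) → u + u + i ≤ j
  exponents≤ {L} {h} u i j 8hu≤L 9ih≤L L<2hj+2h = ≤-pred (*-cancelʳ-< (72 * h) (u + u + i) (suc j) (begin-strict
    (u + u + i) * (72 * h)                     ≡⟨ split u i h ⟩
    18 * (u * (8 * h)) + 8 * (9 * (i * h))     ≤⟨ +-mono-≤ (*-monoʳ-≤ 18 8hu≤L) (*-monoʳ-≤ 8 9ih≤L) ⟩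
    18 * L + 8 * L                             ≤⟨ ≤-by (10 * L) (sum L) ⟩
    36 * L                                     <⟨ *-monoʳ-< 36 L<2hj+2h ⟩
    36 * (suc j * (2 * h))                     ≡⟨ regroup (suc j) h ⟩
    suc j * (72 * h)                           ∎))
    where
    open ≤-Reasoning
    split : ∀ u i h → (u + u + i) * (72 * h) ≡ 18 * (u * (8 * h)) + 8 * (9 * (i * h))
    split = solve-∀
    sum : ∀ L → 18 * L + 8 * L + 10 * L ≡ 36 * L
    sum = solve-∀
    regroup : ∀ j h → 36 * (j * (2 * h)) ≡ j * (72 * h)
    regroup = solve-∀

  cancel-loss : ∀ {x M} u i j → u + u + i ≤ j → x * 2 ^ j ≤ M * 2 ^ suc i → x * 2 ^ (u + u) ≤ 2 * M
  cancel-loss {x} {M} u i j exponents bound = *-cancelʳ-≤ _ _ (2 ^ i) {{m^n≢0 2 i}} (begin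
    x * 2 ^ (u + u) * 2 ^ i     ≡⟨ *-assoc x _ _ ⟩
    x * (2 ^ (u + u) * 2 ^ i)   ≡⟨ cong (x *_) (sym (^-distribˡ-+-* 2 (u + u) i)) ⟩
    x * 2 ^ (u + u + i)         ≤⟨ *-monoʳ-≤ x (^-monoʳ-≤ 2 exponents) ⟩
    x * 2 ^ j                   ≤⟨ bound ⟩
    M * (2 * 2 ^ i)             ≡⟨ swap M (2 ^ i) ⟩
    2 * M * 2 ^ i               ∎)
    where
    open ≤-Reasoning
    swap : ∀ a b → a * (2 * b) ≡ 2 * a * b
    swap = solve-∀

  -- Trades a factor linear in `L` for about `2 ^ (L / b)`: `L < suc i * b` and `suc i ≤ 2 ^ i`.
  absorb : ∀ L b → 1 ≤ b → ∃₂ λ i r → L ≡ r + i * b × i * b ≤ L × suc L ≤ b * 2 ^ i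
  absorb L b 1≤b with divide L b 1≤b
  ... | i , r , refl , r<b = i , r , refl , m≤n+m (i * b) r , ≤-trans (+-monoˡ-≤ (i * b) r<b)
    (≤-trans (*-monoˡ-≤ b (n<2^n i)) (≤-reflexive (*-comm (2 ^ i) b)))

  setupCost-bound : ∀ {L d e n} → n ≤ 2 ^ L →
    setupCost L d L e n n ≤ (168 + 4 * e + e * e) * (2 ^ L * (suc L * suc d))
  setupCost-bound {L} {d} {e} {n} n≤ with 2 ^ L | sortCost L | sortCost-≡ L | m^n>0 2 L
  -- With `2 ^ L` written as `suc x`, the two sides differ by a polynomial with natural
  -- coefficients, spelled out in `slack`.
  ... | suc x | .(10 * (L * suc x)) | refl | _ = ≤-trans
    (+-monoˡ-≤ 152 (+-mono-≤ (+-monoʳ-≤ _ n≤) n≤)) (≤-by _ (slack L d e x))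
    where
    slack : ∀ L d e x →
      10 * (L * suc x) + suc d * (2 + L) + suc L * (2 + e) + e * (2 + e) + e + suc x + suc x + 152
      + (10 + 155 * L + 167 * L * d + 4 * L * d * e + L * d * e * e + L * d * e * e * x
        + 4 * L * d * e * x + 168 * L * d * x + 3 * L * e + L * e * e + L * e * e * x + 4 * L * e * x
        + 158 * L * x + 166 * d + 4 * d * e + d * e * e + d * e * e * x + 4 * d * e * x + 168 * d * x
        + e * e * x + 4 * e * x + 166 * x)
      ≡ (168 + 4 * e + e * e) * (suc x * (suc L * suc d))
    slack = solve-∀

  nodeCost-bound : ∀ L m d → nodeCost L m d ≤ (27 + 6 * m) * (2 ^ L * (suc L * suc d))
  nodeCost-bound L m d with 2 ^ L | sortCost L | sortCost-≡ L | m^n>0 2 L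
  ... | suc x | .(10 * (L * suc x)) | refl | _ = ≤-by _ (slack L m d x)
    where
    slack : ∀ L m d x →
      10 * (L * suc x) + suc (suc x) * (2 + m) + m * (2 + suc x * (2 + d)) + 4 * suc x + 9
      + (10 + 17 * L + 27 * L * d + 6 * L * d * m + 6 * L * d * m * x + 27 * L * d * x + 6 * L * m
        + 6 * L * m * x + 17 * L * x + 27 * d + 5 * d * m + 5 * d * m * x + 27 * d * x + 3 * m * x
        + 21 * x)
      ≡ (27 + 6 * m) * (suc x * (suc L * suc d))
    slack = solve-∀

  -- The work per node is `X` up to the factors `suc L` and `suc d`. These, the number of nodes and
  -- the saving `2 ^ u` together fit into a second factor `X`, and `X` is at most `2 * n`.
  combine-nodes : ∀ {L d q n X c v y u V S W} → X ≡ 2 ^ L → X ≤ 2 * n →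
    suc L ≤ 8 * 2 ^ v → suc d ≤ q * (8 * 2 ^ v) → V ≤ 3 * 2 ^ y → 1 ≤ V → v + v + y + u ≤ L →
    S + W ≤ c * (X * (suc L * suc d)) → (S + W * V) * 2 ^ u ≤ 768 * (c * q) * (n * n)
  combine-nodes {L} {d} {q} {n} {X} {c} {v} {y} {u} {V} {S} {W} refl X≤2n L≤ d≤ V≤ 1≤V exponents S+W≤ = begin
    (S + W * V) * 2 ^ u
      ≤⟨ *-monoˡ-≤ (2 ^ u) (+-monoˡ-≤ (W * V) (m≤m*n S V {{>-nonZero 1≤V}})) ⟩
    (S * V + W * V) * 2 ^ u
      ≡⟨ cong (_* 2 ^ u) (sym (*-distribʳ-+ V S W)) ⟩
    (S + W) * V * 2 ^ u
      ≤⟨ *-monoˡ-≤ (2 ^ u) (*-mono-≤ (≤-trans S+W≤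
           (*-monoʳ-≤ c (*-monoʳ-≤ X (*-mono-≤ L≤ d≤)))) V≤) ⟩
    c * (X * (8 * 2 ^ v * (q * (8 * 2 ^ v)))) * (3 * 2 ^ y) * 2 ^ u
      ≡⟨ regroup c X q (2 ^ v) (2 ^ y) (2 ^ u) ⟩
    192 * (c * q) * (X * (2 ^ v * 2 ^ v * 2 ^ y * 2 ^ u))
      ≡⟨ cong (λ z → 192 * (c * q) * (X * z)) powers ⟩
    192 * (c * q) * (X * 2 ^ (v + v + y + u))
      ≤⟨ *-monoʳ-≤ (192 * (c * q)) (*-mono-≤ X≤2n (≤-trans (^-monoʳ-≤ 2 exponents) X≤2n)) ⟩
    192 * (c * q) * (2 * n * (2 * n))
      ≡⟨ square (c * q) n ⟩
    768 * (c * q) * (n * n) ∎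
    where
    open ≤-Reasoning
    regroup : ∀ c X q P Y U → c * (X * (8 * P * (q * (8 * P)))) * (3 * Y) * U
                            ≡ 192 * (c * q) * (X * (P * P * Y * U))
    regroup = solve-∀
    square : ∀ a n → 192 * a * (2 * n * (2 * n)) ≡ 768 * a * (n * n)
    square = solve-∀
    powers : 2 ^ v * 2 ^ v * 2 ^ y * 2 ^ u ≡ 2 ^ (v + v + y + u)
    powers = sym (trans (^-distribˡ-+-* 2 (v + v + y) u) (cong (_* 2 ^ u)
      (trans (^-distribˡ-+-* 2 (v + v) y) (cong (_* 2 ^ y) (^-distribˡ-+-* 2 v v)))))

  -- Of the two factors `2 ^ u` saved at the leaves, one pays for the `2 + d` calls per pair and the
  -- other is the final saving.
  combine-leaves : ∀ {d q h u x M} → suc d ≤ q * (8 * h * 2 ^ u) → x * 2 ^ (u + u) ≤ 2 * M →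
    (2 + d) * x * 2 ^ u ≤ 32 * (q * h) * M
  combine-leaves {d} {q} {h} {u} {x} {M} d≤ bound = begin
    (2 + d) * x * 2 ^ u
      ≤⟨ *-monoˡ-≤ (2 ^ u) (*-monoˡ-≤ x (≤-by d (twice d))) ⟩
    2 * suc d * x * 2 ^ u
      ≤⟨ *-monoˡ-≤ (2 ^ u) (*-monoˡ-≤ x (*-monoʳ-≤ 2 d≤)) ⟩
    2 * (q * (8 * h * 2 ^ u)) * x * 2 ^ u
      ≡⟨ regroup q h x (2 ^ u) ⟩
    16 * (q * h) * (x * (2 ^ u * 2 ^ u))
      ≡⟨ cong (λ z → 16 * (q * h) * (x * z)) (sym (^-distribˡ-+-* 2 u u)) ⟩
    16 * (q * h) * (x * 2 ^ (u + u))
      ≤⟨ *-monoʳ-≤ (16 * (q * h)) bound ⟩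
    16 * (q * h) * (2 * M)
      ≡⟨ double (q * h) M ⟩
    32 * (q * h) * M ∎
    where
    open ≤-Reasoning
    twice : ∀ d → 2 + d + d ≡ 2 * suc d
    twice = solve-∀
    regroup : ∀ q h x U → 2 * (q * (8 * h * U)) * x * U ≡ 16 * (q * h) * (x * (U * U))
    regroup = solve-∀
    double : ∀ a M → 16 * a * (2 * M) ≡ 32 * a * M
    double = solve-∀

  -- Splits and coordinates each contribute an exponent of at most `L / 4`: the splits through
  -- `72 * q * J ≤ L`, the coordinates because `4 * q` of them cost one factor 2.
  nodes-estimate : ∀ {q J d L} → 1 ≤ q → J * (72 * q) ≤ L → d < q * L →
    ∃[ y ] nodes J d ≤ 3 * 2 ^ y × y + y ≤ L
  nodes-estimate {q} {J} {d} {L} 1≤q Je≤L d<qL = y , *-cancelˡ-≤ 2 (≤-trans (n≤1+n _) few) , y+y≤L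
    where
    open ≤-Reasoning
    -- The free parameter of `nodes-bound`, twice `4 * q`, so that Bernoulli's inequality applies to
    -- blocks of `4 * q` coordinates.
    M = 8 * q
    1≤4q : 1 ≤ 4 * q
    1≤4q = ≤-trans 1≤q (m≤m+n q _)
    division = divide d (4 * q) 1≤4q
    i = proj₁ division
    r = proj₁ (proj₂ division)
    d≡ : d ≡ r + i * (4 * q)
    d≡ = proj₁ (proj₂ (proj₂ division))
    r< : r < 4 * q
    r< = proj₂ (proj₂ (proj₂ division))
    y = 18 * q * J + i

    M^r-bound : ∀ r → r ≤ 4 * q → (M + 1) ^ r ≤ 2 * M ^ r
    M^r-bound r r≤ = ^≤2*^ 1 r (≤-trans 1≤q (m≤m+n q _)) (≤-trans (*-monoʳ-≤ 2
      (≤-trans (≤-reflexive (*-identityʳ r)) r≤)) (≤-reflexive (eight q)))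
      where
      eight : ∀ q → 2 * (4 * q) ≡ 8 * q
      eight = solve-∀

    M^d-bound : suc M ^ d ≤ 2 ^ suc i * M ^ d
    M^d-bound = subst (λ a → a ^ d ≤ 2 ^ suc i * M ^ d) (+-comm M 1)
      (subst (λ d → (M + 1) ^ d ≤ 2 ^ suc i * M ^ d) (sym d≡) (chunks-upper M^r-bound i (<⇒≤ r<)))

    split-bound : (2 * M + 2) ^ J ≤ 2 ^ (18 * q * J)
    split-bound = ≤-trans (^-monoˡ-≤ J (≤-trans 2M+2≤18q (<⇒≤ (n<2^n (18 * q)))))
      (≤-reflexive (^-*-assoc 2 (18 * q) J))
      where
      sum : ∀ q → 2 * (8 * q) + 2 * q ≡ 18 * q
      sum = solve-∀
      2M+2≤18q : 2 * M + 2 ≤ 18 * q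
      2M+2≤18q = ≤-trans (+-monoʳ-≤ (2 * M) (*-monoʳ-≤ 2 1≤q)) (≤-reflexive (sum q))

    few : suc (2 * nodes J d) ≤ 2 * (3 * 2 ^ y)
    few = *-cancelʳ-≤ _ _ (M ^ d) {{>-nonZero (m^n>0 M {{>-nonZero (≤-trans 1≤q (m≤m+n q _))}} d)}} (begin
      suc (2 * nodes J d) * M ^ d                      ≤⟨ nodes-bound M J d ⟩
      3 * ((2 * M + 2) ^ J * suc M ^ d)                ≤⟨ *-monoʳ-≤ 3 (*-mono-≤ split-bound M^d-bound) ⟩
      3 * (2 ^ (18 * q * J) * (2 * 2 ^ i * M ^ d))     ≡⟨ regroup (2 ^ (18 * q * J)) (2 ^ i) (M ^ d) ⟩
      2 * (3 * (2 ^ (18 * q * J) * 2 ^ i)) * M ^ d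
        ≡⟨ cong (λ z → 2 * (3 * z) * M ^ d) (sym (^-distribˡ-+-* 2 (18 * q * J) i)) ⟩
      2 * (3 * 2 ^ y) * M ^ d                          ∎)
      where
      regroup : ∀ a b c → 3 * (a * (2 * b * c)) ≡ 2 * (3 * (a * b)) * c
      regroup = solve-∀

    4i≤L : 4 * i ≤ L
    4i≤L = *-cancelˡ-≤ q {{>-nonZero 1≤q}} (begin
      q * (4 * i)         ≡⟨ regroup q i ⟩
      i * (4 * q)         ≤⟨ m≤n+m _ r ⟩
      r + i * (4 * q)     ≡⟨ sym d≡ ⟩
      d                   ≤⟨ <⇒≤ d<qL ⟩
      q * L               ∎)
      where
      regroup : ∀ q i → q * (4 * i) ≡ i * (4 * q)
      regroup = solve-∀

    y+y≤L : y + y ≤ L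
    y+y≤L = *-cancelˡ-≤ 2 (begin
      2 * (y + y)                   ≡⟨ regroup q J i ⟩
      J * (72 * q) + 4 * i          ≤⟨ +-mono-≤ Je≤L 4i≤L ⟩
      L + L                         ≡⟨ twice L ⟩
      2 * L                         ∎)
      where
      regroup : ∀ q J i → 2 * (18 * q * J + i + (18 * q * J + i)) ≡ J * (72 * q) + 4 * i
      regroup = solve-∀
      twice : ∀ L → L + L ≡ 2 * L
      twice = solve-∀

  nodes-positive : ∀ j d → 1 ≤ nodes j d
  nodes-positive zero    d       = s≤s z≤n
  nodes-positive (suc j) zero    = s≤s z≤n
  nodes-positive (suc j) (suc d) = s≤s z≤n

  -- `2/8 + 1/2 + 1/8 = 7/8`: two linear factors, the nodes and the saving.
  total-exponent : ∀ {L} v y u → v * 8 ≤ L → y + y ≤ L → u * 8 ≤ L → v + v + y + u ≤ L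
  total-exponent {L} v y u 8v≤L 2y≤L 8u≤L = *-cancelˡ-≤ 8 (begin
    8 * (v + v + y + u)                         ≡⟨ regroup v y u ⟩
    2 * (v * 8) + 4 * (y + y) + u * 8
      ≤⟨ +-mono-≤ (+-mono-≤ (*-monoʳ-≤ 2 8v≤L) (*-monoʳ-≤ 4 2y≤L)) 8u≤L ⟩
    2 * L + 4 * L + L                           ≤⟨ ≤-by L (sum L) ⟩
    8 * L                                       ∎)
    where
    open ≤-Reasoning
    regroup : ∀ v y u → 8 * (v + v + y + u) ≡ 2 * (v * 8) + 4 * (y + y) + u * 8
    regroup = solve-∀
    sum : ∀ L → 2 * L + 4 * L + L + L ≡ 8 * L
    sum = solve-∀

  overhead : ℕ → ℕ
  overhead e = 168 + 4 * e + e * e + (27 + 6 * (e * e))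

  overhead-mono : ∀ {e e′} → e ≤ e′ → overhead e ≤ overhead e′
  overhead-mono {e} {e′} e≤ = +-mono-≤ {168 + 4 * e + e * e} {168 + 4 * e′ + e′ * e′}
    (+-mono-≤ {168 + 4 * e} {168 + 4 * e′} (+-monoʳ-≤ 168 {4 * e} {4 * e′} (*-monoʳ-≤ 4 e≤)) ee≤)
    (+-monoʳ-≤ 27 {6 * (e * e)} {6 * (e′ * e′)} (*-monoʳ-≤ 6 ee≤))
    where
    ee≤ : e * e ≤ e′ * e′
    ee≤ = *-mono-≤ e≤ e≤

  opaque
    coefficient : (q e : ℕ) → ℕ
    coefficient q e = 768 * (overhead e * q) + 32 * (q * (e * (e * e * (e * e))))

    -- `q` and `e` vary with the input; monotonicity allows them to be replaced by bounds that
    -- depend on `c` alone.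
    coefficient-mono : ∀ {q q′ e e′} → q ≤ q′ → e ≤ e′ → coefficient q e ≤ coefficient q′ e′
    coefficient-mono {q} {q′} {e} {e′} q≤ e≤ = +-mono-≤
      {768 * (overhead e * q)} {768 * (overhead e′ * q′)}
      (*-monoʳ-≤ 768 {overhead e * q} {overhead e′ * q′}
        (*-mono-≤ {overhead e} {overhead e′} {q} {q′} (overhead-mono e≤) q≤))
      (*-monoʳ-≤ 32 {q * (e * (e * e * (e * e)))} {q′ * (e′ * (e′ * e′ * (e′ * e′)))}
        (*-mono-≤ q≤ (*-mono-≤ e≤ (*-mono-≤ ee≤ ee≤))))
      where
      ee≤ : e * e ≤ e′ * e′
      ee≤ = *-mono-≤ e≤ e≤

    combine-coefficient : ∀ q e {A B M T} → T ≤ A + B →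
      A ≤ 768 * (overhead e * q) * M →
      B ≤ 32 * (q * (e * (e * e * (e * e)))) * M → T ≤ coefficient q e * M
    combine-coefficient q e {M = M} T≤ A≤ B≤ = ≤-trans T≤
      (≤-trans (+-mono-≤ A≤ B≤)
        (≤-reflexive (sym (*-distribʳ-+ M (768 * (overhead e * q)) (32 * (q * (e * (e * e * (e * e)))))))))

  module Estimates {n d : ℕ} (p : Parameters n d) where
    open Parameters p
    open ≤-Reasoning

    q m h : ℕ
    q = suc k
    m = e * e
    h = e * (m * m)

    1≤e : 1 ≤ e
    1≤e = ≤-trans (s≤s z≤n) (2≤multiple k e≡)

    1≤m : 1 ≤ m
    1≤m = *-mono-≤ 1≤e 1≤e

    1≤h : 1 ≤ h
    1≤h = *-mono-≤ 1≤e (*-mono-≤ 1≤m 1≤m)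

    instance
      h≢0 : NonZero h
      h≢0 = >-nonZero 1≤h

    -- J splits gain at least a factor 2^(L/2h − 1), and the d coordinates cost at
    -- most 2^(L/9h + 1), one factor 2 for each chunk of them.  What remains leaves
    -- room for 2^(2u), where u = ⌊L/8h⌋.
    chunk : ℕ
    chunk = q * (9 * h)

    -- `m³ = e * h` and `e = 72 * q` with `72 = 8 * 9`. The 9 makes the loss exponent `L / 9h`; the
    -- 8 leaves twice the room that Bernoulli's inequality asks for, which absorbs the 2 in `Q + 2`.
    m³≡8chunk : Q + 2 ≡ 8 * chunk
    m³≡8chunk = trans Q+2≡m³ (trans (regroup e) (trans (cong (_* h) e≡) (regroup′ q h)))
      where
      regroup : ∀ e → e * e * (e * e * (e * e)) ≡ e * (e * (e * e * (e * e)))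
      regroup = solve-∀
      regroup′ : ∀ q h → 72 * q * h ≡ 8 * (q * (9 * h))
      regroup′ = solve-∀

    1≤chunk : 1 ≤ chunk
    1≤chunk = *-mono-≤ {1} {q} (s≤s z≤n) (*-mono-≤ {1} {9} (s≤s z≤n) 1≤h)

    4chunk≤Q : 4 * chunk ≤ Q
    4chunk≤Q = +-cancelʳ-≤ 2 _ _ (begin
      4 * chunk + 2         ≤⟨ +-monoʳ-≤ (4 * chunk) (≤-trans (s≤s (s≤s z≤n)) (*-monoʳ-≤ 4 1≤chunk)) ⟩
      4 * chunk + 4 * chunk ≡⟨ twice chunk ⟩
      8 * chunk             ≡⟨ sym m³≡8chunk ⟩
      Q + 2                 ∎)
      where
      twice : ∀ c → 4 * c + 4 * c ≡ 8 * c
      twice = solve-∀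

    1≤Q : 1 ≤ Q
    1≤Q = ≤-trans 1≤chunk (≤-trans (m≤m+n chunk _) 4chunk≤Q)

    Q+2-bound : ∀ r → r ≤ chunk → (Q + 2) ^ r ≤ 2 * Q ^ r
    Q+2-bound r r≤ = ^≤2*^ 2 r 1≤Q (≤-trans (≤-reflexive (four r)) (≤-trans (*-monoʳ-≤ 4 r≤) 4chunk≤Q))
      where
      four : ∀ r → 2 * (r * 2) ≡ 4 * r
      four = solve-∀

    1≤F : 1 ≤ F
    1≤F = ≤-trans (*-mono-≤ 1≤m 1≤m) (m≤m+n (m * m) _)

    u : ℕ
    u = proj₁ (divide L (8 * h) (≤-trans 1≤h (m≤m+n h _)))

    8hu≤L : u * (8 * h) ≤ L
    8hu≤L with divide L (8 * h) (≤-trans 1≤h (m≤m+n h _))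
    ... | i , r , eq , _ = ≤-trans (m≤n+m _ r) (≤-reflexive (sym eq))

    L<8hu+8h : L < suc u * (8 * h)
    L<8hu+8h with divide L (8 * h) (≤-trans 1≤h (m≤m+n h _))
    ... | i , r , eq , r< = ≤-trans (≤-reflexive (cong suc eq)) (+-monoˡ-≤ (i * (8 * h)) r<)

    leaves-bound : ∀ {x} → LeafMass J d (n * n) x → x * 2 ^ (u + u) ≤ 2 * (n * n)
    leaves-bound {x} mass =
      let j , r , J≡ , r< = divide J F 1≤F
          i , r′ , d≡ , r′< = divide d chunk 1≤chunk
      in cancel-loss {x} {n * n} u i j
           (exponents≤ {L} {h} u i j 8hu≤L (9ih≤L {i} {r′} d≡) (L<2hj+2h {j} {r} J≡ r<))
           (cancel-powers {F} {Q} {Q + 2} {J} {d} {x} {n * n} j i 1≤F 1≤Q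
             (gain {j} {r} J≡) (loss {i} {r′} d≡ (<⇒≤ r′<)) mass)
      where
      gain : ∀ {j r} → J ≡ r + j * F → 2 ^ j * F ^ J ≤ suc F ^ J
      gain {j} {r} J≡ = subst (λ J → 2 ^ j * F ^ J ≤ suc F ^ J) (sym J≡)
        (chunks-lower (2*^≤^ F 1≤F) (n≤1+n F) j r)
      loss : ∀ {i r} → d ≡ r + i * chunk → r ≤ chunk → (Q + 2) ^ d ≤ 2 ^ suc i * Q ^ d
      loss {i} d≡ r≤ = subst (λ d → (Q + 2) ^ d ≤ 2 ^ suc i * Q ^ d) (sym d≡) (chunks-upper Q+2-bound i r≤)
      9ih≤L : ∀ {i r} → d ≡ r + i * chunk → 9 * (i * h) ≤ L
      9ih≤L {i} {r} d≡ = *-cancelˡ-≤ q (begin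
        q * (9 * (i * h))  ≡⟨ regroup q i h ⟩
        i * (q * (9 * h))  ≤⟨ m≤n+m _ r ⟩
        r + i * chunk      ≡⟨ sym d≡ ⟩
        d                  ≤⟨ <⇒≤ d<kL+L ⟩
        q * L              ∎)
        where
        regroup : ∀ q i h → q * (9 * (i * h)) ≡ i * (q * (9 * h))
        regroup = solve-∀
      L<2hj+2h : ∀ {j r} → J ≡ r + j * F → r < F → L < suc j * (2 * h)
      L<2hj+2h {j} J≡ r< = begin-strict
        L                    <⟨ L<Je+e ⟩
        suc J * e            ≤⟨ *-monoˡ-≤ e (≤-trans (≤-reflexive (cong suc J≡)) (+-monoˡ-≤ (j * F) r<)) ⟩
        suc j * F * e        ≡⟨ regroup (suc j) m e ⟩
        suc j * (2 * h)      ∎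
        where
        regroup : ∀ j m e → j * (2 * (m * m)) * e ≡ j * (2 * (e * (m * m)))
        regroup = solve-∀

    L<8h2^u : suc L ≤ 8 * h * 2 ^ u
    L<8h2^u = ≤-trans L<8hu+8h (≤-trans (*-monoˡ-≤ (8 * h) (n<2^n u)) (≤-reflexive (*-comm (2 ^ u) (8 * h))))

    u*8≤L : u * 8 ≤ L
    u*8≤L = ≤-trans (*-monoʳ-≤ u (m≤m*n 8 h)) 8hu≤L

    2^u≤2n : 2 ^ u ≤ 2 * n
    2^u≤2n = ≤-trans (^-monoʳ-≤ 2 (≤-trans (m≤m*n u 8) u*8≤L)) 2^L≤2n

    private
      S W V : ℕ
      S = setupCost L d L e n n
      W = nodeCost L (e * e) d
      V = nodes J d

    S+W-bound : S + W ≤ overhead e * (2 ^ L * (suc L * suc d))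
    S+W-bound = ≤-trans (+-mono-≤ (setupCost-bound {L} {d} {e} {n} (<⇒≤ n<2^L)) (nodeCost-bound L m d))
      (≤-reflexive (sym (*-distribʳ-+ (2 ^ L * (suc L * suc d)) (168 + 4 * e + e * e) (27 + 6 * m))))

    d<q* : ∀ {b} → suc L ≤ b → suc d ≤ q * b
    d<q* L< = ≤-trans d<kL+L (*-monoʳ-≤ q (≤-trans (n≤1+n L) L<))

    calls-bound : ∀ {calls x} → LeafMass J d (n * n) x → calls ≤ S + (W * V + (2 + d) * x) →
      calls * 2 ^ u ≤ coefficient q e * (n * n)
    calls-bound {calls} {x} mass calls≤ =
      let v , _ , _ , 8v≤L , L≤ = absorb L 8 (s≤s z≤n)
          y , few , y+y≤L = nodes-estimate {q} {J} {d} {L} (s≤s z≤n)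
            (subst (λ e → J * e ≤ L) e≡ Je≤L) d<kL+L
      in combine-coefficient q e
           (≤-trans (*-monoˡ-≤ (2 ^ u) calls≤) (≤-reflexive (distribute S (W * V) ((2 + d) * x) (2 ^ u))))
           (combine-nodes {L} {d} {q} {n} {2 ^ L} {overhead e}
             {v} {y} {u} {V} {S} {W} refl 2^L≤2n L≤
             (d<q* L≤) few (nodes-positive J d) (total-exponent {L} v y u 8v≤L y+y≤L u*8≤L) S+W-bound)
           (combine-leaves {d} {q} {h} {u} {x} {n * n} (d<q* L<8h2^u) (leaves-bound {x} mass))
      where
      distribute : ∀ S V x U → (S + (V + x)) * U ≡ (S + V) * U + x * U
      distribute = solve-∀

    -- Once `u` is positive, rounding it down loses at most a factor 2, hence `16 * h` in place of
    -- `8 * h`. This is why `N` has to be large.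
    n≤2^16hu : 8 * h ≤ L → n ≤ 2 ^ (u * (16 * h))
    n≤2^16hu 8h≤L = ≤-trans (<⇒≤ n<2^L) (^-monoʳ-≤ 2 (begin
      L                         ≤⟨ <⇒≤ L<8hu+8h ⟩
      8 * h + u * (8 * h)       ≤⟨ +-monoˡ-≤ (u * (8 * h))
                                     (≤-trans (≤-reflexive (sym (*-identityˡ (8 * h)))) (*-monoˡ-≤ (8 * h) 1≤u)) ⟩
      u * (8 * h) + u * (8 * h) ≡⟨ twice u h ⟩
      u * (16 * h)              ∎))
      where
      twice : ∀ u h → u * (8 * h) + u * (8 * h) ≡ u * (16 * h)
      twice = solve-∀
      1≤u : 1 ≤ u
      1≤u = ≤-pred (*-cancelʳ-< (8 * h) 1 (suc u)
        (≤-trans (s≤s (≤-trans (≤-reflexive (*-identityˡ (8 * h))) 8h≤L)) L<8hu+8h))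

-- Real powers, logarithms and the saved exponent

module RealBounds where

  open import Defs
  open Powers using (^-distribʳ-*)
  open import Algebra.Bundles using (CommutativeRing)
  open import Data.Empty using (⊥-elim)
  open import Data.Nat.Base as ℕ using (ℕ; zero; suc; NonZero)
  import Data.Nat.Properties as ℕₚ
  open import Data.Nat.Tactic.RingSolver using (solve-∀)
  open import Data.Product.Base using (_,_; proj₁)
  open import Data.Sum.Base using (inj₁; inj₂)
  open import Function.Definitions using (Congruent)
  open import Relation.Binary.Bundles using (Poset)
  import Relation.Binary.Reasoning.PartialOrder as PosetReasoning
  open import Relation.Binary.PropositionalEquality as ≡ using (_≡_)
  open import Relation.Binary.Structures using (IsDecTotalOrder)
  open import Relation.Nullary using (¬_; yes; no)

  module RealFacts (R : Reals) where
    open Reals R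
    open PowerLog R
    open CommutativeRing commutativeRing
      using (refl; sym; trans; reflexive; +-cong; *-cong; +-congˡ; +-congʳ; *-congˡ; *-congʳ;
             +-comm; +-assoc; *-comm; *-assoc; *-identityˡ; *-identityʳ; +-identityʳ; +-identityˡ; distribˡ; distribʳ; zeroˡ; zeroʳ;
             -‿inverseʳ; -‿cong; commutativeSemiring)
    open IsDecTotalOrder isDecTotalOrder using (antisym; total; _≤?_; ≤-respˡ-≈; ≤-respʳ-≈)
      renaming (refl to ≤-refl; trans to ≤-trans; reflexive to ≤-reflexive)
    open import Algebra.Properties.Ring ring using (-‿distribˡ-*; -‿distribʳ-*; -‿involutive; x[y-z]≈xy-xz)
    open import Algebra.Properties.Semiring.Mult semiring using (×-homo-+; ×1-homo-*)
    open import Algebra.Properties.Semiring.Exp semiring using (^-homo-*; ^-assocʳ; ^-congˡ)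
    open import Algebra.Properties.CommutativeSemiring.Exp commutativeSemiring using (^-distrib-*)

    poset : Poset _ _ _
    poset = record { isPartialOrder = IsDecTotalOrder.isPartialOrder isDecTotalOrder }

    open PosetReasoning poset

    fromℕ-+ : ∀ m n → fromℕ (m ℕ.+ n) ≈ fromℕ m + fromℕ n
    fromℕ-+ = ×-homo-+ 1#

    fromℕ-* : ∀ m n → fromℕ (m ℕ.* n) ≈ fromℕ m * fromℕ n
    fromℕ-* = ×1-homo-*

    fromℕ-^ : ∀ m n → fromℕ (m ℕ.^ n) ≈ fromℕ m ^ n
    fromℕ-^ m zero    = +-identityʳ 1#
    fromℕ-^ m (suc n) = trans (fromℕ-* m (m ℕ.^ n)) (*-congˡ (fromℕ-^ m n))

    fromℕ-1 : fromℕ 1 ≈ 1#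
    fromℕ-1 = +-identityʳ 1#

    +-mono₂ : ∀ {w x y z} → w ≤ x → y ≤ z → w + y ≤ x + z
    +-mono₂ {x = x} {y} w≤x y≤z = ≤-trans (+-mono y w≤x) (+-monoʳ x y≤z)

    *-mono₂ : ∀ {w x y z} → 0# ≤ w → 0# ≤ y → w ≤ x → y ≤ z → w * y ≤ x * z
    *-mono₂ {x = x} {y} 0≤w 0≤y w≤x y≤z =
      ≤-trans (*-mono y 0≤y w≤x) (*-monoʳ x (≤-trans 0≤w w≤x) y≤z)

    0<-mono : ∀ {x y} → 0# < x → x ≤ y → 0# < y
    0<-mono (0≤x , 0≉x) x≤y = ≤-trans 0≤x x≤y , λ 0≈y → 0≉x (antisym 0≤x (≤-trans x≤y (≤-reflexive (sym 0≈y))))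

    pos⇒≉0 : ∀ {x} → 0# < x → ¬ x ≈ 0#
    pos⇒≉0 (_ , 0≉x) x≈0 = 0≉x (sym x≈0)

    inv-pos : ∀ {x} (0<x : 0# < x) → 0# < inv x (pos⇒≉0 0<x)
    inv-pos {x} 0<x with inv x (pos⇒≉0 0<x) ≤? 0#
    ... | no ≰0 = ≰⇒> ≰0
    ... | yes ≤0 = ⊥-elim (<⇒≱ 0<1 (begin
      1#                              ≈⟨ sym (*-inv x (pos⇒≉0 0<x)) ⟩
      x * inv x (pos⇒≉0 0<x)          ≤⟨ *-monoʳ x (proj₁ 0<x) ≤0 ⟩
      x * 0#                          ≈⟨ zeroʳ x ⟩
      0#                              ∎))

    inv-cong : ∀ {x y} (x≉0 : ¬ x ≈ 0#) (y≉0 : ¬ y ≈ 0#) → x ≈ y → inv x x≉0 ≈ inv y y≉0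
    inv-cong {x} {y} x≉0 y≉0 x≈y = *-cancel-≈ x x≉0 (trans (*-comm _ x) (trans (*-inv x x≉0)
      (trans (sym (*-inv y y≉0)) (trans (*-comm y _) (*-congˡ (sym x≈y))))))

    1^ : ∀ n → 1# ^ n ≈ 1#
    1^ zero    = refl
    1^ (suc n) = trans (*-identityˡ _) (1^ n)

    log₂≤ : ∀ {n} L → .{{_ : NonZero n}} → n ℕ.< 2 ℕ.^ L → log₂ (fromℕ n) (1≤fromℕ n) ≤ fromℕ L
    log₂≤ {n} L n<2^L = sup≤ (log₂-isSup (fromℕ n) (1≤fromℕ n)) bound
      where
      bound : ∀ x → pow 2# (1≤fromℕ 2) x ≤ fromℕ n → x ≤ fromℕ L
      bound x pow≤n with total x (fromℕ L)
      ... | inj₁ x≤L = x≤L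
      ... | inj₂ L≤x = ⊥-elim (ℕₚ.<⇒≱ n<2^L (fromℕ-reflects (begin
        fromℕ (2 ℕ.^ L)      ≈⟨ fromℕ-^ 2 L ⟩
        2# ^ L               ≤⟨ proj₁ (pow-isSup 2# (1≤fromℕ 2) x) (2# ^ L) (belowPower L 0 1 _
                                  (≤-trans L≤x (≤-reflexive (sym (trans (+-identityˡ _)
                                    (trans (*-congʳ fromℕ-1) (*-identityˡ x))))))
                                  (0≤^ L (0≤fromℕ 2))
                                  (≤-reflexive (trans (*-identityʳ _) (*-identityʳ _)))) ⟩
        pow 2# (1≤fromℕ 2) x ≤⟨ pow≤n ⟩
        fromℕ n              ∎)))

    -- Connects the program's `q = suc k` with `c`: rounding `d` adds at most one unit, hence at
    -- most `L`, so `k * L ≤ (c + 1) * L`.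
    quotient≤ : ∀ {c n d L k} .{{_ : NonZero n}} → 0# < c → n ℕ.< 2 ℕ.^ L → 1 ℕ.≤ L →
      d IsRounded c log n → k ℕ.* L ℕ.≤ d → fromℕ (suc k) ≤ c + 2#
    quotient≤ {c} {n} {d} {L} {k} 0<c n<2^L 1≤L (d<clog+1 , _) kL≤d = begin
      1# + fromℕ k         ≤⟨ +-monoʳ 1# (*-cancel (fromℕ L) (0<-mono 0<1 1≤Lᵣ) scaled) ⟩
      1# + (c + 1#)        ≈⟨ trans (+-comm 1# _) (+-assoc c 1# 1#) ⟩
      c + (1# + 1#)        ≈⟨ +-congˡ (+-congˡ (sym fromℕ-1)) ⟩
      c + 2#               ∎
      where
      1≤Lᵣ : 1# ≤ fromℕ L
      1≤Lᵣ = ≤-trans (≤-reflexive (sym fromℕ-1)) (fromℕ-mono 1≤L)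
      scaled : fromℕ k * fromℕ L ≤ (c + 1#) * fromℕ L
      scaled = begin
        fromℕ k * fromℕ L                             ≈⟨ sym (fromℕ-* k L) ⟩
        fromℕ (k ℕ.* L)                               ≤⟨ fromℕ-mono kL≤d ⟩
        fromℕ d                                       ≤⟨ proj₁ d<clog+1 ⟩
        c * log₂ (fromℕ n) (1≤fromℕ n) + 1#
          ≤⟨ +-mono₂ (*-monoʳ c (proj₁ 0<c) (log₂≤ L n<2^L)) 1≤Lᵣ ⟩
        c * fromℕ L + fromℕ L                         ≈⟨ +-congˡ (sym (*-identityˡ _)) ⟩
        c * fromℕ L + 1# * fromℕ L                    ≈⟨ sym (distribʳ (fromℕ L) c 1#) ⟩
        (c + 1#) * fromℕ L                            ∎

    -- If t 2ᵘ ≤ C n² and n ≤ 2^(uH) then (t/C)^H n ≤ n^(2H), which places t/C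
    -- below n^(2 - 1/H).
    time≤pow : ∀ {s} t C u H n .{{_ : NonZero n}} → 1 ℕ.≤ C → 1 ℕ.≤ H →
      t ℕ.* 2 ℕ.^ u ℕ.≤ C ℕ.* (n ℕ.* n) → n ℕ.≤ 2 ℕ.^ (u ℕ.* H) → fromℕ H * s ≤ 1# →
      fromℕ t ≤ fromℕ C * pow (fromℕ n) (1≤fromℕ n) (2# - s)
    time≤pow {s} t C u H n 1≤C 1≤H t2^u≤ n≤ Hs≤1 = begin
      fromℕ t                       ≈⟨ sym tC ⟩
      fromℕ C * y                   ≤⟨ *-monoʳ (fromℕ C) (0≤fromℕ C)
                                         (proj₁ (pow-isSup (fromℕ n) (1≤fromℕ n) (2# - s)) y below) ⟩
      fromℕ C * pow (fromℕ n) (1≤fromℕ n) (2# - s) ∎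
      where
      0<C : 0# < fromℕ C
      0<C = 0<-mono 0<1 (≤-trans (≤-reflexive (sym fromℕ-1)) (fromℕ-mono 1≤C))
      C⁻¹ = inv (fromℕ C) (pos⇒≉0 0<C)
      y = fromℕ t * C⁻¹
      yC : y * fromℕ C ≈ fromℕ t
      yC = trans (*-assoc _ _ _)
        (trans (*-congˡ (trans (*-comm _ _) (*-inv (fromℕ C) (pos⇒≉0 0<C)))) (*-identityʳ _))
      tC : fromℕ C * y ≈ fromℕ t
      tC = trans (*-comm _ _) yC

      integral : t ℕ.^ H ℕ.* n ℕ.≤ n ℕ.^ (2 ℕ.* H) ℕ.* C ℕ.^ H
      integral = ℕₚ.≤-trans (ℕₚ.*-monoʳ-≤ (t ℕ.^ H) n≤) (ℕₚ.≤-trans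
        (ℕₚ.≤-reflexive (≡.trans (≡.cong (t ℕ.^ H ℕ.*_) (≡.sym (ℕₚ.^-*-assoc 2 u H)))
          (≡.sym (^-distribʳ-* t (2 ℕ.^ u) H))))
        (ℕₚ.≤-trans (ℕₚ.^-monoˡ-≤ H t2^u≤) (ℕₚ.≤-reflexive
          (≡.trans (^-distribʳ-* C (n ℕ.* n) H) (≡.trans (ℕₚ.*-comm (C ℕ.^ H) _)
            (≡.cong (ℕ._* C ℕ.^ H) (≡.trans (≡.cong (ℕ._^ H) (≡.cong (n ℕ.*_) (≡.sym (ℕₚ.*-identityʳ n))))
              (ℕₚ.^-*-assoc n 2 H))))))))

      below : BelowPower (fromℕ n) (2# - s) y
      -- The rational exponent is `(2H - 1) / H = 2 - 1/H`, which `Hs≤1` places below `2 - s`.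
      below = belowPower (2 ℕ.* H) 1 H (ℕ.>-nonZero 1≤H) exponent
        (*-nonneg (0≤fromℕ t) (proj₁ (inv-pos 0<C))) value
        where
        exponent : fromℕ (2 ℕ.* H) ≤ fromℕ 1 + fromℕ H * (2# - s)
        exponent = begin
          fromℕ (2 ℕ.* H)                               ≈⟨ trans (fromℕ-* 2 H) (*-comm _ _) ⟩
          fromℕ H * 2#                                  ≈⟨ sym (cancel+ _ _) ⟩
          fromℕ H * 2# - fromℕ H * s + fromℕ H * s      ≤⟨ +-monoʳ _ Hs≤1 ⟩
          fromℕ H * 2# - fromℕ H * s + 1#
            ≈⟨ +-cong (sym (x[y-z]≈xy-xz (fromℕ H) 2# s)) (sym fromℕ-1) ⟩
          fromℕ H * (2# - s) + fromℕ 1                  ≈⟨ +-comm _ _ ⟩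
          fromℕ 1 + fromℕ H * (2# - s)                  ∎
        value : y ^ H * fromℕ n ^ 1 ≤ fromℕ n ^ (2 ℕ.* H)
        value = *-cancel (fromℕ C ^ H) (0<^ (≤-trans (≤-reflexive (sym fromℕ-1)) (fromℕ-mono 1≤C)) H) (begin
          y ^ H * fromℕ n ^ 1 * fromℕ C ^ H        ≈⟨ *-congʳ (*-congˡ (*-identityʳ _)) ⟩
          y ^ H * fromℕ n * fromℕ C ^ H
            ≈⟨ trans (*-assoc _ _ _) (trans (*-congˡ (*-comm _ _)) (sym (*-assoc _ _ _))) ⟩
          y ^ H * fromℕ C ^ H * fromℕ n            ≈⟨ *-congʳ (sym (^-distrib-* y (fromℕ C) H)) ⟩
          (y * fromℕ C) ^ H * fromℕ n              ≈⟨ *-congʳ (trans (^-congˡ H yC) (sym (fromℕ-^ t H))) ⟩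
          fromℕ (t ℕ.^ H) * fromℕ n                ≈⟨ sym (fromℕ-* (t ℕ.^ H) n) ⟩
          fromℕ (t ℕ.^ H ℕ.* n)                    ≤⟨ fromℕ-mono integral ⟩
          fromℕ (n ℕ.^ (2 ℕ.* H) ℕ.* C ℕ.^ H)
            ≈⟨ trans (fromℕ-* (n ℕ.^ (2 ℕ.* H)) (C ℕ.^ H)) (*-cong (fromℕ-^ n (2 ℕ.* H)) (fromℕ-^ C H)) ⟩
          fromℕ n ^ (2 ℕ.* H) * fromℕ C ^ H        ∎)

    -- For `y` below the power, `y ^ q * c ^ (k * q + p) ≤ y ^ q * c ^ r ≤ c ^ p`; hence `(y * c ^
    -- k) ^ q ≤ 1`, and the root can be taken.
    pow-neg : ∀ {c} (1≤c : 1# ≤ c) k → pow c 1≤c (- fromℕ k) ≤ inv (c ^ k) (pos⇒≉0 (0<^ 1≤c k))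
    pow-neg {c} 1≤c k = sup≤ (pow-isSup c 1≤c (- fromℕ k)) bound
      where
      0<cᵏ = 0<^ 1≤c k
      cᵏ≉0 = pos⇒≉0 0<cᵏ
      bound : ∀ y → BelowPower c (- fromℕ k) y → y ≤ inv (c ^ k) cᵏ≉0
      bound y (belowPower p r q q≢0 exponent≤ 0≤y value≤) = *-cancel (c ^ k) 0<cᵏ (begin
        y * c ^ k                   ≤⟨ ^-reflects q q≢0 0<1 (≤-trans root (≤-reflexive (sym (1^ q)))) ⟩
        1#                          ≈⟨ sym (trans (*-comm _ _) (*-inv (c ^ k) cᵏ≉0)) ⟩
        inv (c ^ k) cᵏ≉0 * c ^ k    ∎)
        where
        exponents : k ℕ.* q ℕ.+ p ℕ.≤ r
        exponents = fromℕ-reflects (begin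
          fromℕ (k ℕ.* q ℕ.+ p)                                   ≈⟨ fromℕ-+ (k ℕ.* q) p ⟩
          fromℕ (k ℕ.* q) + fromℕ p                               ≤⟨ +-monoʳ _ exponent≤ ⟩
          fromℕ (k ℕ.* q) + (fromℕ r + fromℕ q * - fromℕ k)
            ≈⟨ +-cong (trans (fromℕ-* k q) (*-comm _ _))
                 (trans (+-comm _ _) (+-congʳ (sym (-‿distribʳ-* _ _)))) ⟩
          fromℕ q * fromℕ k + (- (fromℕ q * fromℕ k) + fromℕ r)   ≈⟨ sym (+-assoc _ _ _) ⟩
          fromℕ q * fromℕ k - fromℕ q * fromℕ k + fromℕ r         ≈⟨ +-congʳ (-‿inverseʳ _) ⟩
          0# + fromℕ r                                            ≈⟨ +-identityˡ _ ⟩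
          fromℕ r                                                 ∎)
        root : (y * c ^ k) ^ q ≤ 1#
        root = *-cancel (c ^ p) (0<^ 1≤c p) (begin
          (y * c ^ k) ^ q * c ^ p
            ≈⟨ *-congʳ (trans (^-distrib-* y (c ^ k) q) (*-congˡ (^-assocʳ c k q))) ⟩
          y ^ q * c ^ (k ℕ.* q) * c ^ p
            ≈⟨ trans (*-assoc _ _ _) (*-congˡ (sym (^-homo-* c (k ℕ.* q) p))) ⟩
          y ^ q * c ^ (k ℕ.* q ℕ.+ p)       ≤⟨ *-monoʳ (y ^ q) (0≤^ q 0≤y) (^-monoʳ 1≤c exponents) ⟩
          y ^ q * c ^ r                     ≤⟨ value≤ ⟩
          c ^ p                             ≈⟨ sym (*-identityˡ _) ⟩
          1# * c ^ p                        ∎)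

    0≤square : ∀ c → 0# ≤ c * c
    0≤square c with total 0# c
    ... | inj₁ 0≤c = *-nonneg 0≤c 0≤c
    ... | inj₂ c≤0 = ≤-respʳ-≈ (trans (sym (-‿distribˡ-* c (- c)))
        (trans (-‿cong (sym (-‿distribʳ-* c c))) (-‿involutive (c * c)))) (*-nonneg 0≤-c 0≤-c)
      where
      0≤-c : 0# ≤ - c
      0≤-c = ≤-respʳ-≈ (+-identityˡ (- c)) (≤⇒0≤- c≤0)

    shift≤ : ∀ {c} → 0# < c → c + 2# ≤ fromℕ 3 * (c * c + 1#)
    shift≤ {c} 0<c = begin
      c + 2#                              ≤⟨ +-mono₂ c≤w (+-mono₂ 1≤w (+-mono₂ 1≤w ≤-refl)) ⟩
      w + (w + (w + 0#))                  ≈⟨ sym (+-cong (*-identityˡ w)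
                                                 (+-cong (*-identityˡ w) (+-cong (*-identityˡ w) (zeroˡ w)))) ⟩
      1# * w + (1# * w + (1# * w + 0# * w)) ≈⟨ sym (trans (distribʳ w _ _)
                                                 (+-congˡ (trans (distribʳ w _ _) (+-congˡ (distribʳ w _ _))))) ⟩
      fromℕ 3 * w                         ∎
      where
      w = c * c + 1#
      1≤w : 1# ≤ w
      1≤w = ≤-respˡ-≈ (+-identityˡ 1#) (+-mono 1# (0≤square c))
      c≤w : c ≤ w
      c≤w with total c 1#
      ... | inj₁ c≤1 = ≤-trans c≤1 1≤w
      ... | inj₂ 1≤c = begin
        c          ≈⟨ sym (*-identityʳ c) ⟩
        c * 1#     ≤⟨ *-monoʳ c (proj₁ 0<c) 1≤c ⟩
        c * c      ≤⟨ x≤1+x (c * c) ⟩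
        1# + c * c ≈⟨ +-comm 1# (c * c) ⟩
        w          ∎

    -- For κ = 72, loss c exceeds 16 e⁵ for the scale e ≤ 72 (c + 2) of the program;
    -- c + 2 is replaced by 3 (c² + 1) because that is positive for every real c.
    module Saving (κ : ℕ) (1≤κ : 1 ℕ.≤ κ) where

      base : Carrier → Carrier
      base c = fromℕ κ * (fromℕ 3 * (c * c + 1#))

      loss : Carrier → Carrier
      loss c = 1# + fromℕ 16 * base c ^ 5

      0≤base : ∀ c → 0# ≤ base c
      0≤base c = *-nonneg (0≤fromℕ κ) (*-nonneg (0≤fromℕ 3)
        (≤-trans (0≤square c) (≤-trans (x≤1+x _) (≤-reflexive (+-comm 1# _)))))

      1<loss : ∀ c → 1# < loss c
      1<loss c = ≰⇒> λ loss≤1 → <⇒≱ 0<extra (+-cancel 1# (begin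
        fromℕ 16 * base c ^ 5 + 1#    ≈⟨ +-comm _ 1# ⟩
        loss c                        ≤⟨ loss≤1 ⟩
        1#                            ≈⟨ sym (+-identityˡ 1#) ⟩
        0# + 1#                       ∎))
        where
        1≤fromℕ′ : ∀ {n} → 1 ℕ.≤ n → 1# ≤ fromℕ n
        1≤fromℕ′ 1≤n = ≤-trans (≤-reflexive (sym fromℕ-1)) (fromℕ-mono 1≤n)
        1≤* : ∀ {x y} → 1# ≤ x → 1# ≤ y → 1# ≤ x * y
        1≤* 1≤x 1≤y = ≤-trans (≤-reflexive (sym (*-identityˡ 1#))) (*-mono₂ 0≤1 0≤1 1≤x 1≤y)
        1≤w : 1# ≤ c * c + 1#
        1≤w = ≤-respˡ-≈ (+-identityˡ 1#) (+-mono 1# (0≤square c))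
        0<extra : 0# < fromℕ 16 * base c ^ 5
        0<extra = 0<-mono 0<1 (1≤* (1≤fromℕ 16) (1≤^ (1≤* (1≤fromℕ′ 1≤κ) (1≤* (1≤fromℕ 3) 1≤w)) 5))

      0<loss : ∀ c → 0# < loss c
      0<loss c = 0<-mono 0<1 (proj₁ (1<loss c))

      saving : Carrier → Carrier
      saving c = inv (loss c) (pos⇒≉0 (0<loss c))

      loss*saving : ∀ c → loss c * saving c ≈ 1#
      loss*saving c = *-inv (loss c) (pos⇒≉0 (0<loss c))

      saving-cong : Congruent _≈_ _≈_ saving
      saving-cong {c} {c′} c≈c′ = inv-cong (pos⇒≉0 (0<loss c)) (pos⇒≉0 (0<loss c′))
        (+-congˡ (*-congˡ (^-congˡ 5 (*-congˡ (*-congˡ (+-congʳ (*-cong c≈c′ c≈c′)))))))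

      0<saving : ∀ c → 0# < saving c
      0<saving c = inv-pos (0<loss c)

      saving<1 : ∀ c → saving c < 1#
      saving<1 c = ≰⇒> λ 1≤saving → <⇒≱ (1<loss c) (begin
        loss c             ≈⟨ sym (*-identityʳ _) ⟩
        loss c * 1#        ≤⟨ *-monoʳ (loss c) (proj₁ (0<loss c)) 1≤saving ⟩
        loss c * saving c  ≈⟨ loss*saving c ⟩
        1#                 ∎)

      -- Provides the hypothesis `fromℕ H * s ≤ 1#` of `time≤pow` for `H = 16 * h`, with `h` the
      -- fifth power of the scale.
      saving≤ : ∀ {c q} → 0# < c → fromℕ q ≤ c + 2# → let e = κ ℕ.* q in
        fromℕ (16 ℕ.* (e ℕ.* (e ℕ.* e ℕ.* (e ℕ.* e)))) * saving c ≤ 1#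
      saving≤ {c} {q} 0<c q≤ =
        ≤-trans (*-mono (saving c) (proj₁ (0<saving c)) fifth) (≤-reflexive (loss*saving c))
        where
        e = κ ℕ.* q
        e≤base : fromℕ e ≤ base c
        e≤base = ≤-trans (≤-reflexive (fromℕ-* κ q)) (*-monoʳ (fromℕ κ) (0≤fromℕ κ) (≤-trans q≤ (shift≤ 0<c)))
        power : ∀ e → e ℕ.* (e ℕ.* e ℕ.* (e ℕ.* e)) ≡ e ℕ.* (e ℕ.* (e ℕ.* (e ℕ.* (e ℕ.* 1))))
        power = solve-∀
        fifth : fromℕ (16 ℕ.* (e ℕ.* (e ℕ.* e ℕ.* (e ℕ.* e)))) ≤ loss c
        fifth = begin
          fromℕ (16 ℕ.* (e ℕ.* (e ℕ.* e ℕ.* (e ℕ.* e))))  ≈⟨ fromℕ-* 16 (e ℕ.* (e ℕ.* e ℕ.* (e ℕ.* e))) ⟩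
          fromℕ 16 * fromℕ (e ℕ.* (e ℕ.* e ℕ.* (e ℕ.* e)))
            ≈⟨ *-congˡ (trans (reflexive (≡.cong fromℕ (power e))) (fromℕ-^ e 5)) ⟩
          fromℕ 16 * fromℕ e ^ 5
            ≤⟨ *-monoʳ (fromℕ 16) (0≤fromℕ 16) (^-monoˡ 5 (0≤fromℕ e) e≤base) ⟩
          fromℕ 16 * base c ^ 5                           ≤⟨ x≤1+x _ ⟩
          loss c                                          ∎

      loss-constant : Carrier
      loss-constant = 1# + fromℕ 16 * (fromℕ κ * (fromℕ 3 * 2#)) ^ 5

      -- The source of the exponent 10: for `c ≥ 1` the base is at most a constant times `c * c`,
      -- and it enters with its fifth power.
      loss≤ : ∀ {c} → 1# ≤ c → loss c ≤ loss-constant * c ^ 10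
      loss≤ {c} 1≤c = begin
        1# + fromℕ 16 * base c ^ 5
          ≤⟨ +-mono₂ (1≤^ 1≤c 10) (*-monoʳ (fromℕ 16) (0≤fromℕ 16) (^-monoˡ 5 (0≤base c) base≤)) ⟩
        c ^ 10 + fromℕ 16 * (b * (c * c)) ^ 5
          ≈⟨ +-cong (sym (*-identityˡ _)) (*-congˡ (trans (^-distrib-* b (c * c) 5) (*-congˡ
               (trans (^-distrib-* c c 5) (sym (^-homo-* c 5 5)))))) ⟩
        1# * c ^ 10 + fromℕ 16 * (b ^ 5 * c ^ 10)
          ≈⟨ +-congˡ (sym (*-assoc _ _ _)) ⟩
        1# * c ^ 10 + fromℕ 16 * b ^ 5 * c ^ 10
          ≈⟨ sym (distribʳ (c ^ 10) _ _) ⟩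
        loss-constant * c ^ 10 ∎
        where
        b = fromℕ κ * (fromℕ 3 * 2#)
        1≤cc : 1# ≤ c * c
        1≤cc = ≤-trans (≤-reflexive (sym (*-identityˡ 1#))) (*-mono₂ 0≤1 0≤1 1≤c 1≤c)
        w≤ : c * c + 1# ≤ 2# * (c * c)
        w≤ = begin
          c * c + 1#                            ≤⟨ +-monoʳ (c * c) 1≤cc ⟩
          c * c + c * c
            ≈⟨ sym (+-cong (*-identityˡ _) (trans (*-congʳ fromℕ-1) (*-identityˡ _))) ⟩
          1# * (c * c) + fromℕ 1 * (c * c)      ≈⟨ sym (distribʳ (c * c) 1# (fromℕ 1)) ⟩
          2# * (c * c)                          ∎
        base≤ : base c ≤ b * (c * c)
        base≤ = begin
          fromℕ κ * (fromℕ 3 * (c * c + 1#))      ≤⟨ *-monoʳ _ (0≤fromℕ κ) (*-monoʳ _ (0≤fromℕ 3) w≤) ⟩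
          fromℕ κ * (fromℕ 3 * (2# * (c * c)))    ≈⟨ sym (trans (*-assoc _ _ _) (*-congˡ (*-assoc _ _ _))) ⟩
          b * (c * c)                             ∎

      0<loss-constant : 0# < loss-constant
      0<loss-constant = 0<-mono (0<loss 1#) (≤-trans (loss≤ ≤-refl)
        (≤-reflexive (trans (*-congˡ (1^ 10)) (*-identityʳ _))))

      δ : Carrier
      δ = inv loss-constant (pos⇒≉0 0<loss-constant)

      saving-polynomial : ∀ c (1≤c : 1# ≤ c) → δ * pow c 1≤c (- fromℕ 10) ≤ saving c
      saving-polynomial c 1≤c = *-cancel (loss c) (0<loss c) (begin
        δ * pow c 1≤c (- fromℕ 10) * loss c
          ≤⟨ *-mono (loss c) (proj₁ (0<loss c)) (*-monoʳ δ 0≤δ (pow-neg 1≤c 10)) ⟩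
        δ * y * loss c
          ≤⟨ *-monoʳ (δ * y) (*-nonneg 0≤δ (proj₁ (inv-pos 0<c¹⁰))) (loss≤ 1≤c) ⟩
        δ * y * (loss-constant * c ^ 10)
          ≈⟨ trans (*-assoc _ _ _) (*-congˡ (trans (sym (*-assoc _ _ _))
               (trans (*-congʳ (*-comm _ _)) (*-assoc _ _ _)))) ⟩
        δ * (loss-constant * (y * c ^ 10))  ≈⟨ sym (*-assoc _ _ _) ⟩
        δ * loss-constant * (y * c ^ 10)
          ≈⟨ *-cong (trans (*-comm _ _) (*-inv loss-constant (pos⇒≉0 0<loss-constant)))
               (trans (*-comm _ _) (*-inv (c ^ 10) (pos⇒≉0 0<c¹⁰))) ⟩
        1# * 1#                             ≈⟨ *-identityˡ 1# ⟩
        1#                                  ≈⟨ sym (trans (*-comm _ _) (loss*saving c)) ⟩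
        saving c * loss c                   ∎)
        where
        0<c¹⁰ = 0<^ 1≤c 10
        y = inv (c ^ 10) (pos⇒≉0 0<c¹⁰)
        0≤δ = proj₁ (inv-pos 0<loss-constant)

-- From counted calls to the bound with exponent 2 - s(c)

open import Defs
open Evaluation
open Algorithm
open Powers
open Recurrence
open Lists
open Search
open Main
open Estimate
open RealBounds
open import Data.Empty using (⊥-elim)
open import Data.List.Base using ([])
open import Data.Nat.Base as ℕ using (ℕ; zero; suc; NonZero; z≤n; s≤s)
import Data.Nat.Properties as ℕₚ
open import Data.Nat.Tactic.RingSolver using (solve-∀)
open import Data.Product.Base using (∃-syntax; _×_; _,_; proj₁; proj₂)
open import Data.Vec.Base using ([]; _∷_)
open import Function.Definitions using (Congruent)
open import Relation.Binary.PropositionalEquality as ≡ using (_≡_)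
open import Relation.Binary.Structures using (IsDecTotalOrder)
open import Relation.Nullary using (yes; no)

binary-length : ∀ n → ∃[ ℓ ] suc n ℕ.< 2 ℕ.^ ℓ × 2 ℕ.^ ℓ ℕ.≤ 2 ℕ.* suc n
binary-length zero = 1 , ℕₚ.≤-refl , ℕₚ.≤-refl
binary-length (suc n) with binary-length n
... | ℓ , above , below with suc (suc n) ℕₚ.<? 2 ℕ.^ ℓ
...   | yes above′ = ℓ , above′ , ℕₚ.≤-trans below (ℕₚ.*-monoʳ-≤ 2 (ℕₚ.n≤1+n (suc n)))
...   | no ≮ = suc ℓ , ℕₚ.≤-<-trans above (ℕₚ.^-monoʳ-< 2 ℕₚ.≤-refl (ℕₚ.n<1+n ℓ)) ,
    ℕₚ.*-monoʳ-≤ 2 (ℕₚ.≮⇒≥ ≮)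

^2-reflects-< : ∀ {a b} → 2 ℕ.^ a ℕ.< 2 ℕ.^ b → a ℕ.< b
^2-reflects-< {a} {b} 2^a<2^b with a ℕₚ.<? b
... | yes a<b = a<b
... | no a≮b = ⊥-elim (ℕₚ.<⇒≱ 2^a<2^b (ℕₚ.^-monoʳ-≤ 2 (ℕₚ.≮⇒≥ a≮b)))

-- The costs are stated with the `ℓ` of the analysis, the estimates with the `L` that the program
-- computes; both satisfy these bounds and are thereby identified.
binary-length-unique : ∀ {n a b} → n ℕ.< 2 ℕ.^ a → 2 ℕ.^ a ℕ.≤ 2 ℕ.* n →
                       n ℕ.< 2 ℕ.^ b → 2 ℕ.^ b ℕ.≤ 2 ℕ.* n → a ≡ b
binary-length-unique {n} {a} {b} n<a a≤n n<b b≤n =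
  ℕₚ.≤-antisym (bounded {a} {b} a≤n n<b) (bounded {b} {a} b≤n n<a)
  where
  bounded : ∀ {a b} → 2 ℕ.^ a ℕ.≤ 2 ℕ.* n → n ℕ.< 2 ℕ.^ b → a ℕ.≤ b
  bounded {a} {b} a≤n n<b = ℕₚ.≤-pred (^2-reflects-< {a} {suc b} (ℕₚ.≤-<-trans a≤n (ℕₚ.*-monoʳ-< 2 n<b)))

total-time : ∀ {t s calls K u n c c′} → t ℕ.≤ s ℕ.+ calls ℕ.* K → calls ℕ.* 2 ℕ.^ u ℕ.≤ c ℕ.* (n ℕ.* n) →
  c ℕ.≤ c′ → 2 ℕ.^ u ℕ.≤ 2 ℕ.* n → 1 ℕ.≤ n →
  t ℕ.* 2 ℕ.^ u ℕ.≤ suc (2 ℕ.* s ℕ.+ c′ ℕ.* K) ℕ.* (n ℕ.* n)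
total-time {t} {s} {calls} {K} {u} {n} {c} {c′} t≤ calls≤ c≤c′ 2^u≤ 1≤n = begin
  t ℕ.* 2 ℕ.^ u                                            ≤⟨ ℕₚ.*-monoˡ-≤ (2 ℕ.^ u) t≤ ⟩
  (s ℕ.+ calls ℕ.* K) ℕ.* 2 ℕ.^ u                          ≡⟨ distribute s calls K (2 ℕ.^ u) ⟩
  s ℕ.* 2 ℕ.^ u ℕ.+ calls ℕ.* 2 ℕ.^ u ℕ.* K
    ≤⟨ ℕₚ.+-mono-≤ (ℕₚ.*-monoʳ-≤ s (ℕₚ.≤-trans 2^u≤ (ℕₚ.*-monoʳ-≤ 2 (ℕₚ.≤-trans
         (ℕₚ.≤-reflexive (≡.sym (ℕₚ.*-identityʳ n))) (ℕₚ.*-monoʳ-≤ n 1≤n)))))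
         (ℕₚ.*-monoˡ-≤ K (ℕₚ.≤-trans calls≤ (ℕₚ.*-monoˡ-≤ (n ℕ.* n) c≤c′))) ⟩
  -- The added `n * n` makes the constant a successor, so that `time≤pow` may divide by it.
  s ℕ.* (2 ℕ.* (n ℕ.* n)) ℕ.+ c′ ℕ.* (n ℕ.* n) ℕ.* K       ≤⟨ ℕₚ.m≤n+m _ (n ℕ.* n) ⟩
  n ℕ.* n ℕ.+ (s ℕ.* (2 ℕ.* (n ℕ.* n)) ℕ.+ c′ ℕ.* (n ℕ.* n) ℕ.* K) ≡⟨ collect s c′ K (n ℕ.* n) ⟩
  suc (2 ℕ.* s ℕ.+ c′ ℕ.* K) ℕ.* (n ℕ.* n)                 ∎
  where
  open ℕₚ.≤-Reasoning
  distribute : ∀ s c K U → (s ℕ.+ c ℕ.* K) ℕ.* U ≡ s ℕ.* U ℕ.+ c ℕ.* U ℕ.* K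
  distribute = solve-∀
  collect : ∀ s c K M → M ℕ.+ (s ℕ.* (2 ℕ.* M) ℕ.+ c ℕ.* M ℕ.* K) ≡ suc (2 ℕ.* s ℕ.+ c ℕ.* K) ℕ.* M
  collect = solve-∀

fifth : ℕ → ℕ
fifth e = e ℕ.* (e ℕ.* e ℕ.* (e ℕ.* e))

fifth-mono : ∀ {e e′} → e ℕ.≤ e′ → fifth e ℕ.≤ fifth e′
fifth-mono e≤ = ℕₚ.*-mono-≤ e≤ (ℕₚ.*-mono-≤ (ℕₚ.*-mono-≤ e≤ e≤) (ℕₚ.*-mono-≤ e≤ e≤))

module Assembly (R : Reals) where
  open Reals R
  open PowerLog R
  open VectorDomination R
  open Spec R
  open Running R
  open RealFacts R
  open Saving 72 (s≤s z≤n) public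
  open IsDecTotalOrder isDecTotalOrder using () renaming (trans to ≤-trans)

  solves : Solves program
  solves record { elements = [] } B = _ , _ , _⊢_⇓_#_.run (#case-nil #var #nil) , none λ ()
  solves {M = suc M} {N} A@(record { elements = _ ∷ _ }) B =
    let z , _ , outcome , _ , counted run _ =
          -- For correctness any exponent covering both sizes will do, and `n < 2 ^ n` supplies one.
          main-spec (suc M ℕ.+ N) (PointSet.elements A) (PointSet.elements B)
          (ℕₚ.≤-trans (ℕₚ.m≤m+n (suc M) N) (ℕₚ.<⇒≤ (n<2^n _)))
          (ℕₚ.≤-trans (ℕₚ.m≤n+m N (suc M)) (ℕₚ.<⇒≤ (n<2^n _)))
    in z , _ , run , isAnswer A B outcome

  module _ (c : Carrier) (0<c : 0# < c) where
    private
      -- An integer above `c + 2` bounds the program's `q` for all admissible `N` and `d`, so the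
      -- constants below depend on `c` only.
      q̂ = proj₁ (archimedean (c + 2#))
      ê = 72 ℕ.* q̂

    constant : ℕ
    constant = suc (2 ℕ.* size (Program.main program) ℕ.+ coefficient q̂ ê ℕ.* K)

    -- From here on `8 * h ≤ L`, which is what `n≤2^16hu` asks for.
    threshold : ℕ
    threshold = 2 ℕ.^ (8 ℕ.* fifth ê)

    halts : ∀ N .{{_ : NonZero N}} d → threshold ℕ.≤ N → d IsRounded c log N →
            ∀ (A B : PointSet d N) →
            HaltsWithin program A B (fromℕ constant * pow (fromℕ N) (1≤fromℕ N) (2# - saving c))
    halts zero d threshold≤0 = ⊥-elim (ℕₚ.<⇒≱ (ℕₚ.m^n>0 2 (8 ℕ.* fifth ê)) threshold≤0)
    halts (suc n) d threshold≤N rounded A B =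
      let ℓ , N<2^ℓ , 2^ℓ≤2N = binary-length n
          z , calls , outcome , bound , counted {t} run t≤ =
            main-spec ℓ (PointSet.elements A) (PointSet.elements B) (ℕₚ.<⇒≤ N<2^ℓ) (ℕₚ.<⇒≤ N<2^ℓ)
      in z , t , run , within ℓ N<2^ℓ 2^ℓ≤2N bound t≤
      where
      within : ∀ {t calls} ℓ → suc n ℕ.< 2 ℕ.^ ℓ → 2 ℕ.^ ℓ ℕ.≤ 2 ℕ.* suc n →
        Calls≤ (suc n) (suc n) d ℓ calls → t ℕ.≤ size (Program.main program) ℕ.+ calls ℕ.* K →
        fromℕ t ≤ fromℕ constant * pow (fromℕ (suc n)) (1≤fromℕ (suc n)) (2# - saving c)
      within {t} {calls} ℓ N<2^ℓ 2^ℓ≤2N bound t≤ =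
        time≤pow t constant u (16 ℕ.* h) (suc n) (s≤s z≤n) (ℕₚ.≤-trans 1≤h (ℕₚ.m≤n*m h 16))
          (total-time {t} {size (Program.main program)} {calls} {K} {u} {suc n}
            {coefficient q e} {coefficient q̂ ê}
            t≤ (calls-bound {calls} {leaves} leafMass calls≤′)
            (coefficient-mono {q} {q̂} {e} {ê} q≤q̂ e≤ê) 2^u≤2n (s≤s z≤n))
          (n≤2^16hu 8h≤L)
          (≡.subst (λ e → fromℕ (16 ℕ.* fifth e) * saving c ≤ 1#) (≡.sym e≡) (saving≤ {c} {q} 0<c q≤c+2))
        where
        open Calls≤ bound
        open Estimates parameters
        calls≤′ : calls ℕ.≤ setupCost L d L e (suc n) (suc n)
                  ℕ.+ (nodeCost L (e ℕ.* e) d ℕ.* nodes J d ℕ.+ (2 ℕ.+ d) ℕ.* leaves)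
        calls≤′ = ≡.subst (λ ℓ → calls ℕ.≤ setupCost ℓ d L e (suc n) (suc n)
                    ℕ.+ (nodeCost ℓ (e ℕ.* e) d ℕ.* nodes J d ℕ.+ (2 ℕ.+ d) ℕ.* leaves))
          (binary-length-unique {suc n} {ℓ} {L} N<2^ℓ 2^ℓ≤2N n<2^L 2^L≤2n) calls≤
        1≤L : 1 ℕ.≤ L
        1≤L = ^2-reflects-< {0} {L} (ℕₚ.≤-<-trans (s≤s z≤n) n<2^L)
        q≤c+2 : fromℕ q ≤ c + 2#
        q≤c+2 = quotient≤ {c} {suc n} {d} {L} {k} 0<c n<2^L 1≤L rounded kL≤d
        q≤q̂ : q ℕ.≤ q̂
        q≤q̂ = fromℕ-reflects (≤-trans q≤c+2 (proj₂ (archimedean (c + 2#))))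
        e≤ê : e ℕ.≤ ê
        e≤ê = ≡.subst (ℕ._≤ ê) (≡.sym e≡) (ℕₚ.*-monoʳ-≤ 72 q≤q̂)
        8h≤L : 8 ℕ.* h ℕ.≤ L
        8h≤L = ℕₚ.≤-trans (ℕₚ.*-monoʳ-≤ 8 (fifth-mono e≤ê))
          (ℕₚ.<⇒≤ (^2-reflects-< {8 ℕ.* fifth ê} {L} (ℕₚ.≤-<-trans threshold≤N n<2^L)))

lemma3p1 :
  (R : Reals) →
  let open Reals R
      open PowerLog R
      open VectorDomination R
  in
  ∃[ P ] ∃[ s ]
    Solves P ×
    Congruent _≈_ _≈_ s ×
    (∀ c → 0# < c → 0# < s c × s c < 1#) ×
    (∃[ δ ] ∃[ K ] 0# < δ × 0# < K ×
      (∀ c (1≤c : 1# ≤ c) → δ * pow c 1≤c (- K) ≤ s c)) ×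
    (∀ c → 0# < c →
      ∃[ C ] ∃[ N₀ ] ∀ N .{{_ : NonZero N}} d → N₀ ℕ.≤ N → d IsRounded c log N →
        ∀ (A B : PointSet d N) →
        HaltsWithin P A B (C * pow (fromℕ N) (1≤fromℕ N) (2# - s c)))
lemma3p1 R = program , saving , solves , saving-cong , (λ c _ → 0<saving c , saving<1 c) ,
  (δ , fromℕ 10 , inv-pos 0<loss-constant , 0<-mono 0<1 (1≤fromℕ 10) , saving-polynomial) ,
  (λ c 0<c → fromℕ (constant c 0<c) , threshold c 0<c , halts c 0<c)
  where
  open Reals R
  open PowerLog R
  open RealFacts R
  open Assembly R
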